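{- Tree isomorphism can be maintained in $\mathrm{DynFOLL}$ under insertions and deletions of $\mathrm{polylog}(n)$ edges. That is, for forests $F=(V,E)$ subject to changes inserting or deleting up to $(\log n)^c$ edges at once (for an arbitrary fixed constant $c$, with the graph remaining a forest), there is a $\mathrm{DynFOLL}$ program maintaining the binary relation of all pairs of nodes $(x,x^*)$ such that the subtrees rooted at $x$ and $x^*$ are isomorphic (as rooted trees).
   Context: Dynamic complexity setting. All structures have domain $\{0,\dots,n-1\}$ with linear order. A dynamic program stores auxiliary relations over the same domain; for each auxiliary relation and change operation it has an update program which, evaluated on the changed input with the old auxiliary relations, defines the new auxiliary relation. The initial input is empty and initial auxiliary relations are first-order definable from it. The program maintains a query if after every sequence of allowed changes from the empty input a designated auxiliary relation equals the query result on the current input. $\mathrm{DynFOLL}$: update programs are DLOGTIME-uniform polynomial-size circuits of depth $O(\log\log n)$ with NOT gates and unbounded fan-in AND/OR gates, equivalently a first-order formula with $\leq,+,\times$ iterated $O(\log\log n)$ times. -}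

module Defs where

open import Level using (0ℓ)
open import Data.Nat using (ℕ; zero; suc; _+_; _*_; _^_; _≤_)
open import Data.Nat.Logarithm using (⌊log₂_⌋)
open import Data.Fin using (Fin; zero; suc; toℕ; splitAt; _≟_)
open import Data.Bool using (Bool; true; false; T; _∧_; _∨_; not; if_then_else_)
open import Data.List using (List; []; _∷_; map; allFin)
open import Data.Nat.ListAction using (sum)
open import Data.Product using (Σ; _×_; _,_; proj₁; proj₂)
open import Data.Sum using (_⊎_; inj₁; inj₂; [_,_])
open import Data.Empty using (⊥)
open import Data.Unit using (⊤)
open import Relation.Nullary using (¬_)
open import Relation.Nullary.Decidable using (⌊_⌋)
open import Relation.Binary.PropositionalEquality using (_≡_; subst; sym)
open import Relation.Binary.Construct.Closure.ReflexiveTransitive using (Star)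
open import Function.Bundles using (_⇔_)

-- Structures on the domain Fin N (linear order = order of Fin).
-- The input is a directed edge relation E (E u v: u is the parent of v),
-- represented as a Boolean matrix.

BRel : ℕ → Set
BRel N = Fin N → Fin N → Bool

emptyRel : ∀ {N} → BRel N
emptyRel _ _ = false

Reach : ∀ {N} → BRel N → Fin N → Fin N → Set
Reach E = Star (λ u v → T (E u v))

IsForest : ∀ {N} → BRel N → Set
IsForest {N} E =
  (∀ (u u' v : Fin N) → T (E u v) → T (E u' v) → u ≡ u')
  × (∀ (u v : Fin N) → T (E u v) → ¬ Reach E v u)

InSubtree : ∀ {N} → BRel N → Fin N → Fin N → Set
InSubtree E x v = Reach E x v

IsoSubtrees : ∀ {N} → BRel N → Fin N → Fin N → Set
IsoSubtrees {N} E x y =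
  Σ (Fin N → Fin N) λ f → Σ (Fin N → Fin N) λ g →
      (∀ v → InSubtree E x v → InSubtree E y (f v) × g (f v) ≡ v)
    × (∀ w → InSubtree E y w → InSubtree E x (g w) × f (g w) ≡ w)
    × f x ≡ y
    × (∀ u v → InSubtree E x u → InSubtree E x v →
         (T (E u v) ⇔ T (E (f u) (f v))))

card : ∀ {N} → BRel N → ℕ
card {N} R = sum (map (λ u → sum (map (λ v → if R u v then 1 else 0) (allFin N))) (allFin N))

-- First-order formulas over the vocabulary
--   ≤, PLUS, TIMES (built-in arithmetic),
--   E (input edge relation, after the change),
--   Δ (the set of changed edges),
--   auxiliary relation symbols R_i of arity ar i.
-- Variables are de Bruijn indices Fin k.

data Formula (m : ℕ) (ar : Fin m → ℕ) : ℕ → Set where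
  leq   : ∀ {k} → Fin k → Fin k → Formula m ar k
  plus  : ∀ {k} → Fin k → Fin k → Fin k → Formula m ar k
  times : ∀ {k} → Fin k → Fin k → Fin k → Formula m ar k
  inp   : ∀ {k} → Fin k → Fin k → Formula m ar k
  chg   : ∀ {k} → Fin k → Fin k → Formula m ar k
  aux   : ∀ {k} → (i : Fin m) → (Fin (ar i) → Fin k) → Formula m ar k
  neg   : ∀ {k} → Formula m ar k → Formula m ar k
  conj  : ∀ {k} → Formula m ar k → Formula m ar k → Formula m ar k
  disj  : ∀ {k} → Formula m ar k → Formula m ar k → Formula m ar k
  ex    : ∀ {k} → Formula m ar (suc k) → Formula m ar k
  all   : ∀ {k} → Formula m ar (suc k) → Formula m ar k

AuxState : (N m : ℕ) → (Fin m → ℕ) → Set₁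
AuxState N m ar = (i : Fin m) → (Fin (ar i) → Fin N) → Set

record Structure (N m : ℕ) (ar : Fin m → ℕ) : Set₁ where
  field
    E : BRel N
    Δ : BRel N
    A : AuxState N m ar

ext : ∀ {N k} → Fin N → (Fin k → Fin N) → Fin (suc k) → Fin N
ext d ρ zero    = d
ext d ρ (suc i) = ρ i

⟦_⟧ : ∀ {N m ar k} → Formula m ar k → Structure N m ar → (Fin k → Fin N) → Set
⟦ leq x y ⟧ 𝒮 ρ = toℕ (ρ x) ≤ toℕ (ρ y)
⟦ plus x y z ⟧ 𝒮 ρ = toℕ (ρ x) + toℕ (ρ y) ≡ toℕ (ρ z)
⟦ times x y z ⟧ 𝒮 ρ = toℕ (ρ x) * toℕ (ρ y) ≡ toℕ (ρ z)
⟦ inp x y ⟧ 𝒮 ρ = T (Structure.E 𝒮 (ρ x) (ρ y))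
⟦ chg x y ⟧ 𝒮 ρ = T (Structure.Δ 𝒮 (ρ x) (ρ y))
⟦ aux i vs ⟧ 𝒮 ρ = Structure.A 𝒮 i (λ j → ρ (vs j))
⟦ neg φ ⟧ 𝒮 ρ = ¬ ⟦ φ ⟧ 𝒮 ρ
⟦ conj φ ψ ⟧ 𝒮 ρ = ⟦ φ ⟧ 𝒮 ρ × ⟦ ψ ⟧ 𝒮 ρ
⟦ disj φ ψ ⟧ 𝒮 ρ = ⟦ φ ⟧ 𝒮 ρ ⊎ ⟦ ψ ⟧ 𝒮 ρ
⟦ ex φ ⟧ 𝒮 ρ = Σ _ λ d → ⟦ φ ⟧ 𝒮 (ext d ρ)
⟦ all φ ⟧ 𝒮 ρ = ∀ d → ⟦ φ ⟧ 𝒮 (ext d ρ)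

-- Immerman's iterated first-order formulas FO[t(n)]:
-- a quantifier block QB = (Q₁ x₁ . M₁) … (Q_r x_r . M_r)
-- (with (∃x.M)ψ := ∃x (M ∧ ψ) and (∀x.M)ψ := ∀x (M → ψ)),
-- and the formula [QB]^t M₀, all over a fixed finite set of variables.

data Quant : Set where
  ∃Q ∀Q : Quant

assign : ∀ {N k} → (Fin k → Fin N) → Fin k → Fin N → Fin k → Fin N
assign ρ x d y = if ⌊ y ≟ x ⌋ then d else ρ y

blockSem : ∀ {N m ar k} → List (Quant × Fin k × Formula m ar k) →
           Structure N m ar → ((Fin k → Fin N) → Set) → (Fin k → Fin N) → Set
blockSem [] 𝒮 K ρ = K ρ
blockSem ((∃Q , x , M) ∷ qs) 𝒮 K ρ =
  Σ _ λ d → ⟦ M ⟧ 𝒮 (assign ρ x d) × blockSem qs 𝒮 K (assign ρ x d)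
blockSem ((∀Q , x , M) ∷ qs) 𝒮 K ρ =
  ∀ d → ⟦ M ⟧ 𝒮 (assign ρ x d) → blockSem qs 𝒮 K (assign ρ x d)

iterSem : ∀ {N m ar k} → ℕ → List (Quant × Fin k × Formula m ar k) →
          Formula m ar k → Structure N m ar → (Fin k → Fin N) → Set
iterSem zero    QB M₀ 𝒮 ρ = ⟦ M₀ ⟧ 𝒮 ρ
iterSem (suc t) QB M₀ 𝒮 ρ = blockSem QB 𝒮 (iterSem t QB M₀ 𝒮) ρ

-- An FO[O(log log n)] definition of a relation of arity a:
-- variables Fin (a + k): the first a are the free (parameter) variables,
-- the other k are extra variables (initially 0). The quantifier block is
-- iterated  d * (⌊log₂ ⌊log₂ n⌋⌋ + 1)  times, for a constant d.
record IterFO (m : ℕ) (ar : Fin m → ℕ) (a : ℕ) : Set where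
  field
    k     : ℕ
    block : List (Quant × Fin (a + k) × Formula m ar (a + k))
    base  : Formula m ar (a + k)
    d     : ℕ

loglog : ℕ → ℕ
loglog n = ⌊log₂ ⌊log₂ n ⌋ ⌋

evalIter : ∀ {n m ar a} → IterFO m ar a → Structure (suc n) m ar →
           (Fin a → Fin (suc n)) → Set
evalIter {n} {a = a} φ 𝒮 ā =
  iterSem (IterFO.d φ * (loglog (suc n) + 1)) (IterFO.block φ) (IterFO.base φ) 𝒮
          (λ v → [ ā , (λ _ → zero) ] (splitAt a v))

data ChangeType : Set where
  ins del : ChangeType

Change : ℕ → Set
Change N = ChangeType × BRel N

applyChange : ∀ {N} → BRel N → Change N → BRel N
applyChange E (ins , Δ) u v = E u v ∨ Δ u v
applyChange E (del , Δ) u v = E u v ∧ not (Δ u v)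

Allowed : ∀ {N} → ℕ → BRel N → Change N → Set
Allowed {N} c E ch = (card (proj₂ ch) ≤ ⌊log₂ N ⌋ ^ c) × IsForest (applyChange E ch)

ValidSeq : ∀ {N} → ℕ → BRel N → List (Change N) → Set
ValidSeq c E [] = ⊤
ValidSeq c E (ch ∷ chs) = Allowed c E ch × ValidSeq c (applyChange E ch) chs

record DynFOLLProgram : Set where
  field
    m      : ℕ
    ar     : Fin m → ℕ
    init   : (i : Fin m) → Formula m ar (ar i)
    update : ChangeType → (i : Fin m) → IterFO m ar (ar i)
    q      : Fin m
    q-bin  : ar q ≡ 2

module _ (P : DynFOLLProgram) where
  open DynFOLLProgram P

  initState : ∀ {n} → AuxState (suc n) m ar
  initState i ā = ⟦ init i ⟧ record { E = emptyRel ; Δ = emptyRel ; A = λ _ _ → ⊥ } ā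

  step : ∀ {n} → BRel (suc n) → AuxState (suc n) m ar → Change (suc n) →
         AuxState (suc n) m ar
  step E S (τ , Δ) i ā =
    evalIter (update τ i)
      record { E = applyChange E (τ , Δ) ; Δ = Δ ; A = S } ā

  run : ∀ {n} → BRel (suc n) → AuxState (suc n) m ar → List (Change (suc n)) →
        BRel (suc n) × AuxState (suc n) m ar
  run E S [] = E , S
  run E S (ch ∷ chs) = run (applyChange E ch) (step E S ch) chs

  pair : ∀ {N} → Fin N → Fin N → Fin 2 → Fin N
  pair x y zero = x
  pair x y (suc _) = y

  designated : ∀ {n} → AuxState (suc n) m ar → Fin (suc n) → Fin (suc n) → Set
  designated {n} S x y = S q (subst (λ a → Fin a → Fin (suc n)) (sym q-bin) (pair x y))

  MaintainsTreeIso : ℕ → Set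
  MaintainsTreeIso c =
    ∀ (n : ℕ) (chs : List (Change (suc n))) → ValidSeq c emptyRel chs →
      ∀ (x y : Fin (suc n)) →
        designated (proj₂ (run emptyRel initState chs)) x y
          ⇔ IsoSubtrees (proj₁ (run emptyRel initState chs)) x y

{-# OPTIONS --safe #-}

-- Give every subtree a number, its code, that determines the multiset of the codes of the
-- children; two subtrees are isomorphic iff their codes agree. Let the weight of a node be the
-- number of changed edges that start in its subtree, which is at most (log n)^c. A subtree of
-- weight 0 is unchanged, so what is stored about the old forest (isomorphism, path lengths,
-- numbers of children in an isomorphism class) still holds for it. For the other nodes these
-- judgements, and non-isomorphism as a judgement of its own, are derived by sound rules whose
-- premises halve a weight: a path is cut where the weight halves, an interval of children around
-- a child that leaves little weight on either side, and two trees are compared along a path that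
-- descends while some child has half of the weight, so that only light trees hang off it; their
-- multisets are compared by counting each class. Every true judgement thus has a
-- derivation of depth O(log (log n)^c) = O(log log n). One round of derivations is a positive
-- first-order operator, which becomes a quantifier block once ∧ and ∨ are replaced by
-- quantification over a selector.
module Submission where

open import Defs
open import Data.Nat using (ℕ; zero; suc; _+_; _*_; _^_; _∸_; _≤_; _<_; z≤n; s≤s; s≤s⁻¹; pred)
open import Data.Nat.Properties hiding (_≟_; suc-injective)
open import Data.Nat.Properties using () renaming (_≟_ to _≟ℕ_)
open import Data.Nat.DivMod using (_%_; [m+kn]%n≡m%n; m<n⇒m%n≡m)
open import Data.Nat.Logarithm using (⌊log₂_⌋; ⌊log₂⌋-mono-≤; ⌊log₂[2^n]⌋≡n)
open import Data.Nat.Solver using (module +-*-Solver)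
open import Data.Fin using (Fin; zero; suc; toℕ; fromℕ; fromℕ<; splitAt; _↑ˡ_; _↑ʳ_; _≟_)
open import Data.Fin.Patterns
open import Data.Fin.Properties using (suc-injective; pigeonhole; any?; all?; toℕ-fromℕ; toℕ-fromℕ<; toℕ<n; toℕ≤pred[n]; toℕ-injective; splitAt-↑ˡ; splitAt-↑ʳ; ↑ˡ-injective; ↑ʳ-injective)
open import Data.Bool using (T; true; false; if_then_else_)
open import Data.Bool.Properties using (T?) renaming (_≟_ to _≟B_)
open import Data.List using (List; []; _∷_; _++_; map; allFin; tabulate)
open import Data.List.Properties using (map-tabulate)
import Data.Nat.ListAction as List
open import Data.Vec using ([]; _∷_; lookup)
open import Data.Vec.Functional using () renaming (_∷_ to infixr 5 _◂_)
open import Data.Product using (Σ; _×_; _,_; proj₁; proj₂)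
open import Data.Sum using (_⊎_; inj₁; inj₂; [_,_])
open import Data.Empty using (⊥; ⊥-elim)
open import Data.Unit using (tt)
open import Function using (_∘_; id; _⇔_; mk⇔)
open import Function.Bundles using (Equivalence)
open import Relation.Nullary using (¬_; Dec; yes; no)
open import Relation.Nullary.Decidable using (_×-dec_; _→-dec_; ¬?; map′; decidable-stable)
open import Relation.Binary.PropositionalEquality hiding ([_])
open import Relation.Binary.Construct.Closure.ReflexiveTransitive using (ε; _◅_; _◅◅_)
open import Algebra.Properties.Semiring.Sum +-*-semiring using (sum; sum-cong-≗; ∑-distrib-+; ∑-comm; *-distribˡ-sum; *-distribʳ-sum)

-- Positive first-order operators as iterated quantifier blocks

-- A stage of the iteration contains only what has been derived so far, so the absence of a fact
-- says nothing. Hence every negative premise (different codes, unreachability, an empty class)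
-- needs a derivation of its own. The obstacle is the comparison of multisets. Light children can be
-- numerous, so their classes are counted, and a count asks which children are isomorphic to some
-- representative `u`. Such a premise pairs `u` with a third tree, possibly one from the same side
-- as `u`, so it need not be lighter in both components. The measure that does decrease is the sum i
-- + j of the exponents in bounds 2^i and 2^j on the two weights (for a count: the weight of the
-- interval and that of `u`). It drops by one every constant number of rounds and starts at twice
-- the bit length of (log n)^c. A single child may carry nearly all the weight of an interval. The
-- interval is cut at this child, which is compared with `u` directly at the same value of the
-- measure; comparisons are therefore established before counts at each value. An iterated block
-- defines one relation, so all four judgements share one relation with tags.

module _ {m : ℕ} {ar : Fin m → ℕ} where

  eqF : ∀ {k} → Fin k → Fin k → Formula m ar k
  eqF x y = conj (leq x y) (leq y x)

  ren : ∀ {k l} → (Fin k → Fin l) → Formula m ar k → Formula m ar l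
  lift : ∀ {k l} → (Fin k → Fin l) → Fin (suc k) → Fin (suc l)
  lift f zero = zero
  lift f (suc i) = suc (f i)

  ren f (leq x y) = leq (f x) (f y)
  ren f (plus x y z) = plus (f x) (f y) (f z)
  ren f (times x y z) = times (f x) (f y) (f z)
  ren f (inp x y) = inp (f x) (f y)
  ren f (chg x y) = chg (f x) (f y)
  ren f (aux i vs) = aux i (f ∘ vs)
  ren f (neg φ) = neg (ren f φ)
  ren f (conj φ ψ) = conj (ren f φ) (ren f ψ)
  ren f (disj φ ψ) = disj (ren f φ) (ren f ψ)
  ren f (ex φ) = ex (ren (lift f) φ)
  ren f (all φ) = all (ren (lift f) φ)

  -- Tuples are functions, and pointwise equal functions need not be identical. A renaming alters
  -- the tuple passed to an auxiliary symbol only up to pointwise equality, so stored relations must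
  -- respect it.
  Extensional : ∀ {N} → Structure N m ar → Set
  Extensional {N} 𝒮 = ∀ i (g h : Fin (ar i) → Fin N) → (∀ j → g j ≡ h j) →
                      Structure.A 𝒮 i g → Structure.A 𝒮 i h

  module Renaming {N : ℕ} (𝒮 : Structure N m ar) (A-ext : Extensional 𝒮) where

    ren-⇒ : ∀ {k l} (φ : Formula m ar k) (f : Fin k → Fin l) {ρ : Fin k → Fin N} {σ : Fin l → Fin N} →
            (∀ i → ρ i ≡ σ (f i)) → ⟦ φ ⟧ 𝒮 ρ → ⟦ ren f φ ⟧ 𝒮 σ
    ren-⇐ : ∀ {k l} (φ : Formula m ar k) (f : Fin k → Fin l) {ρ : Fin k → Fin N} {σ : Fin l → Fin N} →
            (∀ i → ρ i ≡ σ (f i)) → ⟦ ren f φ ⟧ 𝒮 σ → ⟦ φ ⟧ 𝒮 ρ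
    lift-≗ : ∀ {k l} {f : Fin k → Fin l} {ρ : Fin k → Fin N} {σ : Fin l → Fin N} →
             (∀ i → ρ i ≡ σ (f i)) → ∀ d i → ext d ρ i ≡ ext d σ (lift f i)
    lift-≗ e d zero = refl
    lift-≗ e d (suc i) = e i

    ren-⇒ (leq x y) f e = subst₂ (λ u v → toℕ u ≤ toℕ v) (e x) (e y)
    ren-⇒ (plus x y z) f e p = trans (cong₂ (λ u v → toℕ u + toℕ v) (sym (e x)) (sym (e y))) (trans p (cong toℕ (e z)))
    ren-⇒ (times x y z) f e p = trans (cong₂ (λ u v → toℕ u * toℕ v) (sym (e x)) (sym (e y))) (trans p (cong toℕ (e z)))
    ren-⇒ (inp x y) f e = subst₂ (λ u v → T (Structure.E 𝒮 u v)) (e x) (e y)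
    ren-⇒ (chg x y) f e = subst₂ (λ u v → T (Structure.Δ 𝒮 u v)) (e x) (e y)
    ren-⇒ (aux i vs) f e = A-ext i _ _ (λ j → e (vs j))
    ren-⇒ (neg φ) f e p q = p (ren-⇐ φ f e q)
    ren-⇒ (conj φ ψ) f e (p , q) = ren-⇒ φ f e p , ren-⇒ ψ f e q
    ren-⇒ (disj φ ψ) f e (inj₁ p) = inj₁ (ren-⇒ φ f e p)
    ren-⇒ (disj φ ψ) f e (inj₂ p) = inj₂ (ren-⇒ ψ f e p)
    ren-⇒ (ex φ) f e (d , p) = d , ren-⇒ φ (lift f) (lift-≗ e d) p
    ren-⇒ (all φ) f e p d = ren-⇒ φ (lift f) (lift-≗ e d) (p d)

    ren-⇐ (leq x y) f e = subst₂ (λ u v → toℕ u ≤ toℕ v) (sym (e x)) (sym (e y))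
    ren-⇐ (plus x y z) f e p = trans (cong₂ (λ u v → toℕ u + toℕ v) (e x) (e y)) (trans p (cong toℕ (sym (e z))))
    ren-⇐ (times x y z) f e p = trans (cong₂ (λ u v → toℕ u * toℕ v) (e x) (e y)) (trans p (cong toℕ (sym (e z))))
    ren-⇐ (inp x y) f e = subst₂ (λ u v → T (Structure.E 𝒮 u v)) (sym (e x)) (sym (e y))
    ren-⇐ (chg x y) f e = subst₂ (λ u v → T (Structure.Δ 𝒮 u v)) (sym (e x)) (sym (e y))
    ren-⇐ (aux i vs) f e = A-ext i _ _ (λ j → sym (e (vs j)))
    ren-⇐ (neg φ) f e p q = p (ren-⇒ φ f e q)
    ren-⇐ (conj φ ψ) f e (p , q) = ren-⇐ φ f e p , ren-⇐ ψ f e q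
    ren-⇐ (disj φ ψ) f e (inj₁ p) = inj₁ (ren-⇐ φ f e p)
    ren-⇐ (disj φ ψ) f e (inj₂ p) = inj₂ (ren-⇐ ψ f e p)
    ren-⇐ (ex φ) f e (d , p) = d , ren-⇐ φ (lift f) (lift-≗ e d) p
    ren-⇐ (all φ) f e p d = ren-⇐ φ (lift f) (lift-≗ e d) (p d)

  -- Only `rec` refers to the relation being defined; negations inside `lit` therefore leave the
  -- operator monotone.
  data Pos (a : ℕ) : ℕ → Set where
    lit   : ∀ {k} → Formula m ar k → Pos a k
    rec   : ∀ {k} → (Fin a → Fin k) → Pos a k
    _and_ : ∀ {k} → Pos a k → Pos a k → Pos a k
    _or_  : ∀ {k} → Pos a k → Pos a k → Pos a k
    some  : ∀ {k} → Pos a (suc k) → Pos a k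
    every : ∀ {k} → Pos a (suc k) → Pos a k

  infixr 6 _and_
  infixr 5 _or_

  pos : ∀ {N a k} → Pos a k → Structure N m ar → ((Fin a → Fin N) → Set) → (Fin k → Fin N) → Set
  pos (lit φ)   𝒮 R ρ = ⟦ φ ⟧ 𝒮 ρ
  pos (rec vs)  𝒮 R ρ = R (λ i → ρ (vs i))
  pos (φ and ψ) 𝒮 R ρ = pos φ 𝒮 R ρ × pos ψ 𝒮 R ρ
  pos (φ or ψ)  𝒮 R ρ = pos φ 𝒮 R ρ ⊎ pos ψ 𝒮 R ρ
  pos (some φ)  𝒮 R ρ = Σ _ λ d → pos φ 𝒮 R (ext d ρ)
  pos (every φ) 𝒮 R ρ = ∀ d → pos φ 𝒮 R (ext d ρ)

  pos-mono : ∀ {N a k} (φ : Pos a k) (𝒮 : Structure N m ar) {R R′ : (Fin a → Fin N) → Set} →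
             (∀ g → R g → R′ g) → ∀ ρ → pos φ 𝒮 R ρ → pos φ 𝒮 R′ ρ
  pos-mono (lit φ) 𝒮 h ρ p = p
  pos-mono (rec vs) 𝒮 h ρ p = h _ p
  pos-mono (φ and ψ) 𝒮 h ρ (p , q) = pos-mono φ 𝒮 h ρ p , pos-mono ψ 𝒮 h ρ q
  pos-mono (φ or ψ) 𝒮 h ρ (inj₁ p) = inj₁ (pos-mono φ 𝒮 h ρ p)
  pos-mono (φ or ψ) 𝒮 h ρ (inj₂ p) = inj₂ (pos-mono ψ 𝒮 h ρ p)
  pos-mono (some φ) 𝒮 h ρ (d , p) = d , pos-mono φ 𝒮 h _ p
  pos-mono (every φ) 𝒮 h ρ p d = pos-mono φ 𝒮 h _ (p d)

  stage : ∀ {N a} → Pos a a → Structure N m ar → ℕ → (Fin a → Fin N) → Set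
  stage φ 𝒮 zero    g = ⊥
  stage φ 𝒮 (suc t) g = pos φ 𝒮 (stage φ 𝒮 t) g

  stage-suc : ∀ {N a} (φ : Pos a a) (𝒮 : Structure N m ar) t g → stage φ 𝒮 t g → stage φ 𝒮 (suc t) g
  stage-suc φ 𝒮 (suc t) g p = pos-mono φ 𝒮 (stage-suc φ 𝒮 t) g p

  -- The i-th argument of the final recursive call is any value satisfying the i-th
  -- formula of 'done'.
  data Prefix (a : ℕ) : ℕ → Set where
    done : ∀ {k} → (Fin a → Formula m ar (suc k)) → Prefix a k
    move : ∀ {k} → Quant → Formula m ar (suc k) → Prefix a (suc k) → Prefix a k

  prefixSem : ∀ {N a k} → Prefix a k → Structure N m ar → ((Fin a → Fin N) → Set) → (Fin k → Fin N) → Set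
  prefixSem {N} {a} (done G) 𝒮 R ρ = Σ (Fin a → Fin N) λ g → (∀ i → ⟦ G i ⟧ 𝒮 (ext (g i) ρ)) × R g
  prefixSem (move ∃Q M p) 𝒮 R ρ = Σ _ λ d → ⟦ M ⟧ 𝒮 (ext d ρ) × prefixSem p 𝒮 R (ext d ρ)
  prefixSem (move ∀Q M p) 𝒮 R ρ = ∀ d → ⟦ M ⟧ 𝒮 (ext d ρ) → prefixSem p 𝒮 R (ext d ρ)

  renP : ∀ {a k l} → (Fin k → Fin l) → Prefix a k → Prefix a l
  renP f (done G) = done (λ i → ren (lift f) (G i))
  renP f (move Q M p) = move Q (ren (lift f) M) (renP (lift f) p)

  -- The rest of `merge` once the first prefix is used up: its call arguments `G` are carried to the
  -- end of the second prefix, where `σ` decides between `G` and `H`.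
  mergeʳ : ∀ {a k} → Formula m ar k → (Fin a → Formula m ar (suc k)) → Prefix a k → Prefix a k
  mergeʳ σ G (done H) = done (λ i → disj (conj (ren suc σ) (G i)) (conj (neg (ren suc σ)) (H i)))
  mergeʳ σ G (move Q M p) = move Q (disj (ren suc σ) M) (mergeʳ (ren suc σ) (λ i → ren (lift suc) (G i)) p)

  -- A block is one sequence of quantifiers with one final call, so two prefixes can only be joined
  -- by putting one behind the other. The truth value of `σ` makes one of them active; the guards of
  -- the other become true, and its quantifiers have no effect because the domain is nonempty.
  merge : ∀ {a k} → Formula m ar k → Prefix a k → Prefix a k → Prefix a k
  merge σ (done G) q = mergeʳ σ G q
  merge σ (move Q M p) q = move Q (disj (neg (ren suc σ)) M) (merge (ren suc σ) p (renP suc q))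

  wk₂ : ∀ {k} → Fin k → Fin (suc (suc k))
  wk₂ i = suc (suc i)

  choice : ∀ {a k} → Quant → Prefix a k → Prefix a k → Prefix a k
  choice Q p q = move Q (eqF zero zero) (move Q (eqF zero zero)
                   (merge (eqF zero (suc zero)) (renP wk₂ p) (renP wk₂ q)))

  prefix : ∀ {a k} → Pos a k → Prefix a k
  -- The existential variable is a dummy that allows `φ` to be a guard. The universal guard is
  -- false, so the rest holds vacuously and the outcome does not depend on the call.
  prefix (lit φ)   = move ∃Q (ren suc φ) (move ∀Q (neg (eqF zero zero)) (done (λ _ → eqF zero zero)))
  prefix (rec vs)  = done (λ i → eqF zero (suc (vs i)))
  prefix (φ and ψ) = choice ∀Q (prefix φ) (prefix ψ)
  prefix (φ or ψ)  = choice ∃Q (prefix φ) (prefix ψ)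
  prefix (some φ)  = move ∃Q (eqF zero zero) (prefix φ)
  prefix (every φ) = move ∀Q (eqF zero zero) (prefix φ)

  module PrefixSem {n : ℕ} (𝒮 : Structure (suc n) m ar) (A-ext : Extensional 𝒮)
                   {a : ℕ} (R : (Fin a → Fin (suc n)) → Set)
                   (R-ext : ∀ g h → (∀ i → g i ≡ h i) → R g → R h) where
    open Renaming 𝒮 A-ext
    N = suc n

    renP-⇒ : ∀ {k l} (p : Prefix a k) (f : Fin k → Fin l) {ρ : Fin k → Fin N} {σ : Fin l → Fin N} →
             (∀ i → ρ i ≡ σ (f i)) → prefixSem p 𝒮 R ρ → prefixSem (renP f p) 𝒮 R σ
    renP-⇒ (done G) f e (g , u , r) = g , (λ i → ren-⇒ (G i) (lift f) (lift-≗ e (g i)) (u i)) , r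
    renP-⇒ (move ∃Q M p) f e (d , u , r) = d , ren-⇒ M (lift f) (lift-≗ e d) u , renP-⇒ p (lift f) (lift-≗ e d) r
    renP-⇒ (move ∀Q M p) f e r d u = renP-⇒ p (lift f) (lift-≗ e d) (r d (ren-⇐ M (lift f) (lift-≗ e d) u))

    renP-⇐ : ∀ {k l} (p : Prefix a k) (f : Fin k → Fin l) {ρ : Fin k → Fin N} {σ : Fin l → Fin N} →
             (∀ i → ρ i ≡ σ (f i)) → prefixSem (renP f p) 𝒮 R σ → prefixSem p 𝒮 R ρ
    renP-⇐ (done G) f e (g , u , r) = g , (λ i → ren-⇐ (G i) (lift f) (lift-≗ e (g i)) (u i)) , r
    renP-⇐ (move ∃Q M p) f e (d , u , r) = d , ren-⇐ M (lift f) (lift-≗ e d) u , renP-⇐ p (lift f) (lift-≗ e d) r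
    renP-⇐ (move ∀Q M p) f e r d u = renP-⇐ p (lift f) (lift-≗ e d) (r d (ren-⇒ M (lift f) (lift-≗ e d) u))

    wk-⇒ : ∀ {k} (φ : Formula m ar k) {ρ : Fin k → Fin N} d → ⟦ φ ⟧ 𝒮 ρ → ⟦ ren suc φ ⟧ 𝒮 (ext d ρ)
    wk-⇒ φ d = ren-⇒ φ suc (λ _ → refl)
    wk-⇐ : ∀ {k} (φ : Formula m ar k) {ρ : Fin k → Fin N} d → ⟦ ren suc φ ⟧ 𝒮 (ext d ρ) → ⟦ φ ⟧ 𝒮 ρ
    wk-⇐ φ d = ren-⇐ φ suc (λ _ → refl)

    mergeʳ-on-⇒ : ∀ {k} σ G (q : Prefix a k) {ρ} → ⟦ σ ⟧ 𝒮 ρ → prefixSem (mergeʳ σ G q) 𝒮 R ρ → prefixSem (done G) 𝒮 R ρ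
    mergeʳ-on-⇒ σ G (done H) s (g , u , r) = g , (λ i → pick i (u i)) , r
      where
      pick : ∀ i → _ → _
      pick i (inj₁ (_ , v)) = v
      pick i (inj₂ (v , _)) = ⊥-elim (v (wk-⇒ σ (g i) s))
    mergeʳ-on-⇒ σ G (move ∃Q M q) s (d , _ , r)
      with mergeʳ-on-⇒ _ _ q (wk-⇒ σ d s) r
    ... | g , u , r′ = g , (λ i → ren-⇐ (G i) (lift suc) (lift-≗ (λ _ → refl) (g i)) (u i)) , r′
    mergeʳ-on-⇒ σ G (move ∀Q M q) s r
      with mergeʳ-on-⇒ _ _ q (wk-⇒ σ zero s) (r zero (inj₁ (wk-⇒ σ zero s)))
    ... | g , u , r′ = g , (λ i → ren-⇐ (G i) (lift suc) (lift-≗ (λ _ → refl) (g i)) (u i)) , r′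

    mergeʳ-on-⇐ : ∀ {k} σ G (q : Prefix a k) {ρ} → ⟦ σ ⟧ 𝒮 ρ → prefixSem (done G) 𝒮 R ρ → prefixSem (mergeʳ σ G q) 𝒮 R ρ
    mergeʳ-on-⇐ σ G (done H) s (g , u , r) = g , (λ i → inj₁ (wk-⇒ σ (g i) s , u i)) , r
    mergeʳ-on-⇐ σ G (move ∃Q M q) s (g , u , r) = zero , inj₁ (wk-⇒ σ zero s) ,
      mergeʳ-on-⇐ _ _ q (wk-⇒ σ zero s) (g , (λ i → ren-⇒ (G i) (lift suc) (lift-≗ (λ _ → refl) (g i)) (u i)) , r)
    mergeʳ-on-⇐ σ G (move ∀Q M q) s (g , u , r) d _ =
      mergeʳ-on-⇐ _ _ q (wk-⇒ σ d s) (g , (λ i → ren-⇒ (G i) (lift suc) (lift-≗ (λ _ → refl) (g i)) (u i)) , r)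

    mergeʳ-off-⇒ : ∀ {k} σ G (q : Prefix a k) {ρ} → ¬ ⟦ σ ⟧ 𝒮 ρ → prefixSem (mergeʳ σ G q) 𝒮 R ρ → prefixSem q 𝒮 R ρ
    mergeʳ-off-⇒ σ G (done H) s (g , u , r) = g , (λ i → pick i (u i)) , r
      where
      pick : ∀ i → _ → _
      pick i (inj₂ (_ , v)) = v
      pick i (inj₁ (v , _)) = ⊥-elim (s (wk-⇐ σ (g i) v))
    mergeʳ-off-⇒ σ G (move ∃Q M q) s (d , inj₁ v , r) = ⊥-elim (s (wk-⇐ σ d v))
    mergeʳ-off-⇒ σ G (move ∃Q M q) s (d , inj₂ v , r) = d , v , mergeʳ-off-⇒ _ _ q (s ∘ wk-⇐ σ d) r
    mergeʳ-off-⇒ σ G (move ∀Q M q) s r d v = mergeʳ-off-⇒ _ _ q (s ∘ wk-⇐ σ d) (r d (inj₂ v))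

    mergeʳ-off-⇐ : ∀ {k} σ G (q : Prefix a k) {ρ} → ¬ ⟦ σ ⟧ 𝒮 ρ → prefixSem q 𝒮 R ρ → prefixSem (mergeʳ σ G q) 𝒮 R ρ
    mergeʳ-off-⇐ σ G (done H) s (g , u , r) = g , (λ i → inj₂ (s ∘ wk-⇐ σ (g i) , u i)) , r
    mergeʳ-off-⇐ σ G (move ∃Q M q) s (d , v , r) = d , inj₂ v , mergeʳ-off-⇐ _ _ q (s ∘ wk-⇐ σ d) r
    mergeʳ-off-⇐ σ G (move ∀Q M q) s r d (inj₁ v) = ⊥-elim (s (wk-⇐ σ d v))
    mergeʳ-off-⇐ σ G (move ∀Q M q) s r d (inj₂ v) = mergeʳ-off-⇐ _ _ q (s ∘ wk-⇐ σ d) (r d v)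

    merge-on-⇒ : ∀ {k} σ (p q : Prefix a k) {ρ} → ⟦ σ ⟧ 𝒮 ρ → prefixSem (merge σ p q) 𝒮 R ρ → prefixSem p 𝒮 R ρ
    merge-on-⇒ σ (done G) q s r = mergeʳ-on-⇒ σ G q s r
    merge-on-⇒ σ (move ∃Q M p) q s (d , inj₁ v , r) = ⊥-elim (v (wk-⇒ σ d s))
    merge-on-⇒ σ (move ∃Q M p) q s (d , inj₂ v , r) = d , v , merge-on-⇒ _ p _ (wk-⇒ σ d s) r
    merge-on-⇒ σ (move ∀Q M p) q s r d v = merge-on-⇒ _ p _ (wk-⇒ σ d s) (r d (inj₂ v))

    merge-on-⇐ : ∀ {k} σ (p q : Prefix a k) {ρ} → ⟦ σ ⟧ 𝒮 ρ → prefixSem p 𝒮 R ρ → prefixSem (merge σ p q) 𝒮 R ρ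
    merge-on-⇐ σ (done G) q s r = mergeʳ-on-⇐ σ G q s r
    merge-on-⇐ σ (move ∃Q M p) q s (d , v , r) = d , inj₂ v , merge-on-⇐ _ p _ (wk-⇒ σ d s) r
    merge-on-⇐ σ (move ∀Q M p) q s r d (inj₁ v) = ⊥-elim (v (wk-⇒ σ d s))
    merge-on-⇐ σ (move ∀Q M p) q s r d (inj₂ v) = merge-on-⇐ _ p _ (wk-⇒ σ d s) (r d v)

    merge-off-⇒ : ∀ {k} σ (p q : Prefix a k) {ρ} → ¬ ⟦ σ ⟧ 𝒮 ρ → prefixSem (merge σ p q) 𝒮 R ρ → prefixSem q 𝒮 R ρ
    merge-off-⇒ σ (done G) q s r = mergeʳ-off-⇒ σ G q s r
    merge-off-⇒ σ (move ∃Q M p) q s (d , _ , r) = renP-⇐ q suc (λ _ → refl) (merge-off-⇒ _ p _ (s ∘ wk-⇐ σ d) r)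
    merge-off-⇒ σ (move ∀Q M p) q s r = renP-⇐ q suc (λ _ → refl)
      (merge-off-⇒ _ p _ (s ∘ wk-⇐ σ zero) (r zero (inj₁ (s ∘ wk-⇐ σ zero))))

    merge-off-⇐ : ∀ {k} σ (p q : Prefix a k) {ρ} → ¬ ⟦ σ ⟧ 𝒮 ρ → prefixSem q 𝒮 R ρ → prefixSem (merge σ p q) 𝒮 R ρ
    merge-off-⇐ σ (done G) q s r = mergeʳ-off-⇐ σ G q s r
    merge-off-⇐ σ (move ∃Q M p) q s r = zero , inj₁ (s ∘ wk-⇐ σ zero) ,
      merge-off-⇐ _ p _ (s ∘ wk-⇐ σ zero) (renP-⇒ q suc (λ _ → refl) r)
    merge-off-⇐ σ (move ∀Q M p) q s r d _ = merge-off-⇐ _ p _ (s ∘ wk-⇐ σ d) (renP-⇒ q suc (λ _ → refl) r)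

    -- The selector compares two quantified values, so both of its outcomes
    -- occur only when the domain has two elements.
    module TwoElements (d₀ d₁ : Fin N) (d₀≢d₁ : d₀ ≢ d₁) where

      eqF-≡ : ∀ {k} {ρ : Fin k → Fin N} x y → ⟦ eqF {k} x y ⟧ 𝒮 ρ → ρ x ≡ ρ y
      eqF-≡ x y (p , q) = toℕ-injective (≤-antisym p q)

      choice∀-⇒ : ∀ {k} (p q : Prefix a k) {ρ} → prefixSem (choice ∀Q p q) 𝒮 R ρ → prefixSem p 𝒮 R ρ × prefixSem q 𝒮 R ρ
      choice∀-⇒ p q r =
        renP-⇐ p wk₂ (λ _ → refl) (merge-on-⇒ (eqF zero (suc zero)) (renP wk₂ p) (renP wk₂ q) (≤-refl , ≤-refl)
          (r d₀ (≤-refl , ≤-refl) d₀ (≤-refl , ≤-refl))) ,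
        renP-⇐ q wk₂ (λ _ → refl) (merge-off-⇒ (eqF zero (suc zero)) (renP wk₂ p) (renP wk₂ q)
          (λ (e , e′) → d₀≢d₁ (toℕ-injective (≤-antisym e e′)))
          (r d₁ (≤-refl , ≤-refl) d₀ (≤-refl , ≤-refl)))

      choice∀-⇐ : ∀ {k} (p q : Prefix a k) {ρ} → prefixSem p 𝒮 R ρ × prefixSem q 𝒮 R ρ → prefixSem (choice ∀Q p q) 𝒮 R ρ
      choice∀-⇐ p q (u , v) c _ d _ with d ≟ c
      ... | yes refl = merge-on-⇐ (eqF zero (suc zero)) (renP wk₂ p) (renP wk₂ q) (≤-refl , ≤-refl) (renP-⇒ p wk₂ (λ _ → refl) u)
      ... | no d≢c = merge-off-⇐ (eqF zero (suc zero)) (renP wk₂ p) (renP wk₂ q)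
                       (λ (e , e′) → d≢c (toℕ-injective (≤-antisym e e′))) (renP-⇒ q wk₂ (λ _ → refl) v)

      choice∃-⇒ : ∀ {k} (p q : Prefix a k) {ρ} → prefixSem (choice ∃Q p q) 𝒮 R ρ → prefixSem p 𝒮 R ρ ⊎ prefixSem q 𝒮 R ρ
      choice∃-⇒ p q (c , _ , d , _ , r) with d ≟ c
      ... | yes refl = inj₁ (renP-⇐ p wk₂ (λ _ → refl)
                         (merge-on-⇒ (eqF zero (suc zero)) (renP wk₂ p) (renP wk₂ q) (≤-refl , ≤-refl) r))
      ... | no d≢c = inj₂ (renP-⇐ q wk₂ (λ _ → refl) (merge-off-⇒ (eqF zero (suc zero)) (renP wk₂ p) (renP wk₂ q)
                       (λ (e , e′) → d≢c (toℕ-injective (≤-antisym e e′))) r))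

      choice∃-⇐ : ∀ {k} (p q : Prefix a k) {ρ} → prefixSem p 𝒮 R ρ ⊎ prefixSem q 𝒮 R ρ → prefixSem (choice ∃Q p q) 𝒮 R ρ
      choice∃-⇐ p q (inj₁ u) = d₀ , (≤-refl , ≤-refl) , d₀ , (≤-refl , ≤-refl) ,
        merge-on-⇐ (eqF zero (suc zero)) (renP wk₂ p) (renP wk₂ q) (≤-refl , ≤-refl) (renP-⇒ p wk₂ (λ _ → refl) u)
      choice∃-⇐ p q (inj₂ v) = d₁ , (≤-refl , ≤-refl) , d₀ , (≤-refl , ≤-refl) ,
        merge-off-⇐ (eqF zero (suc zero)) (renP wk₂ p) (renP wk₂ q)
          (λ (e , e′) → d₀≢d₁ (toℕ-injective (≤-antisym e e′))) (renP-⇒ q wk₂ (λ _ → refl) v)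

      prefix-⇒ : ∀ {k} (φ : Pos a k) {ρ} → prefixSem (prefix φ) 𝒮 R ρ → pos φ 𝒮 R ρ
      prefix-⇒ (lit φ) (d , u , _) = wk-⇐ φ d u
      prefix-⇒ (rec vs) {ρ} (g , e , r) = R-ext _ _ (λ i → eqF-≡ {ρ = ext (g i) ρ} zero (suc (vs i)) (e i)) r
      prefix-⇒ (φ and ψ) r = Data.Product.map (prefix-⇒ φ) (prefix-⇒ ψ) (choice∀-⇒ (prefix φ) (prefix ψ) r)
      prefix-⇒ (φ or ψ) r = Data.Sum.map (prefix-⇒ φ) (prefix-⇒ ψ) (choice∃-⇒ (prefix φ) (prefix ψ) r)
      prefix-⇒ (some φ) (d , _ , r) = d , prefix-⇒ φ r
      prefix-⇒ (every φ) r d = prefix-⇒ φ (r d (≤-refl , ≤-refl))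

      prefix-⇐ : ∀ {k} (φ : Pos a k) {ρ} → pos φ 𝒮 R ρ → prefixSem (prefix φ) 𝒮 R ρ
      prefix-⇐ (lit φ) u = d₀ , wk-⇒ φ d₀ u , λ d v → ⊥-elim (v (≤-refl , ≤-refl))
      prefix-⇐ (rec vs) {ρ} r = (λ i → ρ (vs i)) , (λ i → ≤-refl , ≤-refl) , r
      prefix-⇐ (φ and ψ) (u , v) = choice∀-⇐ (prefix φ) (prefix ψ) (prefix-⇐ φ u , prefix-⇐ ψ v)
      prefix-⇐ (φ or ψ) r = choice∃-⇐ (prefix φ) (prefix ψ) (Data.Sum.map (prefix-⇐ φ) (prefix-⇐ ψ) r)
      prefix-⇐ (some φ) (d , r) = d , (≤-refl , ≤-refl) , prefix-⇐ φ r
      prefix-⇐ (every φ) r d _ = prefix-⇐ φ (r d)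

  -- Prefixes as blocks over a fixed set of variables

  length : ∀ {a k} → Prefix a k → ℕ
  length (done G) = 0
  length (move Q M p) = suc (length p)

  copies : ∀ {b V} → (Fin b → Fin V) → (Fin b → Formula m ar V) → List (Quant × Fin V × Formula m ar V)
  copies {zero} x M = []
  copies {suc b} x M = (∃Q , x zero , M zero) ∷ copies (x ∘ suc) (M ∘ suc)

  -- 'θ' places the de Bruijn variables among the block variables, 'f' supplies
  -- unused ones; arguments are computed into 'c' before 'v' is overwritten.
  toBlock : ∀ {a k V} (p : Prefix a k) → (Fin k → Fin V) → (Fin (length p) → Fin V) →
            (c v : Fin a → Fin V) → List (Quant × Fin V × Formula m ar V)
  toBlock (done G) θ f c v = copies c (λ i → ren (c i ◂ θ) (G i)) ++ copies v (λ i → eqF (v i) (c i)) ++ []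
  toBlock (move Q M p) θ f c v = (Q , f zero , ren (f zero ◂ θ) M) ∷ toBlock p (f zero ◂ θ) (f ∘ suc) c v

assign-same : ∀ {N V} (τ : Fin V → Fin N) x d → assign τ x d x ≡ d
assign-same τ x d with x ≟ x
... | yes _ = refl
... | no x≢x = ⊥-elim (x≢x refl)

assign-other : ∀ {N V} (τ : Fin V → Fin N) x d y → y ≢ x → assign τ x d y ≡ τ y
assign-other τ x d y y≢x with y ≟ x
... | yes y≡x = ⊥-elim (y≢x y≡x)
... | no _ = refl

module _ {m : ℕ} {ar : Fin m → ℕ} {N : ℕ} (𝒮 : Structure N m ar) {V : ℕ} where

  AgreeOff : ∀ {b} → (Fin b → Fin V) → (τ τ′ : Fin V → Fin N) → Set
  AgreeOff x τ τ′ = ∀ y → (∀ i → y ≢ x i) → τ′ y ≡ τ y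

  module _ (rest : List (Quant × Fin V × Formula m ar V)) (K : (Fin V → Fin N) → Set) where

    -- When a guard is evaluated, only variables among the `x i` have been overwritten. `AgreeOff`
    -- records this, so that `S i` can be stated about the values before the copying.
    copies-⇒ : ∀ {b} (x : Fin b → Fin V) (M : Fin b → Formula m ar V) (S : Fin b → Fin N → Set) τ →
      (∀ i j → x i ≡ x j → i ≡ j) →
      (∀ i d τ′ → AgreeOff x τ τ′ → ⟦ M i ⟧ 𝒮 (assign τ′ (x i) d) → S i d) →
      blockSem (copies x M ++ rest) 𝒮 K τ →
      Σ (Fin V → Fin N) λ τ′ → AgreeOff x τ τ′ × (∀ i → S i (τ′ (x i))) × blockSem rest 𝒮 K τ′
    copies-⇒ {zero} x M S τ inj h r = τ , (λ _ _ → refl) , (λ ()) , r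
    copies-⇒ {suc b} x M S τ inj h (d , u , r)
      with copies-⇒ (x ∘ suc) (M ∘ suc) (S ∘ suc) (assign τ (x zero) d)
             (λ i j e → suc-injective (inj _ _ e))
             (λ i e τ′ ag → h (suc i) e τ′ (λ y hy → trans (ag y (hy ∘ suc)) (assign-other τ _ d y (hy zero)))) r
    ... | τ′ , ag , s , r′ = τ′ , (λ y hy → trans (ag y (hy ∘ suc)) (assign-other τ _ d y (hy zero))) , s′ , r′
      where
      τ′x₀ : τ′ (x zero) ≡ d
      τ′x₀ = trans (ag (x zero) (λ i e → case0 (inj _ _ e))) (assign-same τ _ d)
        where
        case0 : ∀ {i : Fin b} → zero ≡ suc i → ⊥
        case0 ()
      s′ : ∀ i → S i (τ′ (x i))
      s′ zero = subst (S zero) (sym τ′x₀) (h zero d τ (λ _ _ → refl) u)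
      s′ (suc i) = s i

    copies-⇐ : ∀ {b} (x : Fin b → Fin V) (M : Fin b → Formula m ar V) (g : Fin b → Fin N) τ →
      (∀ i j → x i ≡ x j → i ≡ j) →
      (∀ i τ′ → AgreeOff x τ τ′ → ⟦ M i ⟧ 𝒮 (assign τ′ (x i) (g i))) →
      (∀ τ′ → AgreeOff x τ τ′ → (∀ i → τ′ (x i) ≡ g i) → blockSem rest 𝒮 K τ′) →
      blockSem (copies x M ++ rest) 𝒮 K τ
    copies-⇐ {zero} x M g τ inj h r = r τ (λ _ _ → refl) (λ ())
    copies-⇐ {suc b} x M g τ inj h r = g zero , h zero τ (λ _ _ → refl) ,
      copies-⇐ (x ∘ suc) (M ∘ suc) (g ∘ suc) (assign τ (x zero) (g zero))
        (λ i j e → suc-injective (inj _ _ e))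
        (λ i τ′ ag → h (suc i) τ′ (widen ag))
        (λ τ′ ag e → r τ′ (widen ag) λ { zero → trans (ag (x zero) (λ i e → case0 (inj _ _ e))) (assign-same τ _ _)
                                       ; (suc i) → e i })
      where
      case0 : ∀ {i : Fin b} → zero ≡ suc i → ⊥
      case0 ()
      widen : ∀ {τ′} → AgreeOff (x ∘ suc) (assign τ (x zero) (g zero)) τ′ → AgreeOff x τ τ′
      widen ag y hy = trans (ag y (hy ∘ suc)) (assign-other τ _ _ y (hy zero))

  module _ (A-ext : Extensional 𝒮) where
    open Renaming 𝒮 A-ext

    ◂-≗ : ∀ {k} {ρ : Fin k → Fin N} {τ : Fin V → Fin N} {θ : Fin k → Fin V} x d →
          (∀ i → x ≢ θ i) → (∀ i → ρ i ≡ τ (θ i)) → ∀ i → ext d ρ i ≡ assign τ x d ((x ◂ θ) i)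
    ◂-≗ {τ = τ} x d x∉θ e zero = sym (assign-same τ x d)
    ◂-≗ {τ = τ} x d x∉θ e (suc i) = trans (e i) (sym (assign-other τ x d _ (x∉θ i ∘ sym)))

    module ToBlock {a : ℕ} (R : (Fin a → Fin N) → Set) (R-ext : ∀ g h → (∀ i → g i ≡ h i) → R g → R h)
                   (K : (Fin V → Fin N) → Set) (c v : Fin a → Fin V)
                   (K-⇒ : ∀ τ → K τ → R (τ ∘ v)) (K-⇐ : ∀ τ → R (τ ∘ v) → K τ)
                   (c-inj : ∀ i j → c i ≡ c j → i ≡ j) (v-inj : ∀ i j → v i ≡ v j → i ≡ j)
                   (c≢v : ∀ i j → c i ≢ v j) where

      record Fresh {k l} (θ : Fin k → Fin V) (f : Fin l → Fin V) : Set where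
        field
          f-inj : ∀ i j → f i ≡ f j → i ≡ j
          f≢θ : ∀ i j → f i ≢ θ j
          c≢θ : ∀ i j → c i ≢ θ j
          c≢f : ∀ i j → c i ≢ f j

      fresh-◂ : ∀ {k l} {θ : Fin k → Fin V} {f : Fin (suc l) → Fin V} → Fresh θ f → Fresh (f zero ◂ θ) (f ∘ suc)
      fresh-◂ F = record
        { f-inj = λ i j e → suc-injective (f-inj _ _ e)
        ; f≢θ = λ { i zero e → case0 (f-inj _ _ (sym e)) ; i (suc j) → f≢θ _ j }
        ; c≢θ = λ { i zero → c≢f i zero ; i (suc j) → c≢θ i j }
        ; c≢f = λ i j → c≢f i (suc j) }
        where
        open Fresh F
        case0 : ∀ {l} {i : Fin l} → zero ≡ suc i → ⊥
        case0 ()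

      toBlock-⇒ : ∀ {k} (p : Prefix a k) {ρ τ θ f} → Fresh θ f → (∀ i → ρ i ≡ τ (θ i)) →
                  blockSem (toBlock p θ f c v) 𝒮 K τ → prefixSem p 𝒮 R ρ
      toBlock-⇒ (done G) {ρ} {τ} {θ} F e r
        with copies-⇒ (copies v (λ i → eqF (v i) (c i)) ++ []) K c (λ i → ren (c i ◂ θ) (G i)) (λ i d → ⟦ G i ⟧ 𝒮 (ext d ρ)) τ c-inj
               (λ i d τ′ ag u → ren-⇐ (G i) (c i ◂ θ)
                  (◂-≗ {τ = τ′} {θ = θ} (c i) d (Fresh.c≢θ F i) (λ j → trans (e j) (sym (ag _ (λ l → Fresh.c≢θ F l j ∘ sym))))) u) r
      ... | τ′ , ag , s , r′
        with copies-⇒ [] K v (λ i → eqF (v i) (c i)) (λ i d → d ≡ τ′ (c i)) τ′ v-inj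
               (λ i d τ″ ag′ u → trans (sym (assign-same τ″ (v i) d))
                  (trans (toℕ-injective (≤-antisym (proj₁ u) (proj₂ u)))
                    (trans (assign-other τ″ (v i) d (c i) (c≢v i i)) (ag′ (c i) (c≢v i)))))
               r′
      ... | τ″ , _ , s′ , r″ = (λ i → τ′ (c i)) , s , R-ext _ _ s′ (K-⇒ _ r″)
      toBlock-⇒ (move ∃Q M p) {ρ} {τ} F e (d , u , r) = d , ren-⇐ M _ e′ u , toBlock-⇒ p (fresh-◂ F) e′ r
        where e′ = ◂-≗ {ρ = ρ} {τ = τ} _ d (Fresh.f≢θ F zero) e
      toBlock-⇒ (move ∀Q M p) {ρ} {τ} F e r d u = toBlock-⇒ p (fresh-◂ F) e′ (r d (ren-⇒ M _ e′ u))
        where e′ = ◂-≗ {ρ = ρ} {τ = τ} _ d (Fresh.f≢θ F zero) e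

      toBlock-⇐ : ∀ {k} (p : Prefix a k) {ρ τ θ f} → Fresh θ f → (∀ i → ρ i ≡ τ (θ i)) →
                  prefixSem p 𝒮 R ρ → blockSem (toBlock p θ f c v) 𝒮 K τ
      toBlock-⇐ (done G) {ρ} {τ} {θ} F e (g , u , r) =
        copies-⇐ (copies v (λ i → eqF (v i) (c i)) ++ []) K c (λ i → ren (c i ◂ θ) (G i)) g τ c-inj
          (λ i τ′ ag → ren-⇒ (G i) (c i ◂ θ)
             (◂-≗ {τ = τ′} {θ = θ} (c i) (g i) (Fresh.c≢θ F i) (λ j → trans (e j) (sym (ag _ (λ l → Fresh.c≢θ F l j ∘ sym))))) (u i))
          λ τ′ ag eg →
            (copies-⇐ [] K v (λ i → eqF (v i) (c i)) g τ′ v-inj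
              (λ i τ″ ag′ → let q = trans (assign-same τ″ (v i) (g i))
                                      (sym (trans (assign-other τ″ (v i) (g i) (c i) (c≢v i i)) (trans (ag′ (c i) (c≢v i)) (eg i))))
                             in ≤-reflexive (cong toℕ q) , ≤-reflexive (cong toℕ (sym q)))
              (λ τ″ _ e″ → K-⇐ τ″ (R-ext _ _ (λ i → sym (e″ i)) r)))
      toBlock-⇐ (move ∃Q M p) {ρ} {τ} F e (d , u , r) = d , ren-⇒ M _ e′ u , toBlock-⇐ p (fresh-◂ F) e′ r
        where e′ = ◂-≗ {ρ = ρ} {τ = τ} _ d (Fresh.f≢θ F zero) e
      toBlock-⇐ (move ∀Q M p) {ρ} {τ} F e r d u = toBlock-⇐ p (fresh-◂ F) e′ (r d (ren-⇐ M _ e′ u))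
        where e′ = ◂-≗ {ρ = ρ} {τ = τ} _ d (Fresh.f≢θ F zero) e

-- Stages of a positive operator by iterating its block

module Compile {m : ℕ} {ar : Fin m → ℕ} {a : ℕ} (φ : Pos {m} {ar} a a) where

  falseF : ∀ {k} → Formula m ar k
  falseF = ex (neg (eqF zero zero))

  -- The leading guard makes the relation true on the one-element domain.
  opaque
    guarded : Prefix {m} {ar} a a
    guarded = move ∀Q (ex (neg (eqF zero (suc zero)))) (renP suc (prefix φ))

  -- Arguments come first, as `IterFO` demands of its parameters; then the copies that receive the
  -- next arguments; then one variable for each quantifier of the prefix.
  V : ℕ
  V = a + (a + length guarded)

  argVar : Fin a → Fin V
  argVar i = i ↑ˡ (a + length guarded)

  copyVar : Fin a → Fin V
  copyVar i = a ↑ʳ (i ↑ˡ length guarded)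

  freshVar : Fin (length guarded) → Fin V
  freshVar i = a ↑ʳ (a ↑ʳ i)

  block : List (Quant × Fin V × Formula m ar V)
  block = toBlock guarded argVar freshVar copyVar argVar

  inj₁≢inj₂ : ∀ {A B : Set} {x : A} {y : B} → inj₁ x ≡ inj₂ y → ⊥
  inj₁≢inj₂ ()

  ↑ˡ≢↑ʳ : ∀ {b l} (i : Fin b) (j : Fin l) → i ↑ˡ l ≢ b ↑ʳ j
  ↑ˡ≢↑ʳ {b} {l} i j e = inj₁≢inj₂ (trans (sym (splitAt-↑ˡ b i l)) (trans (cong (splitAt b) e) (splitAt-↑ʳ b l j)))

  module Rounds {n : ℕ} (𝒮 : Structure (suc n) m ar) (A-ext : Extensional 𝒮) where
    open Renaming 𝒮 A-ext

    pos-ext : ∀ {k} (ψ : Pos a k) {R : (Fin a → Fin (suc n)) → Set} → (∀ g h → (∀ i → g i ≡ h i) → R g → R h) →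
              ∀ {ρ σ} → (∀ i → ρ i ≡ σ i) → pos ψ 𝒮 R ρ → pos ψ 𝒮 R σ
    pos-ext (lit ψ) R-ext {σ = σ} e p = ren-⇐ ψ suc {σ} {ext zero σ} (λ _ → refl) (ren-⇒ ψ suc e p)
    pos-ext (rec vs) R-ext e p = R-ext _ _ (λ i → e (vs i)) p
    pos-ext (ψ and χ) R-ext e (p , q) = pos-ext ψ R-ext e p , pos-ext χ R-ext e q
    pos-ext (ψ or χ) R-ext e (inj₁ p) = inj₁ (pos-ext ψ R-ext e p)
    pos-ext (ψ or χ) R-ext e (inj₂ p) = inj₂ (pos-ext χ R-ext e p)
    pos-ext (some ψ) R-ext e (d , p) = d , pos-ext ψ R-ext (λ { zero → refl ; (suc i) → e i }) p
    pos-ext (every ψ) R-ext e p d = pos-ext ψ R-ext (λ { zero → refl ; (suc i) → e i }) (p d)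

    stage-ext : ∀ t g h → (∀ i → g i ≡ h i) → stage φ 𝒮 t g → stage φ 𝒮 t h
    stage-ext (suc t) g h e = pos-ext φ (stage-ext t) e

    module _ (d₀ d₁ : Fin (suc n)) (d₀≢d₁ : d₀ ≢ d₁) where

      module B t K K-⇒ K-⇐ = ToBlock 𝒮 {V} A-ext (stage φ 𝒮 t) (stage-ext t) K copyVar argVar K-⇒ K-⇐
        (λ i j e → ↑ˡ-injective _ i j (↑ʳ-injective a _ _ e))
        (λ i j → ↑ˡ-injective _ i j)
        (λ i j e → ↑ˡ≢↑ʳ j (i ↑ˡ length guarded) (sym e))

      fresh : ∀ t K K-⇒ K-⇐ → B.Fresh t K K-⇒ K-⇐ argVar freshVar
      fresh t K K-⇒ K-⇐ = record
        { f-inj = λ i j e → ↑ʳ-injective a i j (↑ʳ-injective a _ _ e)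
        ; f≢θ = λ i j e → ↑ˡ≢↑ʳ j (a ↑ʳ i) (sym e)
        ; c≢θ = λ i j e → ↑ˡ≢↑ʳ j (i ↑ˡ length guarded) (sym e)
        ; c≢f = λ i j e → ↑ˡ≢↑ʳ i j (↑ʳ-injective a _ _ e) }

      other : ∀ x → Σ (Fin (suc n)) (_≢ x)
      other x with d₀ ≟ x
      ... | no d₀≢x = d₀ , d₀≢x
      ... | yes refl = d₁ , d₀≢d₁ ∘ sym

      opaque
        unfolding guarded

        guarded-⇒ : ∀ t g → prefixSem guarded 𝒮 (stage φ 𝒮 t) g → pos φ 𝒮 (stage φ 𝒮 t) g
        guarded-⇒ t g r = P.TwoElements.prefix-⇒ d₀ d₁ d₀≢d₁ φ (P.renP-⇐ (prefix φ) suc (λ _ → refl)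
            (r zero (proj₁ (other zero) , λ e → proj₂ (other zero) (toℕ-injective (≤-antisym (proj₁ e) (proj₂ e))))))
          where module P = PrefixSem 𝒮 A-ext (stage φ 𝒮 t) (stage-ext t)

        guarded-⇐ : ∀ t g → pos φ 𝒮 (stage φ 𝒮 t) g → prefixSem guarded 𝒮 (stage φ 𝒮 t) g
        guarded-⇐ t g r d _ = P.renP-⇒ (prefix φ) suc (λ _ → refl) (P.TwoElements.prefix-⇐ d₀ d₁ d₀≢d₁ φ r)
          where module P = PrefixSem 𝒮 A-ext (stage φ 𝒮 t) (stage-ext t)

      rounds-⇒ : ∀ t τ → iterSem t block falseF 𝒮 τ → stage φ 𝒮 t (τ ∘ argVar)
      rounds-⇐ : ∀ t τ → stage φ 𝒮 t (τ ∘ argVar) → iterSem t block falseF 𝒮 τ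
      rounds-⇒ zero τ (d , u) = u (≤-refl , ≤-refl)
      rounds-⇒ (suc t) τ r = guarded-⇒ t (τ ∘ argVar)
        (B.toBlock-⇒ t _ (rounds-⇒ t) (rounds-⇐ t) guarded (fresh t _ (rounds-⇒ t) (rounds-⇐ t)) (λ _ → refl) r)
      rounds-⇐ (suc t) τ r =
        B.toBlock-⇐ t _ (rounds-⇒ t) (rounds-⇐ t) guarded (fresh t _ (rounds-⇒ t) (rounds-⇐ t)) (λ _ → refl) (guarded-⇐ t (τ ∘ argVar) r)

    opaque
      unfolding guarded

      -- The guard asks for a second element, so on this domain the outermost universal quantifier
      -- has nothing to check.
      rounds-trivial : (∀ (x y : Fin (suc n)) → x ≡ y) → ∀ t τ → iterSem (suc t) block falseF 𝒮 τ
      rounds-trivial one t τ d (e , u) = ⊥-elim (u (all-≤ _ _ , all-≤ _ _))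
        where
        all-≤ : ∀ (x y : Fin (suc n)) → toℕ x ≤ toℕ y
        all-≤ x y = ≤-reflexive (cong toℕ (one x y))

  iterFO : ℕ → IterFO m ar a
  iterFO d = record { k = a + length guarded ; block = block ; base = falseF ; d = d }

  module Evaluation {n : ℕ} (𝒮 : Structure (suc n) m ar) (A-ext : Extensional 𝒮) (d : ℕ) where
    open Rounds 𝒮 A-ext

    t : ℕ
    t = d * (loglog (suc n) + 1)

    initial : (Fin a → Fin (suc n)) → Fin V → Fin (suc n)
    initial g v = [ g , (λ _ → zero) ] (splitAt a v)

    initial-arg : ∀ g i → initial g (argVar i) ≡ g i
    initial-arg g i = cong [ g , (λ _ → zero) ] (splitAt-↑ˡ a i (a + length guarded))

    module _ (d₀ d₁ : Fin (suc n)) (d₀≢d₁ : d₀ ≢ d₁) where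
      eval-⇒ : ∀ g → evalIter (iterFO d) 𝒮 g → stage φ 𝒮 t g
      eval-⇒ g p = stage-ext t _ g (initial-arg g) (rounds-⇒ d₀ d₁ d₀≢d₁ t (initial g) p)

      eval-⇐ : ∀ g → stage φ 𝒮 t g → evalIter (iterFO d) 𝒮 g
      eval-⇐ g p = rounds-⇐ d₀ d₁ d₀≢d₁ t (initial g) (stage-ext t g _ (λ i → sym (initial-arg g i)) p)

    eval-trivial : (∀ (x y : Fin (suc n)) → x ≡ y) → ∀ t′ → suc t′ ≡ t → ∀ g → evalIter (iterFO d) 𝒮 g
    eval-trivial one t′ e g = subst (λ t → iterSem t block falseF 𝒮 (initial g)) e (rounds-trivial one t′ (initial g))

-- The extra variables of an 'IterFO' start at 0, so the same block also defines the
-- binary section of the relation at 0.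
module CompilePair {m : ℕ} {ar : Fin m → ℕ} {c : ℕ} (φ : Pos {m} {ar} (2 + c) (2 + c)) where
  open Compile φ

  iterFO₂ : ℕ → IterFO m ar 2
  iterFO₂ d = record { k = c + ((2 + c) + length guarded) ; block = block ; base = falseF ; d = d }

  padded : ∀ {n} → (Fin 2 → Fin (suc n)) → Fin (2 + c) → Fin (suc n)
  padded g v = [ g , (λ _ → zero) ] (splitAt 2 v)

  module PairEvaluation {n : ℕ} (𝒮 : Structure (suc n) m ar) (A-ext : Extensional 𝒮) (d : ℕ) where
    open Rounds 𝒮 A-ext

    t : ℕ
    t = d * (loglog (suc n) + 1)

    initial : (Fin 2 → Fin (suc n)) → Fin V → Fin (suc n)
    initial g v = [ g , (λ _ → zero) ] (splitAt 2 v)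

    initial-arg : ∀ g i → initial g (argVar i) ≡ padded g i
    initial-arg g zero = refl
    initial-arg g (suc zero) = refl
    initial-arg g (suc (suc i)) = refl

    module _ (d₀ d₁ : Fin (suc n)) (d₀≢d₁ : d₀ ≢ d₁) where
      eval-⇒ : ∀ g → evalIter (iterFO₂ d) 𝒮 g → stage φ 𝒮 t (padded g)
      eval-⇒ g p = stage-ext t _ (padded g) (initial-arg g) (rounds-⇒ d₀ d₁ d₀≢d₁ t (initial g) p)

      eval-⇐ : ∀ g → stage φ 𝒮 t (padded g) → evalIter (iterFO₂ d) 𝒮 g
      eval-⇐ g p = rounds-⇐ d₀ d₁ d₀≢d₁ t (initial g) (stage-ext t (padded g) _ (λ i → sym (initial-arg g i)) p)

    eval-trivial : (∀ (x y : Fin (suc n)) → x ≡ y) → ∀ t′ → suc t′ ≡ t → ∀ g → evalIter (iterFO₂ d) 𝒮 g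
    eval-trivial one t′ e g = subst (λ t → iterSem t block falseF 𝒮 (initial g)) e (rounds-trivial one t′ (initial g))

-- Finite sums and digits

𝟙 : ∀ {P : Set} → Dec P → ℕ
𝟙 (yes _) = 1
𝟙 (no _) = 0

𝟙-yes : ∀ {P : Set} (d : Dec P) → P → 𝟙 d ≡ 1
𝟙-yes (yes _) p = refl
𝟙-yes (no ¬p) p = ⊥-elim (¬p p)

𝟙-no : ∀ {P : Set} (d : Dec P) → ¬ P → 𝟙 d ≡ 0
𝟙-no (yes p) ¬p = ⊥-elim (¬p p)
𝟙-no (no _) ¬p = refl

𝟙-cong : ∀ {P Q : Set} (d : Dec P) (e : Dec Q) → (P → Q) → (Q → P) → 𝟙 d ≡ 𝟙 e
𝟙-cong (yes p) e f g = sym (𝟙-yes e (f p))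
𝟙-cong (no ¬p) e f g = sym (𝟙-no e (¬p ∘ g))

𝟙-mono : ∀ {P Q : Set} (d : Dec P) (e : Dec Q) → (P → Q) → 𝟙 d ≤ 𝟙 e
𝟙-mono (no _) e f = z≤n
𝟙-mono (yes p) e f = ≤-reflexive (sym (𝟙-yes e (f p)))

𝟙≤1 : ∀ {P : Set} (d : Dec P) → 𝟙 d ≤ 1
𝟙≤1 (yes _) = ≤-refl
𝟙≤1 (no _) = z≤n

𝟙>0 : ∀ {P : Set} (d : Dec P) → 0 < 𝟙 d → P
𝟙>0 (yes p) _ = p

sum-mono : ∀ {N} {f g : Fin N → ℕ} → (∀ i → f i ≤ g i) → sum f ≤ sum g
sum-mono {zero} h = z≤n
sum-mono {suc N} h = +-mono-≤ (h zero) (sum-mono (h ∘ suc))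

sum-≡0 : ∀ {N} {f : Fin N → ℕ} → (∀ i → f i ≡ 0) → sum f ≡ 0
sum-≡0 {zero} h = refl
sum-≡0 {suc N} h = cong₂ _+_ (h zero) (sum-≡0 (h ∘ suc))

term≤sum : ∀ {N} (f : Fin N → ℕ) i → f i ≤ sum f
term≤sum f zero = m≤m+n _ _
term≤sum f (suc i) = ≤-trans (term≤sum (f ∘ suc) i) (m≤n+m _ (f zero))

two-terms≤sum : ∀ {N} (f : Fin N → ℕ) i j → i ≢ j → f i + f j ≤ sum f
two-terms≤sum f zero zero i≢j = ⊥-elim (i≢j refl)
two-terms≤sum f zero (suc j) i≢j = +-monoʳ-≤ (f zero) (term≤sum (f ∘ suc) j)
two-terms≤sum f (suc i) zero i≢j = subst (_≤ sum f) (+-comm (f zero) _) (+-monoʳ-≤ (f zero) (term≤sum (f ∘ suc) i))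
two-terms≤sum f (suc i) (suc j) i≢j = ≤-trans (two-terms≤sum (f ∘ suc) i j (i≢j ∘ cong suc)) (m≤n+m _ (f zero))

sum-single : ∀ {N} (f : Fin N → ℕ) i → (∀ j → j ≢ i → f j ≡ 0) → sum f ≡ f i
sum-single f zero h = trans (cong (f zero +_) (sum-≡0 (λ j → h (suc j) λ ()))) (+-identityʳ _)
sum-single f (suc i) h = trans (cong (_+ sum (f ∘ suc)) (h zero λ ()))
  (sum-single (f ∘ suc) i (λ j j≢i → h (suc j) (j≢i ∘ suc-injective)))

sum>0 : ∀ {N} (f : Fin N → ℕ) → 0 < sum f → Σ (Fin N) λ i → 0 < f i
sum>0 {suc N} f p with f zero in eq
... | suc _ = zero , subst (0 <_) (sym eq) (s≤s z≤n)
... | zero = Data.Product.map suc (λ q → q) (sum>0 (f ∘ suc) p)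

sum≤1 : ∀ {N} (f : Fin N → ℕ) → (∀ i → f i ≤ 1) → (∀ i j → 0 < f i → 0 < f j → i ≡ j) → sum f ≤ 1
sum≤1 {zero} f h u = z≤n
sum≤1 {suc N} f h u with f zero in eq
... | zero = sum≤1 (f ∘ suc) (h ∘ suc) (λ i j p q → suc-injective (u _ _ p q))
... | suc k = subst (_≤ 1) (sym (trans (cong (suc k +_) (sum-≡0 rest)) (+-identityʳ _))) (subst (_≤ 1) eq (h zero))
  where
  rest : ∀ i → f (suc i) ≡ 0
  rest i with f (suc i) in eq′
  ... | zero = refl
  ... | suc _ with u zero (suc i) (subst (0 <_) (sym eq) (s≤s z≤n)) (subst (0 <_) (sym eq′) (s≤s z≤n))
  ...   | ()

sum≤N : ∀ {N} (f : Fin N → ℕ) → (∀ i → f i ≤ 1) → sum f ≤ N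
sum≤N {zero} f h = z≤n
sum≤N {suc N} f h = +-mono-≤ (h zero) (sum≤N (f ∘ suc) (h ∘ suc))

-- Numbers with digits in base N + 1: 'value' is the number whose v-th digit counts
-- (with multiplicity φ) the indices of exponent v.
module Digits (N : ℕ) where

  base : ℕ
  base = suc N

  value : (φ e : Fin N → ℕ) → ℕ
  value φ e = sum (λ b → φ b * base ^ e b)

  digit : (φ e : Fin N → ℕ) → ℕ → ℕ
  digit φ e v = sum (λ b → φ b * 𝟙 (e b ≟ℕ v))

  -- An index of exponent 0 would stay at 0 under `pred` and be counted again in the next digit; its
  -- multiplicity is therefore cleared.
  high : (φ e : Fin N → ℕ) → Fin N → ℕ
  high φ e b with e b
  ... | zero = 0
  ... | suc _ = φ b

  high≤ : ∀ φ e b → high φ e b ≤ φ b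
  high≤ φ e b with e b
  ... | zero = z≤n
  ... | suc _ = ≤-refl

  value-split : ∀ φ e → value φ e ≡ digit φ e 0 + value (high φ e) (pred ∘ e) * base
  value-split φ e = begin
    sum (λ b → φ b * base ^ e b)                                     ≡⟨ sum-cong-≗ term ⟩
    sum (λ b → φ b * 𝟙 (e b ≟ℕ 0) + base * (high φ e b * base ^ pred (e b)))  ≡⟨ ∑-distrib-+ (λ b → φ b * 𝟙 (e b ≟ℕ 0)) _ ⟩
    digit φ e 0 + sum (λ b → base * (high φ e b * base ^ pred (e b)))  ≡⟨ cong (digit φ e 0 +_) (*-distribˡ-sum base (λ b → high φ e b * base ^ pred (e b))) ⟨
    digit φ e 0 + base * value (high φ e) (pred ∘ e)                  ≡⟨ cong (digit φ e 0 +_) (*-comm base _) ⟩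
    digit φ e 0 + value (high φ e) (pred ∘ e) * base                  ∎
    where
    open ≡-Reasoning
    term : ∀ b → φ b * base ^ e b ≡ φ b * 𝟙 (e b ≟ℕ 0) + base * (high φ e b * base ^ pred (e b))
    term b with e b
    ... | zero = sym (trans (cong (φ b * 1 +_) (*-zeroʳ base)) (+-identityʳ _))
    ... | suc k = trans (sym (*-assoc (φ b) base _)) (trans (cong (_* base ^ k) (*-comm (φ b) base))
                    (trans (*-assoc base (φ b) _) (cong (_+ base * (φ b * base ^ k)) (sym (*-zeroʳ (φ b))))))

  digit-high : ∀ φ e v → digit (high φ e) (pred ∘ e) v ≡ digit φ e (suc v)
  digit-high φ e v = sum-cong-≗ term
    where
    term : ∀ b → high φ e b * 𝟙 (pred (e b) ≟ℕ v) ≡ φ b * 𝟙 (e b ≟ℕ suc v)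
    term b with e b
    ... | zero = sym (*-zeroʳ (φ b))
    ... | suc k = cong (φ b *_) (𝟙-cong (k ≟ℕ v) (suc k ≟ℕ suc v) (cong suc) (cong pred))

  digit<base : ∀ φ e v → (∀ b → φ b ≤ 1) → digit φ e v < base
  digit<base φ e v φ≤1 = s≤s (sum≤N _ (λ b → *-mono-≤ (φ≤1 b) (𝟙≤1 (e b ≟ℕ v))))

  division-unique : ∀ {r r′} q q′ → r < base → r′ < base → r + q * base ≡ r′ + q′ * base → r ≡ r′ × q ≡ q′
  division-unique {r} {r′} q q′ r< r′< eq = r≡r′ , *-cancelʳ-≡ q q′ base (+-cancelˡ-≡ r′ _ _ (trans (cong (_+ q * base) (sym r≡r′)) eq))
    where
    r≡r′ : r ≡ r′
    r≡r′ = begin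
      r                        ≡⟨ m<n⇒m%n≡m r< ⟨
      r % base                 ≡⟨ [m+kn]%n≡m%n r q base ⟨
      (r + q * base) % base    ≡⟨ cong (_% base) eq ⟩
      (r′ + q′ * base) % base  ≡⟨ [m+kn]%n≡m%n r′ q′ base ⟩
      r′ % base                ≡⟨ m<n⇒m%n≡m r′< ⟩
      r′                       ∎
      where open ≡-Reasoning

  -- Multiplicities of at most 1 over N indices keep every digit below the base N + 1. Thus there
  -- are no carries, and division by the base peels off the digits one at a time.
  value⇒digit : ∀ φ e φ′ e′ → (∀ b → φ b ≤ 1) → (∀ b → φ′ b ≤ 1) → value φ e ≡ value φ′ e′ →
                ∀ v → digit φ e v ≡ digit φ′ e′ v
  value⇒digit φ e φ′ e′ h h′ eq v
    with division-unique (value (high φ e) (pred ∘ e)) (value (high φ′ e′) (pred ∘ e′)) (digit<base φ e 0 h) (digit<base φ′ e′ 0 h′)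
           (trans (sym (value-split φ e)) (trans eq (value-split φ′ e′)))
  value⇒digit φ e φ′ e′ h h′ eq zero | d , _ = d
  value⇒digit φ e φ′ e′ h h′ eq (suc v) | _ , q =
    trans (sym (digit-high φ e v))
      (trans (value⇒digit (high φ e) (pred ∘ e) (high φ′ e′) (pred ∘ e′)
                (λ b → ≤-trans (high≤ φ e b) (h b)) (λ b → ≤-trans (high≤ φ′ e′ b) (h′ b)) q v)
             (digit-high φ′ e′ v))

  -- The bound `M` on the exponents in use ends the peeling: when it reaches 0, all multiplicities
  -- are 0 and so are both values.
  digit⇒value : ∀ M φ e φ′ e′ → (∀ b → 0 < φ b → e b < M) → (∀ b → 0 < φ′ b → e′ b < M) →
                (∀ v → digit φ e v ≡ digit φ′ e′ v) → value φ e ≡ value φ′ e′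
  digit⇒value zero φ e φ′ e′ h h′ d = trans (sum-≡0 (z φ e h)) (sym (sum-≡0 (z φ′ e′ h′)))
    where
    z : ∀ (φ e : Fin N → ℕ) → (∀ b → 0 < φ b → e b < 0) → ∀ b → φ b * base ^ e b ≡ 0
    z φ e h b with φ b in eq
    ... | zero = refl
    ... | suc _ with h b (subst (0 <_) (sym eq) (s≤s z≤n))
    ...   | ()
  digit⇒value (suc M) φ e φ′ e′ h h′ d =
    trans (value-split φ e) (trans (cong₂ (λ x y → x + y * base) (d 0)
      (digit⇒value M (high φ e) (pred ∘ e) (high φ′ e′) (pred ∘ e′) (bound φ e h) (bound φ′ e′ h′)
        (λ v → trans (digit-high φ e v) (trans (d (suc v)) (sym (digit-high φ′ e′ v))))))
      (sym (value-split φ′ e′)))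
    where
    bound : ∀ (φ e : Fin N → ℕ) → (∀ b → 0 < φ b → e b < suc M) → ∀ b → 0 < high φ e b → pred (e b) < M
    bound φ e h b p with e b | h b
    ... | suc k | q = s≤s⁻¹ (q p)

-- Forests and codes of subtrees

infixr 5 _∷_
data Path {N : ℕ} (E : BRel N) : Fin N → ℕ → Fin N → Set where
  []  : ∀ {x} → Path E x 0 x
  _∷_ : ∀ {x z y k} → T (E x z) → Path E z k y → Path E x (suc k) y

module _ {N : ℕ} {E : BRel N} where

  append : ∀ {x y z j k} → Path E x j y → Path E y k z → Path E x (j + k) z
  append [] q = q
  append (e ∷ p) q = e ∷ append p q

  snoc : ∀ {x y z k} → Path E x k y → T (E y z) → Path E x (suc k) z
  snoc [] e = e ∷ []
  snoc (d ∷ p) e = d ∷ snoc p e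

  unsnoc : ∀ {x y k} → Path E x (suc k) y → Σ (Fin N) λ z → Path E x k z × T (E z y)
  unsnoc (e ∷ []) = _ , [] , e
  unsnoc (e ∷ p@(_ ∷ _)) with unsnoc p
  ... | z , q , d = z , e ∷ q , d

  path⇒reach : ∀ {x y k} → Path E x k y → Reach E x y
  path⇒reach [] = ε
  path⇒reach (e ∷ p) = e ◅ path⇒reach p

  reach⇒path : ∀ {x y} → Reach E x y → Σ ℕ λ k → Path E x k y
  reach⇒path ε = 0 , []
  reach⇒path (e ◅ p) with reach⇒path p
  ... | k , q = suc k , e ∷ q

  path? : ∀ x k y → Dec (Path E x k y)
  path? x zero y with x ≟ y
  ... | yes refl = yes []
  ... | no x≢y = no λ { [] → x≢y refl }
  path? x (suc k) y = map′ (λ { (z , e , p) → e ∷ p }) (λ { (e ∷ p) → _ , e , p })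
                        (any? (λ z → T? (E x z) ×-dec path? z k y))

  node : ∀ {x y k} → Path E x k y → Fin (suc k) → Fin N
  node {x} p zero = x
  node (e ∷ p) (suc i) = node p i

  node-path : ∀ {x y k} (p : Path E x k y) i → Path E x (toℕ i) (node p i)
  node-path p zero = []
  node-path (e ∷ p) (suc i) = e ∷ node-path p i

  node-between : ∀ {x y k} (p : Path E x k y) i j → toℕ i < toℕ j → Σ ℕ λ m → Path E (node p i) (suc m) (node p j)
  node-between (e ∷ p) zero (suc j) _ = toℕ j , e ∷ node-path p j
  node-between (e ∷ p) (suc i) (suc j) i<j = node-between p i j (s≤s⁻¹ i<j)

-- The exponents make 'codeUpTo' determine the multiset of the children's codes,
-- so equal codes mean isomorphic subtrees; the base N + 1 is the same for all
-- forests on the domain, so codes of different forests can be compared.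
module _ {N : ℕ} (E : BRel N) where
  open Digits N

  child : Fin N → Fin N → ℕ
  child x b = 𝟙 (T? (E x b))

  codeUpTo : ℕ → Fin N → ℕ
  codeUpTo zero x = 0
  codeUpTo (suc h) x = value (child x) (codeUpTo h)

  code : Fin N → ℕ
  code = codeUpTo N

  -- `z′` is the child on a chosen path and `b` hangs off that path. Taking `z′ = z` excludes
  -- nothing, since in a forest no node is its own child; so `hangs z z` counts all children.
  Hang : Fin N → Fin N → Fin N → Set
  Hang z z′ b = T (E z b) × b ≢ z′

  hang? : ∀ z z′ b → Dec (Hang z z′ b)
  hang? z z′ b = T? (E z b) ×-dec ¬? (b ≟ z′)

  hangOf? : ∀ z z′ v b → Dec (Hang z z′ b × code b ≡ v)
  hangOf? z z′ v b = hang? z z′ b ×-dec (code b ≟ℕ v)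

  hangs : Fin N → Fin N → ℕ → ℕ
  hangs z z′ v = sum (λ b → 𝟙 (hangOf? z z′ v b))

𝟙-× : ∀ {P Q : Set} (d : Dec P) (e : Dec Q) → 𝟙 d * 𝟙 e ≡ 𝟙 (d ×-dec e)
𝟙-× (yes p) (yes q) = refl
𝟙-× (yes p) (no q) = refl
𝟙-× (no p) e = refl

module Forest {N : ℕ} (E : BRel N) (forest : IsForest E) where
  open Digits N

  parent-unique : ∀ {u u′ v} → T (E u v) → T (E u′ v) → u ≡ u′
  parent-unique = proj₁ forest _ _ _

  no-cycle : ∀ {x k} → ¬ Path E x (suc k) x
  no-cycle (e ∷ p) = proj₂ forest _ _ e (path⇒reach p)

  no-loop : ∀ {x y} → T (E x y) → y ≢ x
  no-loop e refl = no-cycle (e ∷ [])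

  path-length : ∀ {x k y} → Path E x k y → k < N
  path-length {k = k} p with N ≤? k
  ... | no N≰k = ≰⇒> N≰k
  ... | yes N≤k with pigeonhole (s≤s N≤k) (node p)
  ...   | i , j , i<j , eq with node-between p i j i<j
  ...     | m , q = ⊥-elim (no-cycle (subst (Path E _ (suc m)) (sym eq) q))

  start-unique : ∀ {k x x′ y} → Path E x k y → Path E x′ k y → x ≡ x′
  start-unique {zero} [] [] = refl
  start-unique {suc k} p q with unsnoc p | unsnoc q
  ... | z , p′ , e | z′ , q′ , e′ with parent-unique e e′
  ...   | refl = start-unique p′ q′

  -- Walking up from `y` is deterministic, so the shorter path is an end piece of the longer one.
  path-≤ : ∀ {j k x x′ y} → j ≤ k → Path E x j y → Path E x′ k y → Path E x′ (k ∸ j) x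
  path-≤ {zero} j≤k [] q = q
  path-≤ {suc j} {suc k} j≤k p q with unsnoc p | unsnoc q
  ... | z , p′ , e | z′ , q′ , e′ with parent-unique e e′
  ...   | refl = path-≤ (s≤s⁻¹ j≤k) p′ q′

  length-unique : ∀ {j k x y} → Path E x j y → Path E x k y → j ≡ k
  length-unique p q = ≤-antisym (≮⇒≥ (λ k<j → not-shorter q p k<j)) (≮⇒≥ (λ j<k → not-shorter p q j<k))
    where
    cycle : ∀ {i x} → 0 < i → Path E x i x → ⊥
    cycle {suc i} _ c = no-cycle c
    not-shorter : ∀ {j k x y} → Path E x j y → Path E x k y → j < k → ⊥
    not-shorter p q j<k = cycle (m<n⇒0<n∸m j<k) (path-≤ (<⇒≤ j<k) p q)

  -- Climbing to parents must stop, because paths are shorter than N; the fuel and the length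
  -- climbed always add up to N.
  root : ∀ y → Σ (Fin N) λ u → Σ ℕ λ k → Path E u k y × (∀ p → ¬ T (E p u))
  root y = climb N [] (+-identityʳ N)
    where
    climb : ∀ f {u k} → Path E u k y → f + k ≡ N → Σ (Fin N) λ u → Σ ℕ λ k → Path E u k y × (∀ p → ¬ T (E p u))
    climb zero p refl = ⊥-elim (<-irrefl refl (path-length p))
    climb (suc f) {u} p e with any? (λ q → T? (E q u))
    ... | yes (q , d) = climb f (d ∷ p) (trans (+-suc f _) e)
    ... | no ¬q = u , _ , p , λ q d → ¬q (q , d)

  reach? : ∀ x y → Dec (Σ ℕ λ k → Path E x k y)
  reach? x y = map′ (λ { (k , p) → toℕ k , p })
                    (λ { (k , p) → fromℕ< (path-length p) , subst (λ i → Path E x i y) (sym (toℕ-fromℕ< _)) p })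
                    (any? (λ k → path? x (toℕ k) y))

  -- Unrolling to height `h` misses nothing once all downward paths are shorter than `h`. Height N
  -- suffices for every node, which makes `code` satisfy its own recursion.
  codeUpTo-stable : ∀ h x → (∀ {k y} → Path E x k y → k < h) → codeUpTo E h x ≡ codeUpTo E (suc h) x
  codeUpTo-stable zero x bound with bound []
  ... | ()
  codeUpTo-stable (suc h) x bound = sum-cong-≗ term
    where
    term : ∀ b → child E x b * base ^ codeUpTo E h b ≡ child E x b * base ^ codeUpTo E (suc h) b
    term b with T? (E x b)
    ... | yes e = cong (λ c → 1 * base ^ c) (codeUpTo-stable h b (λ p → s≤s⁻¹ (bound (e ∷ p))))
    ... | no _ = refl

  code-unfold : ∀ x → code E x ≡ value (child E x) (code E)
  code-unfold x = codeUpTo-stable N x path-length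

  digit≡hangs : ∀ x v → digit (child E x) (code E) v ≡ hangs E x x v
  digit≡hangs x v = sum-cong-≗ λ b → trans (𝟙-× (T? (E x b)) (code E b ≟ℕ v))
    (𝟙-cong (T? (E x b) ×-dec (code E b ≟ℕ v)) (hangOf? E x x v b)
      (λ { (e , c) → (e , no-loop e) , c }) (λ { ((e , _) , c) → e , c }))

  SameHangs : (z z′ w w′ : Fin N) → Set
  SameHangs z z′ w w′ = ∀ v → hangs E z z′ v ≡ hangs E w w′ v

  code⇒hangs : ∀ {x y} → code E x ≡ code E y → SameHangs x x y y
  code⇒hangs {x} {y} eq v = trans (sym (digit≡hangs x v))
    (trans (value⇒digit (child E x) (code E) (child E y) (code E) (λ b → 𝟙≤1 (T? (E x b))) (λ b → 𝟙≤1 (T? (E y b)))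
              (trans (sym (code-unfold x)) (trans eq (code-unfold y))) v)
           (digit≡hangs y v))

  hangs⇒code : ∀ {x y} → SameHangs x x y y → code E x ≡ code E y
  hangs⇒code {x} {y} h = trans (code-unfold x)
    (trans (digit⇒value (suc (sum (code E))) (child E x) (code E) (child E y) (code E)
              (λ b _ → s≤s (term≤sum (code E) b)) (λ b _ → s≤s (term≤sum (code E) b))
              (λ v → trans (digit≡hangs x v) (trans (h v) (sym (digit≡hangs y v)))))
           (sym (code-unfold y)))

  hangs-except : ∀ {z z′} → T (E z z′) → ∀ v → hangs E z z v ≡ hangs E z z′ v + 𝟙 (code E z′ ≟ℕ v)
  hangs-except {z} {z′} e v = trans (sum-cong-≗ term)
    (trans (∑-distrib-+ (λ b → 𝟙 (hang? E z z′ b ×-dec (code E b ≟ℕ v))) (λ b → 𝟙 ((b ≟ z′) ×-dec (code E b ≟ℕ v))))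
      (cong (hangs E z z′ v +_) (trans (sum-single _ z′ (λ b b≢z′ → 𝟙-no ((b ≟ z′) ×-dec (code E b ≟ℕ v)) (b≢z′ ∘ proj₁)))
        (𝟙-cong ((z′ ≟ z′) ×-dec (code E z′ ≟ℕ v)) (code E z′ ≟ℕ v) proj₂ (refl ,_)))))
    where
    term : ∀ b → 𝟙 (hang? E z z b ×-dec (code E b ≟ℕ v)) ≡
                 𝟙 (hang? E z z′ b ×-dec (code E b ≟ℕ v)) + 𝟙 ((b ≟ z′) ×-dec (code E b ≟ℕ v))
    term b with b ≟ z′
    ... | yes refl = trans (𝟙-cong (hang? E z z b ×-dec (code E b ≟ℕ v)) (code E b ≟ℕ v) proj₂ (λ c → (e , no-loop e) , c))
                       (cong₂ _+_ (sym (𝟙-no ((T? (E z b) ×-dec no (λ ¬p → ¬p refl)) ×-dec (code E b ≟ℕ v)) (λ { ((_ , ¬p) , _) → ¬p refl })))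
                                  (𝟙-cong (code E b ≟ℕ v) (yes refl ×-dec (code E b ≟ℕ v)) (refl ,_) proj₂))
    ... | no b≢z′ = trans (𝟙-cong (hang? E z z b ×-dec (code E b ≟ℕ v)) ((T? (E z b) ×-dec yes b≢z′) ×-dec (code E b ≟ℕ v))
                             (λ { ((d , _) , c) → (d , b≢z′) , c }) (λ { ((d , _) , c) → (d , no-loop d) , c }))
                       (sym (+-identityʳ _))

  hang-of-code : ∀ z z′ v → 0 < hangs E z z′ v → Σ (Fin N) λ b → Hang E z z′ b × code E b ≡ v
  hang-of-code z z′ v p with sum>0 _ p
  ... | b , q = b , 𝟙>0 (hangOf? E z z′ v b) q

  hangs>0 : ∀ {z z′ b} → Hang E z z′ b → 0 < hangs E z z′ (code E b)
  hangs>0 {z} {z′} {b} h = ≤-trans (≤-reflexive (sym (𝟙-yes (hangOf? E z z′ (code E b) b) (h , refl))))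
    (term≤sum (λ b′ → 𝟙 (hangOf? E z z′ (code E b) b′)) b)

  children-except : ∀ {z z′ w w′} → T (E z z′) → T (E w w′) → code E z′ ≡ code E w′ →
                    SameHangs z z w w → SameHangs z z′ w w′
  children-except {z} {z′} {w} {w′} e e′ c h v = +-cancelʳ-≡ (𝟙 (code E z′ ≟ℕ v)) _ _
    (trans (sym (hangs-except e v)) (trans (h v) (trans (hangs-except e′ v) (cong (λ c → hangs E w w′ v + 𝟙 (c ≟ℕ v)) (sym c)))))

  children-with : ∀ {z z′ w w′} → T (E z z′) → T (E w w′) → code E z′ ≡ code E w′ →
                  SameHangs z z′ w w′ → SameHangs z z w w
  children-with {z} {z′} {w} {w′} e e′ c h v = trans (hangs-except e v)
    (trans (cong₂ (λ k c → k + 𝟙 (c ≟ℕ v)) (h v) c) (sym (hangs-except e′ v)))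

  -- `SameHangs` ranges over all numbers; here the classes are named by nodes, over which a formula
  -- can quantify. Counts are needed only for representatives from the first side, as the second
  -- clause rules out classes that occur only on the other side. This asymmetry is what allows the
  -- side of the representatives to be chosen by weight.
  Matching : (z z′ w w′ : Fin N) → Set
  Matching z z′ w w′ = (∀ t → Hang E z z′ t → hangs E z z′ (code E t) ≡ hangs E w w′ (code E t))
                     × (∀ b → Hang E w w′ b → Σ (Fin N) λ t → Hang E z z′ t × code E t ≡ code E b)

  matching? : ∀ z z′ w w′ → Dec (Matching z z′ w w′)
  matching? z z′ w w′ = all? (λ t → hang? E z z′ t →-dec (hangs E z z′ (code E t) ≟ℕ hangs E w w′ (code E t)))
    ×-dec all? (λ b → hang? E w w′ b →-dec any? (λ t → hang? E z z′ t ×-dec (code E t ≟ℕ code E b)))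

  matching⇒ : ∀ {z z′ w w′} → Matching z z′ w w′ → SameHangs z z′ w w′
  matching⇒ {z} {z′} {w} {w′} (h , k) v with 0 <? hangs E z z′ v
  ... | yes p with hang-of-code z z′ v p
  ...   | t , ht , refl = h t ht
  matching⇒ {z} {z′} {w} {w′} (h , k) v | no ¬p with 0 <? hangs E w w′ v
  ... | no ¬q = trans (n≤0⇒n≡0 (≮⇒≥ ¬p)) (sym (n≤0⇒n≡0 (≮⇒≥ ¬q)))
  ... | yes q with hang-of-code w w′ v q
  ...   | b , hb , refl with k b hb
  ...     | t , ht , c = ⊥-elim (¬p (subst (λ c → 0 < hangs E z z′ c) c (hangs>0 ht)))

  ⇒matching : ∀ {z z′ w w′} → SameHangs z z′ w w′ → Matching z z′ w w′
  ⇒matching {z} {z′} {w} {w′} h = (λ t _ → h (code E t)) ,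
    λ b hb → hang-of-code z z′ (code E b) (subst (0 <_) (sym (h (code E b))) (hangs>0 hb))

  -- Levels are numbered from the lower end, because the ancestor of `y` at distance `j` is unique
  -- whereas descendants at a given distance are not.
  Level : ℕ → (y y* : Fin N) → Set
  Level j y y* = Σ (Fin N) λ z′ → Σ (Fin N) λ z → Σ (Fin N) λ w′ → Σ (Fin N) λ w →
    Path E z′ j y × Path E w′ j y* × T (E z z′) × T (E w w′) × SameHangs z z′ w w′

  -- Equal codes give equally many children of every code, so each step of the path can be copied in
  -- the other tree. Removing the chosen child on both sides leaves equal multisets.
  descend : ∀ {k x x* y} → code E x ≡ code E x* → Path E x k y →
            Σ (Fin N) λ y* → Path E x* k y* × code E y ≡ code E y* × (∀ j → j < k → Level j y y*)
  descend c [] = _ , [] , c , λ _ ()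
  descend {suc k} {x} {x*} {y} c (_∷_ {z = x₁} e p)
    with hang-of-code x* x* (code E x₁) (subst (0 <_) (code⇒hangs c (code E x₁)) (hangs>0 (e , no-loop e)))
  ... | x₁* , (e* , _) , c₁ with descend (sym c₁) p
  ...   | y* , p* , cy , lev = y* , e* ∷ p* , cy , lev′
    where
    lev′ : ∀ j → j < suc k → Level j y y*
    lev′ j j< with j ≟ℕ k
    ... | yes refl = x₁ , x , x₁* , x* , p , p* , e , e* , children-except e e* (sym c₁) (code⇒hangs c)
    ... | no j≢k = lev j (≤∧≢⇒< (s≤s⁻¹ j<) j≢k)

  -- From the lower ends upwards: path children with equal codes, together with equal multisets
  -- hanging beside them, give parents with equal codes.
  ascend : ∀ {k x x* y y*} → Path E x k y → Path E x* k y* → code E y ≡ code E y* →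
           (∀ j → j < k → Level j y y*) → code E x ≡ code E x*
  ascend [] [] c lev = c
  ascend {suc k} (e ∷ p) (e* ∷ p*) c lev with lev k ≤-refl
  ... | z′ , z , w′ , w , q , q* , d , d* , h with start-unique p q | start-unique p* q*
  ...   | refl | refl with parent-unique e d | parent-unique e* d*
  ...     | refl | refl = hangs⇒code (children-with e e* (ascend p p* c (λ j j<k → lev j (m<n⇒m<1+n j<k))) h)

-- Equal codes and isomorphism

-- Both sums are margins of the matrix with entry `φ b` at (b, f b). The inverse laws are asked for
-- only at positive terms, because an isomorphism is controlled only inside the two subtrees.
sum-reindex : ∀ {N} (φ ψ : Fin N → ℕ) (f g : Fin N → Fin N) →
              (∀ b → 0 < φ b → ψ (f b) ≡ φ b × g (f b) ≡ b) →
              (∀ c → 0 < ψ c → φ (g c) ≡ ψ c × f (g c) ≡ c) → sum φ ≡ sum ψ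
sum-reindex φ ψ f g hφ hψ = trans (sum-cong-≗ row) (trans (∑-comm (λ b c → φ b * 𝟙 (c ≟ f b))) (sum-cong-≗ column))
  where
  row : ∀ b → φ b ≡ sum (λ c → φ b * 𝟙 (c ≟ f b))
  row b = sym (trans (sum-single _ (f b) (λ c c≢ → trans (cong (φ b *_) (𝟙-no (c ≟ f b) c≢)) (*-zeroʳ (φ b))))
                (trans (cong (φ b *_) (𝟙-yes (f b ≟ f b) refl)) (*-identityʳ (φ b))))
  column : ∀ c → sum (λ b → φ b * 𝟙 (c ≟ f b)) ≡ ψ c
  column c with ψ c in eq
  ... | zero = sum-≡0 λ b → lem b
    where
    lem : ∀ b → φ b * 𝟙 (c ≟ f b) ≡ 0
    lem b with c ≟ f b
    ... | no _ = *-zeroʳ (φ b)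
    ... | yes refl with φ b in eq′
    ...   | zero = refl
    ...   | suc k with trans (sym eq) (trans (proj₁ (hφ b (subst (0 <_) (sym eq′) (s≤s z≤n)))) eq′)
    ...     | ()
  ... | suc m with hψ c (subst (0 <_) (sym eq) (s≤s z≤n))
  ...   | φg , fg = trans (sum-single _ (g c) lem)
            (trans (cong (φ (g c) *_) (𝟙-yes (c ≟ f (g c)) (sym fg))) (trans (*-identityʳ _) (trans φg eq)))
    where
    lem : ∀ b → b ≢ g c → φ b * 𝟙 (c ≟ f b) ≡ 0
    lem b b≢ with c ≟ f b
    ... | no _ = *-zeroʳ (φ b)
    ... | yes refl with φ b in eq′
    ...   | zero = refl
    ...   | suc k = ⊥-elim (b≢ (sym (proj₂ (hφ b (subst (0 <_) (sym eq′) (s≤s z≤n))))))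

-- The rank of `c` among the indices satisfying `P`.
below : ∀ {N} {P : Fin N → Set} → (∀ i → Dec (P i)) → Fin N → ℕ
below P? c = sum (λ b → 𝟙 ((toℕ b <? toℕ c) ×-dec P? b))

below-suc : ∀ {N} {P : Fin (suc N) → Set} (P? : ∀ i → Dec (P i)) c → below P? (suc c) ≡ 𝟙 (P? zero) + below (P? ∘ suc) c
below-suc P? c = cong₂ _+_ (𝟙-cong ((0 <? suc (toℕ c)) ×-dec P? zero) (P? zero) proj₂ (s≤s z≤n ,_))
  (sum-cong-≗ λ b → 𝟙-cong ((suc (toℕ b) <? suc (toℕ c)) ×-dec P? (suc b)) ((toℕ b <? toℕ c) ×-dec P? (suc b))
    (λ { (l , q) → s≤s⁻¹ l , q }) (λ { (l , q) → s≤s l , q }))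

select : ∀ {N} {P : Fin N → Set} (P? : ∀ i → Dec (P i)) k → k < sum (λ b → 𝟙 (P? b)) →
         Σ (Fin N) λ c → P c × below P? c ≡ k
select {suc N} {P} P? k k< = first (P? zero) refl k k<
  where
  first : (d : Dec (P zero)) → d ≡ P? zero → ∀ k → k < 𝟙 d + sum (λ b → 𝟙 (P? (suc b))) → Σ (Fin (suc N)) λ c → P c × below P? c ≡ k
  first (no ¬p) d≡ k k< with select (P? ∘ suc) k k<
  ... | c , pc , e = suc c , pc , trans (below-suc P? c) (cong₂ _+_ (cong 𝟙 (sym d≡)) e)
  first (yes p) d≡ zero k< = zero , p , sum-≡0 λ b → 𝟙-no ((toℕ b <? 0) ×-dec P? b) λ { (() , _) }
  first (yes p) d≡ (suc k) k< with select (P? ∘ suc) k (s≤s⁻¹ k<)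
  ... | c , pc , e = suc c , pc , trans (below-suc P? c) (cong₂ _+_ (cong 𝟙 (sym d≡)) e)

below-suc≤ : ∀ {N} {P : Fin N → Set} (P? : ∀ i → Dec (P i)) {c} {Q : Fin N → Set} (Q? : ∀ i → Dec (Q i)) →
             (∀ b → toℕ b < toℕ c → P b → Q b) → Q c → below P? c < sum (λ b → 𝟙 (Q? b))
below-suc≤ P? {c} Q? h qc = ≤-trans (≤-reflexive (sym total)) (sum-mono term)
  where
  total : sum (λ b → 𝟙 ((toℕ b <? toℕ c) ×-dec P? b) + 𝟙 (b ≟ c)) ≡ suc (below P? c)
  total = trans (∑-distrib-+ (λ b → 𝟙 ((toℕ b <? toℕ c) ×-dec P? b)) (λ b → 𝟙 (b ≟ c)))
            (trans (cong (below P? c +_) (trans (sum-single _ c (λ b → 𝟙-no (b ≟ c))) (𝟙-yes (c ≟ c) refl))) (+-comm _ 1))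
  term : ∀ b → 𝟙 ((toℕ b <? toℕ c) ×-dec P? b) + 𝟙 (b ≟ c) ≤ 𝟙 (Q? b)
  term b with b ≟ c
  ... | yes refl = ≤-reflexive (trans (cong (_+ 1) (𝟙-no ((toℕ b <? toℕ b) ×-dec P? b) (<-irrefl refl ∘ proj₁))) (sym (𝟙-yes (Q? b) qc)))
  ... | no _ = subst (_≤ 𝟙 (Q? b)) (sym (+-identityʳ _)) (𝟙-mono ((toℕ b <? toℕ c) ×-dec P? b) (Q? b) (λ { (l , p) → h b l p }))

below-injective : ∀ {N} {P : Fin N → Set} (P? : ∀ i → Dec (P i)) {c c′} → P c → P c′ → below P? c ≡ below P? c′ → c ≡ c′
below-injective {P = P} P? {c} {c′} p p′ e = toℕ-injective (≤-antisym (≮⇒≥ λ l → smaller p′ l (sym e)) (≮⇒≥ λ l → smaller p l e))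
  where
  smaller : ∀ {c c′} → P c → toℕ c < toℕ c′ → below P? c ≡ below P? c′ → ⊥
  smaller {c} {c′} p l e = <-irrefl e (below-suc≤ P? (λ b → (toℕ b <? toℕ c′) ×-dec P? b) (λ b k q → <-trans k l , q) (l , p))

module Isomorphism {N : ℕ} (E : BRel N) (forest : IsForest E) where
  open Forest E forest
  open Digits N

  module _ {x y : Fin N} (iso : IsoSubtrees E x y) where
    f = proj₁ iso
    g = proj₁ (proj₂ iso)
    f-spec = proj₁ (proj₂ (proj₂ iso))
    g-spec = proj₁ (proj₂ (proj₂ (proj₂ iso)))
    f-root = proj₁ (proj₂ (proj₂ (proj₂ (proj₂ iso))))
    f-edge = proj₂ (proj₂ (proj₂ (proj₂ (proj₂ iso))))

    child>0 : ∀ {u b k} → 0 < child E u b * k → T (E u b)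
    child>0 {u} {b} p with T? (E u b)
    ... | yes e = e

    child-1 : ∀ {u b} → T (E u b) → child E u b ≡ 1
    child-1 {u} {b} e = 𝟙-yes (T? (E u b)) e

    -- Children of `f u` lie below `y`, where `g` inverts `f`. So the children of `u` and of `f u`
    -- correspond bijectively, and the defining sum is merely reindexed.
    iso⇒codeUpTo : ∀ h u → Reach E x u → codeUpTo E h u ≡ codeUpTo E h (f u)
    iso⇒codeUpTo zero u r = refl
    iso⇒codeUpTo (suc h) u r = sum-reindex _ _ f g there back
      where
      there : ∀ b → 0 < child E u b * base ^ codeUpTo E h b → child E (f u) (f b) * base ^ codeUpTo E h (f b) ≡ child E u b * base ^ codeUpTo E h b × g (f b) ≡ b
      there b p with child>0 {u} {b} p
      ... | e = let r′ = r ◅◅ (e ◅ ε) in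
        cong₂ (λ i c → i * base ^ c) (trans (child-1 (Equivalence.to (f-edge u b r r′) e)) (sym (child-1 e))) (sym (iso⇒codeUpTo h b r′)) ,
        proj₂ (f-spec b r′)
      back : ∀ c → 0 < child E (f u) c * base ^ codeUpTo E h c → child E u (g c) * base ^ codeUpTo E h (g c) ≡ child E (f u) c * base ^ codeUpTo E h c × f (g c) ≡ c
      back c p with child>0 {f u} {c} p
      ... | e with g-spec c (proj₁ (f-spec u r) ◅◅ (e ◅ ε))
      ...   | r′ , fg = cong₂ (λ i c → i * base ^ c)
                (trans (child-1 (Equivalence.from (f-edge u (g c) r r′) (subst (T ∘ E (f u)) (sym fg) e))) (sym (child-1 e)))
                (trans (iso⇒codeUpTo h (g c) r′) (cong (codeUpTo E h) fg)) , fg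

    iso⇒code : code E x ≡ code E y
    iso⇒code = trans (iso⇒codeUpTo N x ε) (cong (code E) f-root)

  Sibling : Fin N → ℕ → Fin N → Set
  Sibling x v c = Hang E x x c × code E c ≡ v

  sibling? : ∀ x v c → Dec (Sibling x v c)
  sibling? x v c = hang? E x x c ×-dec (code E c ≟ℕ v)

  -- Comparing ranks among the siblings of equal code makes the pairing of children canonical:
  -- pairing back from `y` to `x` returns to the same child.
  Partner : (x y b c : Fin N) → Set
  Partner x y b c = Sibling y (code E b) c × below (sibling? y (code E b)) c ≡ below (sibling? x (code E b)) b

  partner : (x y b : Fin N) → Fin N
  partner x y b with any? (λ c → sibling? y (code E b) c ×-dec (below (sibling? y (code E b)) c ≟ℕ below (sibling? x (code E b)) b))
  ... | yes (c , _) = c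
  ... | no _ = b

  partner-spec : ∀ {x y b} → code E x ≡ code E y → T (E x b) → Partner x y b (partner x y b)
  partner-spec {x} {y} {b} eq e
    with any? (λ c → sibling? y (code E b) c ×-dec (below (sibling? y (code E b)) c ≟ℕ below (sibling? x (code E b)) b))
  ... | yes (c , p) = p
  ... | no none = ⊥-elim (none (select (sibling? y (code E b)) _
          (subst (below (sibling? x (code E b)) b <_) (code⇒hangs eq (code E b))
            (below-suc≤ (sibling? x (code E b)) (sibling? x (code E b)) (λ _ _ p → p) ((e , no-loop e) , refl)))))

  partner-inverse : ∀ {x y b} → code E x ≡ code E y → T (E x b) → partner y x (partner x y b) ≡ b
  partner-inverse {x} {y} {b} eq e with partner x y b | partner-spec {x} {y} {b} eq e
  ... | c | (((ec , _) , cc) , rc) with partner y x c | partner-spec {y} {x} {c} (sym eq) ec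
  ...   | d | (sd , rd) rewrite cc = below-injective (sibling? x (code E b)) sd ((e , no-loop e) , refl) (trans rd rc)

  match : ℕ → (x y w : Fin N) → Fin N
  -- The fuel is at least the depth of `w` below `x` wherever the value matters; at 0 this leaves
  -- only `w = x`, whose image is `y`. The value for `w` outside the subtree, in the last clause, is
  -- arbitrary.
  match zero x y w = y
  match (suc h) x y w with w ≟ x | any? (λ b → T? (E x b) ×-dec reach? b w)
  ... | yes _ | _ = y
  ... | no _ | yes (b , _) = match h b (partner x y b) w
  ... | no _ | no _ = y

  match-root : ∀ h x y → match h x y x ≡ y
  match-root zero x y = refl
  match-root (suc h) x y with x ≟ x | any? (λ b → T? (E x b) ×-dec reach? b x)
  ... | yes _ | _ = refl
  ... | no x≢x | _ = ⊥-elim (x≢x refl)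

  match-child : ∀ h {x b k w} y → T (E x b) → Path E b k w → match (suc h) x y w ≡ match h b (partner x y b) w
  match-child h {x} {b} {k} {w} y e p with w ≟ x | any? (λ b → T? (E x b) ×-dec reach? b w)
  ... | yes refl | _ = ⊥-elim (no-cycle (e ∷ p))
  ... | no _ | no none = ⊥-elim (none (b , e , k , p))
  ... | no _ | yes (b′ , e′ , k′ , p′) with length-unique (e ∷ p) (e′ ∷ p′)
  ...   | refl with start-unique p p′
  ...     | refl = refl

  match-path : ∀ h {x y k w} → code E x ≡ code E y → Path E x k w → k ≤ h → Path E y k (match h x y w)
  match-path h {x} {y} eq [] k≤h = subst (Path E y 0) (sym (match-root h x y)) []
  match-path (suc h) {x} {y} {suc k} {w} eq (_∷_ {z = b} e p) k≤h with partner-spec {x} {y} eq e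
  ... | ((e′ , _) , c) , _ = subst (Path E y (suc k)) (sym (match-child h y e p)) (e′ ∷ match-path h (sym c) p (s≤s⁻¹ k≤h))

  match-inverse : ∀ h {x y k w} → code E x ≡ code E y → Path E x k w → k ≤ h → match h y x (match h x y w) ≡ w
  match-inverse h {x} {y} eq [] k≤h = trans (cong (match h y x) (match-root h x y)) (match-root h y x)
  match-inverse (suc h) {x} {y} {suc k} {w} eq (_∷_ {z = b} e p) k≤h with partner-spec {x} {y} eq e
  ... | ((e′ , _) , c) , _ = begin
    match (suc h) y x (match (suc h) x y w)               ≡⟨ cong (match (suc h) y x) (match-child h y e p) ⟩
    match (suc h) y x (match h b b′ w)                    ≡⟨ match-child h x e′ (match-path h (sym c) p (s≤s⁻¹ k≤h)) ⟩
    match h b′ (partner y x b′) (match h b b′ w)          ≡⟨ cong (λ d → match h b′ d (match h b b′ w)) (partner-inverse eq e) ⟩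
    match h b′ b (match h b b′ w)                         ≡⟨ match-inverse h (sym c) p (s≤s⁻¹ k≤h) ⟩
    w                                                     ∎
    where
    open ≡-Reasoning
    b′ = partner x y b

  match-edge : ∀ h {x y k u v} → code E x ≡ code E y → Path E x k u → T (E u v) → k < h → T (E (match h x y u) (match h x y v))
  match-edge (suc h) {x} {y} {v = v} eq [] d k<h with partner-spec {x} {y} eq d
  ... | ((e′ , _) , _) , _ = subst₂ (λ a b → T (E a b)) (sym (match-root (suc h) x y))
          (sym (trans (match-child h y d []) (match-root h v _))) e′
  match-edge (suc h) {x} {y} eq (e ∷ p) d k<h with partner-spec {x} {y} eq e
  ... | ((e′ , _) , c) , _ = subst₂ (λ a b → T (E a b)) (sym (match-child h y e p)) (sym (match-child h y e (snoc p d)))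
          (match-edge h (sym c) p d (s≤s⁻¹ k<h))

  code⇒iso : ∀ {x y} → code E x ≡ code E y → IsoSubtrees E x y
  code⇒iso {x} {y} eq = match N x y , match N y x , there eq , there (sym eq) , match-root N x y , edge
    where
    there : ∀ {x y} → code E x ≡ code E y → ∀ v → Reach E x v → Reach E y (match N x y v) × match N y x (match N x y v) ≡ v
    there eq v r with reach⇒path r
    ... | k , p = path⇒reach (match-path N eq p (<⇒≤ (path-length p))) , match-inverse N eq p (<⇒≤ (path-length p))
    forth : ∀ {x y} → code E x ≡ code E y → ∀ {u v} → Reach E x u → T (E u v) → T (E (match N x y u) (match N x y v))
    forth eq r e with reach⇒path r
    ... | k , p = match-edge N eq p e (path-length p)
    edge : ∀ u v → Reach E x u → Reach E x v → T (E u v) ⇔ T (E (match N x y u) (match N x y v))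
    edge u v r s = mk⇔ (forth eq r) λ e → subst₂ (λ a b → T (E a b)) (proj₂ (there eq u r)) (proj₂ (there eq v s))
                                             (forth (sym eq) (proj₁ (there eq u r)) e)

  iso⇔code : ∀ x y → IsoSubtrees E x y ⇔ (code E x ≡ code E y)
  iso⇔code x y = mk⇔ iso⇒code code⇒iso

-- Weights of changes

least : ∀ {N} {P : Fin N → Set} (P? : ∀ i → Dec (P i)) → Σ (Fin N) P →
        Σ (Fin N) λ i → P i × (∀ j → toℕ j < toℕ i → ¬ P j)
least {suc N} P? (i , p) with P? zero
... | yes p₀ = zero , p₀ , λ j ()
least {suc N} P? (zero , p) | no ¬p₀ = ⊥-elim (¬p₀ p)
least {suc N} P? (suc i , p) | no ¬p₀ with least (P? ∘ suc) (i , p)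
... | j , q , min = suc j , q , λ { zero _ → ¬p₀ ; (suc k) l → min k (s≤s⁻¹ l) }

-- Sums over intervals of nodes

module _ {N : ℕ} where

  In : Fin N → Fin N → Fin N → Set
  In lo hi b = toℕ lo ≤ toℕ b × toℕ b ≤ toℕ hi

  in? : ∀ lo hi b → Dec (In lo hi b)
  in? lo hi b = (toℕ lo ≤? toℕ b) ×-dec (toℕ b ≤? toℕ hi)

  sumIn : (Fin N → ℕ) → Fin N → Fin N → ℕ
  sumIn f lo hi = sum (λ b → 𝟙 (in? lo hi b) * f b)

  sumIn-single : ∀ f a → sumIn f a a ≡ f a
  sumIn-single f a = trans (sum-single _ a (λ b b≢a → cong (_* f b) (𝟙-no (in? a a b) λ { (p , q) → b≢a (toℕ-injective (≤-antisym q p)) })))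
    (trans (cong (_* f a) (𝟙-yes (in? a a a) (≤-refl , ≤-refl))) (*-identityˡ (f a)))

  sumIn-split : ∀ f {lo m m′ hi} → toℕ lo ≤ toℕ m → toℕ m′ ≡ suc (toℕ m) → toℕ m′ ≤ toℕ hi →
                sumIn f lo hi ≡ sumIn f lo m + sumIn f m′ hi
  sumIn-split f {lo} {m} {m′} {hi} l e h = trans (sum-cong-≗ term) (∑-distrib-+ (λ b → 𝟙 (in? lo m b) * f b) (λ b → 𝟙 (in? m′ hi b) * f b))
    where
    m<m′ : toℕ m < toℕ m′
    m<m′ = ≤-reflexive (sym e)
    ind : ∀ b → 𝟙 (in? lo hi b) ≡ 𝟙 (in? lo m b) + 𝟙 (in? m′ hi b)
    ind b with toℕ b ≤? toℕ m
    ... | yes b≤m = trans (𝟙-cong (in? lo hi b) ((toℕ lo ≤? toℕ b) ×-dec yes b≤m) (λ { (p , _) → p , b≤m })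
                             (λ { (p , _) → p , ≤-trans b≤m (≤-trans (<⇒≤ m<m′) h) }))
                       (trans (sym (+-identityʳ _)) (cong (𝟙 ((toℕ lo ≤? toℕ b) ×-dec yes b≤m) +_)
                          (sym (𝟙-no (in? m′ hi b) λ { (p , _) → <-irrefl refl (≤-trans (≤-trans m<m′ p) b≤m) }))))
    ... | no b≰m = trans (𝟙-cong (in? lo hi b) (in? m′ hi b) (λ { (_ , q) → ≤-trans (≤-reflexive e) (≰⇒> b≰m) , q })
                             (λ { (p , q) → ≤-trans l (<⇒≤ (≰⇒> b≰m)) , q }))
                     (cong (_+ 𝟙 (in? m′ hi b)) (sym (𝟙-no ((toℕ lo ≤? toℕ b) ×-dec no b≰m) (b≰m ∘ proj₂))))
    term : ∀ b → 𝟙 (in? lo hi b) * f b ≡ 𝟙 (in? lo m b) * f b + 𝟙 (in? m′ hi b) * f b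
    term b = trans (cong (_* f b) (ind b)) (*-distribʳ-+ (f b) (𝟙 (in? lo m b)) (𝟙 (in? m′ hi b)))

  sumIn-cong : ∀ {f g lo hi} → (∀ b → In lo hi b → f b ≡ g b) → sumIn f lo hi ≡ sumIn g lo hi
  sumIn-cong {f} {g} {lo} {hi} h = sum-cong-≗ term
    where
    term : ∀ b → 𝟙 (in? lo hi b) * f b ≡ 𝟙 (in? lo hi b) * g b
    term b with in? lo hi b
    ... | yes i = cong (1 *_) (h b i)
    ... | no _ = refl

  sumIn-≡0 : ∀ {f lo hi} → (∀ b → In lo hi b → f b ≡ 0) → sumIn f lo hi ≡ 0
  sumIn-≡0 {f} {lo} {hi} h = trans (sumIn-cong {g = λ _ → 0} h) (sum-≡0 (λ b → *-zeroʳ (𝟙 (in? lo hi b))))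

  term≤sumIn : ∀ f {lo hi b} → In lo hi b → f b ≤ sumIn f lo hi
  term≤sumIn f {lo} {hi} {b} i = ≤-trans (≤-reflexive (sym (trans (cong (_* f b) (𝟙-yes (in? lo hi b) i)) (*-identityˡ (f b)))))
    (term≤sum (λ b → 𝟙 (in? lo hi b) * f b) b)

  sumIn≤sum : ∀ f lo hi → sumIn f lo hi ≤ sum f
  sumIn≤sum f lo hi = sum-mono λ b → ≤-trans (*-monoˡ-≤ (f b) (𝟙≤1 (in? lo hi b))) (≤-reflexive (*-identityˡ (f b)))

  sumIn+term≤sum : ∀ f {lo hi a} → ¬ In lo hi a → sumIn f lo hi + f a ≤ sum f
  sumIn+term≤sum f {lo} {hi} {a} a∉ = subst (_≤ sum f) (trans (∑-distrib-+ (λ b → 𝟙 (in? lo hi b) * f b) (λ b → 𝟙 (b ≟ a) * f b))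
      (cong (sumIn f lo hi +_) (trans (sum-single _ a (λ b b≢a → cong (_* f b) (𝟙-no (b ≟ a) b≢a)))
        (trans (cong (_* f a) (𝟙-yes (a ≟ a) refl)) (*-identityˡ (f a)))))) (sum-mono term)
    where
    term : ∀ b → 𝟙 (in? lo hi b) * f b + 𝟙 (b ≟ a) * f b ≤ f b
    term b with b ≟ a
    ... | yes refl = ≤-reflexive (trans (cong (λ i → i * f b + (f b + 0)) (𝟙-no (in? lo hi b) a∉)) (+-identityʳ (f b)))
    ... | no _ = ≤-trans (≤-reflexive (+-identityʳ _)) (≤-trans (*-monoˡ-≤ (f b) (𝟙≤1 (in? lo hi b))) (≤-reflexive (*-identityˡ (f b))))

  sumIn-all : ∀ f lo hi → (∀ b → In lo hi b) → sumIn f lo hi ≡ sum f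
  sumIn-all f lo hi h = sum-cong-≗ λ b → trans (cong (_* f b) (𝟙-yes (in? lo hi b) (h b))) (*-identityˡ (f b))

  predecessor : ∀ {lo a : Fin N} → toℕ lo < toℕ a → Σ (Fin N) λ m → toℕ a ≡ suc (toℕ m)
  predecessor {lo} {a} l with toℕ a in eq
  ... | suc k = fromℕ< k<N , cong suc (sym (toℕ-fromℕ< k<N))
    where
    k<N : k < N
    k<N = ≤-trans (≤-trans (n≤1+n _) (≤-reflexive (cong suc (sym eq)))) (toℕ<n a)

  successor : ∀ {a hi : Fin N} → toℕ a < toℕ hi → Σ (Fin N) λ m → toℕ m ≡ suc (toℕ a)
  successor {a} {hi} l = fromℕ< (≤-<-trans l (toℕ<n hi)) , toℕ-fromℕ< _

  -- `a` is the first position at which the partial sum reaches `H`: before it the sum is below `H`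
  -- by minimality, after it because the whole is below `H + H`. If `H` is never reached, the last
  -- position serves.
  centre : ∀ f {lo hi} H → toℕ lo ≤ toℕ hi → sumIn f lo hi < H + H →
           Σ (Fin N) λ a → In lo hi a × (∀ m → toℕ a ≡ suc (toℕ m) → toℕ lo ≤ toℕ m → sumIn f lo m < H)
                                     × (∀ m → toℕ m ≡ suc (toℕ a) → toℕ m ≤ toℕ hi → sumIn f m hi < H)
  centre f {lo} {hi} H lo≤hi bound with H ≤? sumIn f lo hi
  ... | no H≰ = hi , (lo≤hi , ≤-refl) ,
          (λ m e l → ≤-<-trans (≤-trans (m≤m+n _ _) (≤-reflexive (sym (sumIn-split f l e ≤-refl)))) (≰⇒> H≰)) ,
          (λ m e l → ⊥-elim (<-irrefl refl (≤-trans (≤-reflexive (sym e)) l)))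
  ... | yes H≤ with least (λ a → in? lo hi a ×-dec (H ≤? sumIn f lo a)) (hi , (lo≤hi , ≤-refl) , H≤)
  ...   | a , (i , H≤a) , min = a , i ,
          (λ m e l → ≰⇒> λ H≤m → min m (≤-reflexive (sym e)) ((l , <⇒≤ (≤-trans (≤-reflexive (sym e)) (proj₂ i))) , H≤m)) ,
          (λ m e l → +-cancelˡ-< H _ _ (≤-<-trans (≤-trans (+-monoˡ-≤ _ H≤a) (≤-reflexive (sym (sumIn-split f (proj₁ i) e l)))) bound))

-- Changes below a node, among its children and along a path

module Change {N : ℕ} (E₀ E₁ : BRel N) (F₀ : IsForest E₀) (F₁ : IsForest E₁) where
  open Forest E₁ F₁
  module Old = Forest E₀ F₀

  diff : Fin N → Fin N → ℕ
  diff u v = 𝟙 (¬? (E₀ u v ≟B E₁ u v))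

  degree : Fin N → ℕ
  degree u = sum (diff u)

  weight : Fin N → ℕ
  weight x = sum (λ u → 𝟙 (reach? x u) * degree u)

  -- Weight is charged to positions and not only to children: a deleted edge from `z` to `b`
  -- invalidates stored counts over intervals around `b`, so the first summand charges it although
  -- `b` is no longer a child.
  childWeight : Fin N → Fin N → ℕ
  childWeight z b = diff z b + child E₁ z b * weight b

  Unchanged : Fin N → Set
  Unchanged u = ∀ v → E₀ u v ≡ E₁ u v

  diff≡0 : ∀ {u v} → diff u v ≡ 0 → E₀ u v ≡ E₁ u v
  diff≡0 {u} {v} e with E₀ u v ≟B E₁ u v
  ... | yes p = p

  degree≡0 : ∀ {u} → degree u ≡ 0 → Unchanged u
  degree≡0 {u} e v = diff≡0 (n≤0⇒n≡0 (≤-trans (term≤sum (diff u) v) (≤-reflexive e)))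

  branch : Fin N → Fin N → ℕ
  branch z u = sum (λ b → child E₁ z b * 𝟙 (reach? b u))

  -- A node strictly below `z` lies below exactly one child of `z`, and `z` lies below none. Summed
  -- against `degree`, this bounds the weights of the children together with the changes at `z`
  -- itself.
  branch≤ : ∀ z u → 𝟙 (u ≟ z) + branch z u ≤ 𝟙 (reach? z u)
  branch≤ z u with u ≟ z
  ... | yes refl = ≤-trans (≤-reflexive (cong suc (sum-≡0 λ b → trans (𝟙-× (T? (E₁ z b)) (reach? b u))
                       (𝟙-no (T? (E₁ z b) ×-dec reach? b u) λ { (e , k , p) → no-cycle (e ∷ p) }))))
                     (≤-reflexive (sym (𝟙-yes (reach? z u) (0 , []))))
  ... | no _ with reach? z u
  ...   | no ¬r = ≤-reflexive (sum-≡0 λ b → trans (𝟙-× (T? (E₁ z b)) (reach? b u))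
                       (𝟙-no (T? (E₁ z b) ×-dec reach? b u) λ { (e , k , p) → ¬r (suc k , e ∷ p) }))
  ...   | yes _ = sum≤1 _ (λ b → *-mono-≤ (𝟙≤1 (T? (E₁ z b))) (𝟙≤1 (reach? b u))) λ b b′ q q′ → same (get b q) (get b′ q′)
    where
    get : ∀ b → 0 < child E₁ z b * 𝟙 (reach? b u) → T (E₁ z b) × Σ ℕ λ k → Path E₁ b k u
    get b q = 𝟙>0 (T? (E₁ z b) ×-dec reach? b u) (≤-trans q (≤-reflexive (𝟙-× (T? (E₁ z b)) (reach? b u))))
    same : ∀ {b b′} → T (E₁ z b) × (Σ ℕ λ k → Path E₁ b k u) → T (E₁ z b′) × (Σ ℕ λ k → Path E₁ b′ k u) → b ≡ b′
    same (e , k , p) (e′ , k′ , p′) with length-unique (e ∷ p) (e′ ∷ p′)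
    ... | refl = start-unique p p′

  childWeights≤weight : ∀ z → sum (childWeight z) ≤ weight z
  childWeights≤weight z = begin
    sum (childWeight z)                                            ≡⟨ ∑-distrib-+ (diff z) (λ b → child E₁ z b * weight b) ⟩
    degree z + sum (λ b → child E₁ z b * weight b)                 ≡⟨ cong₂ _+_ deg-as-sum below-as-sum ⟩
    sum (λ u → 𝟙 (u ≟ z) * degree u) + sum (λ u → branch z u * degree u) ≡⟨ ∑-distrib-+ (λ u → 𝟙 (u ≟ z) * degree u) (λ u → branch z u * degree u) ⟨
    sum (λ u → 𝟙 (u ≟ z) * degree u + branch z u * degree u)       ≤⟨ sum-mono (λ u → ≤-trans (≤-reflexive (sym (*-distribʳ-+ (degree u) (𝟙 (u ≟ z)) (branch z u)))) (*-monoˡ-≤ (degree u) (branch≤ z u))) ⟩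
    weight z                                                       ∎
    where
    open ≤-Reasoning
    deg-as-sum : degree z ≡ sum (λ u → 𝟙 (u ≟ z) * degree u)
    deg-as-sum = sym (trans (sum-single _ z (λ u u≢z → cong (_* degree u) (𝟙-no (u ≟ z) u≢z)))
                        (trans (cong (_* degree z) (𝟙-yes (z ≟ z) refl)) (*-identityˡ (degree z))))
    below-as-sum : sum (λ b → child E₁ z b * weight b) ≡ sum (λ u → branch z u * degree u)
    below-as-sum = trans (sum-cong-≗ λ b → trans (*-distribˡ-sum (child E₁ z b) (λ u → 𝟙 (reach? b u) * degree u))
                            (sum-cong-≗ λ u → sym (*-assoc (child E₁ z b) (𝟙 (reach? b u)) (degree u))))
                     (trans (∑-comm (λ b u → child E₁ z b * 𝟙 (reach? b u) * degree u))
                       (sum-cong-≗ λ u → sym (*-distribʳ-sum (degree u) (λ b → child E₁ z b * 𝟙 (reach? b u)))))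

  child-weight : ∀ {z b} → T (E₁ z b) → weight b ≤ childWeight z b
  child-weight {z} {b} e = ≤-trans (≤-reflexive (sym (trans (cong (_* weight b) (𝟙-yes (T? (E₁ z b)) e)) (*-identityˡ (weight b)))))
    (m≤n+m _ (diff z b))

  degree+child≤weight : ∀ {z b} → T (E₁ z b) → degree z + weight b ≤ weight z
  degree+child≤weight {z} {b} e = ≤-trans (+-monoʳ-≤ (degree z) (≤-trans (≤-reflexive (sym (trans (cong (_* weight b) (𝟙-yes (T? (E₁ z b)) e)) (*-identityˡ (weight b)))))
      (term≤sum (λ b → child E₁ z b * weight b) b)))
    (≤-trans (≤-reflexive (sym (∑-distrib-+ (diff z) (λ b → child E₁ z b * weight b)))) (childWeights≤weight z))

  weight-child : ∀ {z b} → T (E₁ z b) → weight b ≤ weight z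
  weight-child e = ≤-trans (m≤n+m _ _) (degree+child≤weight e)

  weight-path : ∀ {x k y} → Path E₁ x k y → weight y ≤ weight x
  weight-path [] = ≤-refl
  weight-path (e ∷ p) = ≤-trans (weight-path p) (weight-child e)

  weight≤degrees : ∀ x → weight x ≤ sum degree
  weight≤degrees x = sum-mono λ u → ≤-trans (*-monoˡ-≤ (degree u) (𝟙≤1 (reach? x u))) (≤-reflexive (*-identityˡ (degree u)))

  Light : Fin N → Set
  Light x = ∀ {k u} → Path E₁ x k u → Unchanged u

  weight≡0⇒light : ∀ {x} → weight x ≡ 0 → Light x
  weight≡0⇒light {x} e {k} {u} p = degree≡0 (n≤0⇒n≡0 (≤-trans
    (≤-reflexive (sym (trans (cong (_* degree u) (𝟙-yes (reach? x u) (k , p))) (*-identityˡ (degree u)))))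
    (≤-trans (term≤sum (λ u → 𝟙 (reach? x u) * degree u) u) (≤-reflexive e))))

  -- Every row of the edge matrix in the subtree is the same in both forests, so both recursions
  -- unfold over the same nodes.
  light-code : ∀ {x} → Light x → code E₀ x ≡ code E₁ x
  light-code = upTo N
    where
    open Digits N using (base)
    upTo : ∀ h {x} → Light x → codeUpTo E₀ h x ≡ codeUpTo E₁ h x
    upTo zero l = refl
    upTo (suc h) {x} l = sum-cong-≗ term
      where
      term : ∀ b → child E₀ x b * base ^ codeUpTo E₀ h b ≡ child E₁ x b * base ^ codeUpTo E₁ h b
      term b with E₀ x b | E₁ x b | l [] b | (λ {k u} (e : T (E₁ x b)) (p : Path E₁ b k u) → l (e ∷ p))
      ... | Data.Bool.true | _ | refl | l′ = cong (λ c → 1 * base ^ c) (upTo h (l′ _))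
      ... | Data.Bool.false | _ | refl | _ = refl

  -- If `y` is below `x` in the old forest, the edges in question are those of the old path.
  -- Survival of a whole path is thus expressed by stored distances and the two edge relations,
  -- without iteration.
  Intact : Fin N → Fin N → Set
  Intact x y = ∀ u v → T (E₀ u v) → (Σ ℕ λ i → Path E₀ x i u) → (Σ ℕ λ j → Path E₀ v j y) → T (E₁ u v)

  intact⇒path : ∀ {x k y} → Path E₀ x k y → Intact x y → Path E₁ x k y
  intact⇒path [] h = []
  intact⇒path (e ∷ p) h = h _ _ e (0 , []) (_ , p) ∷ intact⇒path p λ { u v d (i , q) r → h u v d (suc i , e ∷ q) r }

  -- The weight of `x` contains the changes at `x` and the whole weight of `z`. If it equals the
  -- weight at the far end, nothing is left for `x`.
  unchanged-start : ∀ {x z k y} → T (E₁ x z) → Path E₁ z k y → weight x ≡ weight y → Unchanged x × weight z ≡ weight y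
  unchanged-start {x} {z} {k} {y} e p eq =
    degree≡0 (n≤0⇒n≡0 (+-cancelʳ-≤ (weight y) (degree x) 0 (≤-trans (+-monoʳ-≤ (degree x) (weight-path p))
      (≤-trans (degree+child≤weight e) (≤-reflexive eq))))) ,
    ≤-antisym (≤-trans (weight-child e) (≤-reflexive eq)) (weight-path p)

  constant⇒old : ∀ {x k y} → Path E₁ x k y → weight x ≡ weight y → Path E₀ x k y
  constant⇒old [] eq = []
  constant⇒old (_∷_ {z = z} e p) eq with unchanged-start e p eq
  ... | un , eq′ = subst T (sym (un z)) e ∷ constant⇒old p eq′

  constant⇒intact : ∀ {x k y} → Path E₁ x k y → weight x ≡ weight y → Intact x y
  constant⇒intact [] eq u v d (i , q) (j , r) with trans (sym (+-suc i j)) (Old.length-unique (append q (d ∷ r)) [])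
  ... | ()
  constant⇒intact (e ∷ p) eq u v d (zero , []) (j , r) = subst T (proj₁ (unchanged-start e p eq) v) d
  constant⇒intact {y = y} (_∷_ {z = z} e p) eq u v d (suc i , e′ ∷ q) (j , r) with unchanged-start e p eq
  ... | un , eq′ with Old.length-unique (e′ ∷ append q (d ∷ r)) (subst T (sym (un z)) e ∷ constant⇒old p eq′)
  ...   | refl with Old.start-unique (append q (d ∷ r)) (constant⇒old p eq′)
  ...     | refl = constant⇒intact p eq′ u v d (i , q) (j , r)

  record SplitPath (x : Fin N) (k : ℕ) (y : Fin N) (H : ℕ) : Set where
    field
      {u v} : Fin N
      {k₁ k₂} : ℕ
      first : Path E₁ x k₁ u
      edge : T (E₁ u v)
      second : Path E₁ v k₂ y
      total : suc (k₁ + k₂) ≡ k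
      first-light : weight x < weight u + H
      second-light : weight v < weight y + H

  -- The cut is the edge at which the weight drops below `weight y + H`. Above it the end `u` has at
  -- least this weight, so the bound with `H + H` leaves an excess below `H`; under it the excess
  -- over `y` is below `H` already.
  split-path : ∀ {x k y} H → 0 < H → Path E₁ x k y → weight x < weight y + (H + H) → weight y + H ≤ weight x → SplitPath x k y H
  split-path {x} {k} {y} H 0<H p bound heavy = go [] p refl heavy
    where
    go : ∀ {i j u} → Path E₁ x i u → Path E₁ u j y → i + j ≡ k → weight y + H ≤ weight u → SplitPath x k y H
    go q [] e h = ⊥-elim (<-irrefl refl (≤-trans (m<m+n (weight y) 0<H) h))
    go {i} {suc j} {u} q (_∷_ {z = v} d r) e h with weight y + H ≤? weight v
    ... | yes h′ = go (snoc q d) r (trans (sym (+-suc i j)) e) h′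
    ... | no ¬h′ = record
      { first = q ; edge = d ; second = r ; total = trans (sym (+-suc i j)) e
      ; first-light = ≤-trans bound (≤-trans (≤-reflexive (sym (+-assoc (weight y) H H))) (+-monoˡ-≤ H h))
      ; second-light = ≰⇒> ¬h′ }

  -- Descend as long as some child weighs at least `H`. The end is known to be heavy only after at
  -- least one step, since `x` itself may be light.
  heavy-path : ∀ H x → Σ (Fin N) λ y → Σ ℕ λ k → Path E₁ x k y × (∀ b → T (E₁ y b) → weight b < H) × (0 < k → H ≤ weight y)
  heavy-path H x = go N [] (λ ()) (+-identityʳ N)
    where
    go : ∀ f {k u} → Path E₁ x k u → (0 < k → H ≤ weight u) → f + k ≡ N →
         Σ (Fin N) λ y → Σ ℕ λ k → Path E₁ x k y × (∀ b → T (E₁ y b) → weight b < H) × (0 < k → H ≤ weight y)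
    go zero p h refl = ⊥-elim (<-irrefl refl (path-length p))
    go (suc f) {k} {u} p h e with any? (λ b → T? (E₁ u b) ×-dec (H ≤? weight b))
    ... | yes (b , d , h′) = go f (snoc p d) (λ _ → h′) (trans (+-suc f k) e)
    ... | no none = u , k , p , (λ b d → ≰⇒> λ h′ → none (b , d , h′)) , h

  module _ {H x k y} (p : Path E₁ x k y) (x-light : weight x < H + H) (y-heavy : 0 < k → H ≤ weight y) where

    -- `z` weighs less than `H + H`, and the child on the path accounts for at least `H` of it.
    path-siblings : ∀ {j z z′} → j < k → Path E₁ z′ j y → T (E₁ z z′) → sum (childWeight z) < childWeight z z′ + H × H ≤ weight z′
    path-siblings {j} {z} {z′} j<k q e = ≤-<-trans (childWeights≤weight z)
        (≤-<-trans (weight-path (path-≤ j<k (e ∷ q) p)) (≤-trans x-light (+-monoˡ-≤ H (≤-trans heavy (child-weight e))))) , heavy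
      where
      heavy : H ≤ weight z′
      heavy = ≤-trans (y-heavy (≤-<-trans z≤n j<k)) (weight-path q)

-- The derivation rules

-- Relation 0 holds all four kinds of judgements about the current forest, relation 1 the query,
-- relation 2 the edges. The edges are stored because after a change `inp` shows only the new
-- forest.
arity : Fin 3 → ℕ
arity 0F = 8
arity 1F = 2
arity 2F = 2

Fm : ℕ → Set
Fm = Formula 3 arity

Rule : ℕ → Set
Rule = Pos {3} {arity} 8

module _ {k : ℕ} where
  s₂ : Fin k → Fin (2 Data.Nat.+ k)
  s₂ x = suc (suc x)
  s₃ : Fin k → Fin (3 Data.Nat.+ k)
  s₃ x = suc (s₂ x)
  s₄ : Fin k → Fin (4 Data.Nat.+ k)
  s₄ x = suc (s₃ x)
  s₅ : Fin k → Fin (5 Data.Nat.+ k)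
  s₅ x = suc (s₄ x)

  ltF : Fin k → Fin k → Fm k
  ltF x y = neg (leq y x)

  succF : Fin k → Fin k → Fm k
  succF j i = conj (ltF j i) (all (disj (leq 0F (suc j)) (leq (suc i) 0F)))

  zeroF maxF : Fin k → Fm k
  zeroF x = all (leq (suc x) 0F)
  maxF x = all (leq 0F (suc x))

  inF : Fin k → Fin k → Fin k → Fm k
  inF lo hi b = conj (leq lo b) (leq b hi)

  hangF : Fin k → Fin k → Fin k → Fm k
  hangF z z′ b = conj (inp z b) (neg (eqF b z′))

  -- The last two arguments tag the judgement by being 0 or not: (0,0) isomorphic,
  -- (0,+) not isomorphic, (+,0) distance, (+,+) number of hanging children.
  -- Throughout, o is a variable for 0 and l one for the largest element.
  isoArgs nisoArgs : (o l x y : Fin k) → Fin 8 → Fin k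
  isoArgs o l x y = lookup (x ∷ y ∷ o ∷ o ∷ o ∷ o ∷ o ∷ o ∷ [])
  nisoArgs o l x y = lookup (x ∷ y ∷ o ∷ o ∷ o ∷ o ∷ o ∷ l ∷ [])
  distArgs : (o l x y d : Fin k) → Fin 8 → Fin k
  distArgs o l x y d = lookup (x ∷ y ∷ d ∷ o ∷ o ∷ o ∷ l ∷ o ∷ [])
  countArgs : (o l z z′ t lo hi c : Fin k) → Fin 8 → Fin k
  countArgs o l z z′ t lo hi c = lookup (z ∷ z′ ∷ t ∷ lo ∷ hi ∷ c ∷ l ∷ l ∷ [])

  oldEdge : Fin k → Fin k → Fm k
  oldEdge u v = aux 2F (lookup (u ∷ v ∷ []))

module _ {k : ℕ} where
  sameF : Fin k → Fin k → Fm k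
  sameF u v = disj (conj (inp u v) (oldEdge u v)) (conj (neg (inp u v)) (neg (oldEdge u v)))

  unchangedF : Fin k → Fm k
  unchangedF u = all (disj (conj (inp (suc u) 0F) (oldEdge (suc u) 0F)) (conj (neg (inp (suc u) 0F)) (neg (oldEdge (suc u) 0F))))

  module _ (o l : Fin k) where
    oldReach : Fin k → Fin k → Fm k
    oldReach x y = ex (aux 0F (distArgs (suc o) (suc l) (suc x) (suc y) 0F))

    -- The chain of ancestors of `y` is listed completely: a root at distance `K`, and for every
    -- distance up to `K` an ancestor different from `x`. Only positive distance facts are used.
    unreachable : Fin k → Fin k → Rule k
    unreachable x y = some (some (lit (all (neg (inp 0F 2F))) and rec (distArgs (s₂ o) (s₂ l) 1F (s₂ y) 0F) and
      every (lit (ltF 1F 0F) or some (lit (neg (eqF 0F (s₄ x))) and rec (distArgs (s₄ o) (s₄ l) 0F (s₄ y) 1F)))))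

    matched mismatched : (z z′ w w′ : Fin k) → Rule k
    matched z z′ w w′ =
      every (lit (neg (hangF (suc z) (suc z′) 0F)) or
        some (rec (countArgs (s₂ o) (s₂ l) (s₂ z) (s₂ z′) 1F (s₂ o) (s₂ l) 0F) and
              rec (countArgs (s₂ o) (s₂ l) (s₂ w) (s₂ w′) 1F (s₂ o) (s₂ l) 0F)))
      and
      every (lit (neg (hangF (suc w) (suc w′) 0F)) or
        some (lit (hangF (s₂ z) (s₂ z′) 0F) and rec (isoArgs (s₂ o) (s₂ l) 0F 1F)))
    mismatched z z′ w w′ =
      some (lit (hangF (suc z) (suc z′) 0F) and
        some (some (lit (neg (eqF 0F 1F)) and
          rec (countArgs (s₃ o) (s₃ l) (s₃ z) (s₃ z′) 2F (s₃ o) (s₃ l) 1F) and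
          rec (countArgs (s₃ o) (s₃ l) (s₃ w) (s₃ w′) 2F (s₃ o) (s₃ l) 0F))))
      or
      some (lit (hangF (suc w) (suc w′) 0F) and
        every (lit (neg (hangF (s₂ z) (s₂ z′) 0F)) or rec (nisoArgs (s₂ o) (s₂ l) 0F 1F)))

module _ {k : ℕ} (o l : Fin k) where
  light : Fin k → Rule k
  light b = every (lit (unchangedF 0F) or unreachable (suc o) (suc l) (suc b) 0F)

  hangs⁺ hangs⁻ : (z z′ w w′ : Fin k) → Rule k
  hangs⁺ z z′ w w′ = matched o l z z′ w w′ or matched o l w w′ z z′
  hangs⁻ z z′ w w′ = mismatched o l z z′ w w′ or mismatched o l w w′ z z′

module _ {k : ℕ} (o l : Fin k) where
  level⁺ level⁻ : (j y y* : Fin k) → Rule k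
  level⁺ j y y* = some (some (some (some (
    rec (distArgs (s₄ o) (s₄ l) 3F (s₄ y) (s₄ j)) and rec (distArgs (s₄ o) (s₄ l) 1F (s₄ y*) (s₄ j)) and
    lit (conj (inp 2F 3F) (inp 0F 1F)) and hangs⁺ (s₄ o) (s₄ l) 2F 3F 0F 1F))))
  level⁻ j y y* = some (some (some (some (
    rec (distArgs (s₄ o) (s₄ l) 3F (s₄ y) (s₄ j)) and rec (distArgs (s₄ o) (s₄ l) 1F (s₄ y*) (s₄ j)) and
    lit (conj (inp 2F 3F) (inp 0F 1F)) and hangs⁻ (s₄ o) (s₄ l) 2F 3F 0F 1F))))

module _ {k : ℕ} (o l : Fin k) where
  -- An isomorphism maps the end `y` of a path in `x` to some `y*` below `x*`. For `along⁻` it is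
  -- therefore enough to refute each `y*`: its depth differs, the children of the ends differ, or
  -- some level differs.
  along⁺ along⁻ : Fin k → Fin k → Rule k
  along⁺ x x* = some (some (some (
    rec (distArgs (s₃ o) (s₃ l) (s₃ x) 2F 0F) and rec (distArgs (s₃ o) (s₃ l) (s₃ x*) 1F 0F) and
    hangs⁺ (s₃ o) (s₃ l) 2F 2F 1F 1F and
    every (lit (leq 1F 0F) or level⁺ (s₄ o) (s₄ l) 0F 3F 2F))))
  along⁻ x x* = some (some (rec (distArgs (s₂ o) (s₂ l) (s₂ x) 1F 0F) and
    every (unreachable (s₃ o) (s₃ l) (s₃ x*) 0F or
      some (rec (distArgs (s₄ o) (s₄ l) (s₄ x*) 1F 0F) and
        (lit (neg (eqF 0F 2F)) or hangs⁻ (s₄ o) (s₄ l) 3F 3F 1F 1F or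
          some (lit (ltF 0F 3F) and level⁻ (s₅ o) (s₅ l) 0F 4F 2F))))))

module _ {k : ℕ} (o l : Fin k) where
  isoRule nisoRule : Fin k → Fin k → Rule k
  isoRule x y = (light o l x and light o l y and lit (aux 0F (isoArgs o l x y))) or along⁺ o l x y or along⁺ o l y x
  nisoRule x y = (light o l x and light o l y and lit (neg (aux 0F (isoArgs o l x y)))) or along⁻ o l x y or along⁻ o l y x

  intactF : Fin k → Fin k → Fm k
  intactF x y = all (all (neg (conj (oldEdge 1F 0F) (conj (oldReach (s₂ o) (s₂ l) (s₂ x) 1F)
    (conj (oldReach (s₂ o) (s₂ l) 0F (s₂ y)) (neg (inp 1F 0F)))))))

  distRule : (x y d : Fin k) → Rule k
  distRule x y d = lit (conj (aux 0F (distArgs o l x y d)) (intactF x y)) or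
    some (some (some (some (some (lit (conj (inp 4F 3F) (conj (plus 2F 1F 0F) (succF 0F (s₅ d)))) and
      rec (distArgs (s₅ o) (s₅ l) (s₅ x) 4F 2F) and rec (distArgs (s₅ o) (s₅ l) 3F (s₅ y) 1F))))))

  quietRule splitRule leafRule countRule : (z z′ t lo hi c : Fin k) → Rule k
  quietRule z z′ t lo hi c =
    every (lit (neg (inF (suc lo) (suc hi) 0F)) or (lit (sameF (suc z) 0F) and
      (lit (neg (inp (suc z) 0F)) or (lit (neg (eqF 0F (suc z′))) and light (suc o) (suc l) 0F))))
    and
    -- `t` may have changed, so the stored relation is asked about a child in the interval that is
    -- isomorphic to `t`; that child is light. The stored count excludes no child, which agrees
    -- because `z′` is not a child inside the interval.
    (some (lit (conj (inF (suc lo) (suc hi) 0F) (conj (inp (suc z) 0F)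
             (aux 0F (countArgs (suc o) (suc l) (suc z) (suc z) 0F (suc lo) (suc hi) (suc c))))) and
           rec (isoArgs (suc o) (suc l) (suc t) 0F))
     or
     (lit (zeroF c) and every (lit (neg (inF (suc lo) (suc hi) 0F)) or lit (neg (inp (suc z) 0F)) or
       rec (nisoArgs (suc o) (suc l) (suc t) 0F))))
  splitRule z z′ t lo hi c =
    some (some (some (some (lit (conj (leq (s₄ lo) 3F) (conj (succF 3F 2F) (conj (leq 2F (s₄ hi)) (plus 1F 0F (s₄ c))))) and
      rec (countArgs (s₄ o) (s₄ l) (s₄ z) (s₄ z′) (s₄ t) (s₄ lo) 3F 1F) and
      rec (countArgs (s₄ o) (s₄ l) (s₄ z) (s₄ z′) (s₄ t) 2F (s₄ hi) 0F)))))
  leafRule z z′ t lo hi c = lit (eqF lo hi) and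
    (lit (conj (neg (hangF z z′ lo)) (zeroF c)) or
     (lit (hangF z z′ lo) and ((lit (succF o c) and rec (isoArgs o l t lo)) or (lit (zeroF c) and rec (nisoArgs o l t lo)))))
  countRule z z′ t lo hi c = quietRule z z′ t lo hi c or splitRule z z′ t lo hi c or leafRule z z′ t lo hi c

rules : Rule 8
rules = some (some (lit (conj (zeroF 1F) (maxF 0F)) and
  -- The two binders, for 0 and for the largest element, shift the arguments by two; the tags are
  -- now the variables 8 and 9.
  ((lit (conj (eqF 8F 1F) (eqF 9F 1F)) and isoRule 1F 0F 2F 3F) or
   (lit (conj (eqF 8F 1F) (neg (eqF 9F 1F))) and nisoRule 1F 0F 2F 3F) or
   (lit (conj (neg (eqF 8F 1F)) (eqF 9F 1F)) and distRule 1F 0F 2F 3F 4F) or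
   (lit (conj (neg (eqF 8F 1F)) (neg (eqF 9F 1F))) and countRule 1F 0F 2F 3F 4F 5F 6F 7F))))

-- Soundness

hangsIn : ∀ {N} → BRel N → Fin N → Fin N → ℕ → Fin N → Fin N → ℕ
hangsIn E z z′ v = sumIn (λ b → 𝟙 (hangOf? E z z′ v b))

Judgement : ∀ {N} → BRel N → ℕ → ℕ → (x₀ x₁ x₂ x₃ x₄ x₅ : Fin N) → Set
Judgement E zero zero x y _ _ _ _ = code E x ≡ code E y
Judgement E zero (suc _) x y _ _ _ _ = code E x ≢ code E y
Judgement E (suc _) zero x y d _ _ _ = Path E x (toℕ d) y
Judgement E (suc _) (suc _) z z′ t lo hi c = hangsIn E z z′ (code E t) lo hi ≡ toℕ c

Truth : ∀ {N} → BRel N → (Fin 8 → Fin N) → Set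
Truth E g = Judgement E (toℕ (g 6F)) (toℕ (g 7F)) (g 0F) (g 1F) (g 2F) (g 3F) (g 4F) (g 5F)

truth : ∀ {N} (E : BRel N) (g : Fin 8 → Fin N) {p q} → toℕ (g 6F) ≡ p → toℕ (g 7F) ≡ q →
        Judgement E p q (g 0F) (g 1F) (g 2F) (g 3F) (g 4F) (g 5F) → Truth E g
truth E g refl refl j = j

T-≡ : ∀ {a b} → (T a → T b) → (T b → T a) → a ≡ b
T-≡ {true} {true} f g = refl
T-≡ {true} {false} f g = ⊥-elim (f tt)
T-≡ {false} {true} f g = ⊥-elim (g tt)
T-≡ {false} {false} f g = refl

module Rules {N : ℕ} (bot top : Fin N) (bot≡0 : toℕ bot ≡ 0) {m : ℕ} (top≡suc : toℕ top ≡ suc m)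
             (≤top : ∀ (b : Fin N) → toℕ b ≤ toℕ top) where

  all-in : ∀ b → In bot top b
  all-in b = ≤-trans (≤-reflexive bot≡0) z≤n , ≤top b

  record Env (k : ℕ) : Set where
    constructor env
    field
      ρ : Fin k → Fin N
      o l : Fin k
      o≡ : ρ o ≡ bot
      l≡ : ρ l ≡ top

    o≡0 : toℕ (ρ o) ≡ 0
    o≡0 = trans (cong toℕ o≡) bot≡0

    l≡suc : toℕ (ρ l) ≡ suc m
    l≡suc = trans (cong toℕ l≡) top≡suc
  open Env public

  infixl 6 _▸_
  _▸_ : ∀ {k} → Env k → Fin N → Env (suc k)
  env ρ o l o≡ l≡ ▸ d = env (ext d ρ) (suc o) (suc l) o≡ l≡

  module Atoms (E : BRel N) (R : (Fin 8 → Fin N) → Set) (sound : ∀ g → R g → Truth E g) where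

    iso-sound : ∀ {k} (e : Env k) x y → R (λ i → ρ e (isoArgs (o e) (l e) x y i)) → code E (ρ e x) ≡ code E (ρ e y)
    iso-sound e@(env ρ o l o≡ l≡) x y r = subst (λ p → Judgement E p p (ρ x) (ρ y) (ρ o) (ρ o) (ρ o) (ρ o)) (o≡0 e) (sound _ r)

    niso-sound : ∀ {k} (e : Env k) x y → R (λ i → ρ e (nisoArgs (o e) (l e) x y i)) → code E (ρ e x) ≢ code E (ρ e y)
    niso-sound e@(env ρ o l o≡ l≡) x y r = subst₂ (λ p q → Judgement E p q (ρ x) (ρ y) (ρ o) (ρ o) (ρ o) (ρ o)) (o≡0 e) (l≡suc e) (sound _ r)

    dist-sound : ∀ {k} (e : Env k) x y d → R (λ i → ρ e (distArgs (o e) (l e) x y d i)) → Path E (ρ e x) (toℕ (ρ e d)) (ρ e y)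
    dist-sound e@(env ρ o l o≡ l≡) x y d r = subst₂ (λ p q → Judgement E p q (ρ x) (ρ y) (ρ d) (ρ o) (ρ o) (ρ o)) (l≡suc e) (o≡0 e) (sound _ r)

    count-sound : ∀ {k} (e : Env k) z z′ t lo hi c → R (λ i → ρ e (countArgs (o e) (l e) z z′ t lo hi c i)) →
                  hangsIn E (ρ e z) (ρ e z′) (code E (ρ e t)) (ρ e lo) (ρ e hi) ≡ toℕ (ρ e c)
    count-sound e@(env ρ o l o≡ l≡) z z′ t lo hi c r =
      subst (λ p → Judgement E p p (ρ z) (ρ z′) (ρ t) (ρ lo) (ρ hi) (ρ c)) (l≡suc e) (sound _ r)

    count-all-sound : ∀ {k} (e : Env k) z z′ t c → R (λ i → ρ e (countArgs (o e) (l e) z z′ t (o e) (l e) c i)) →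
                      hangs E (ρ e z) (ρ e z′) (code E (ρ e t)) ≡ toℕ (ρ e c)
    count-all-sound e z z′ t c r = trans
      (sym (trans (cong₂ (hangsIn E (ρ e z) (ρ e z′) (code E (ρ e t))) (o≡ e) (l≡ e))
                  (sumIn-all (λ b → 𝟙 (hangOf? E (ρ e z) (ρ e z′) (code E (ρ e t)) b)) bot top all-in)))
      (count-sound e z z′ t (o e) (l e) c r)

  module Update (E₀ E₁ Δ : BRel N) (F₀ : IsForest E₀) (F₁ : IsForest E₁) (A : AuxState N 3 arity)
                (A-sound : ∀ (g : Fin 8 → Fin N) → A 0F g → Truth E₀ g) (A-complete : ∀ (g : Fin 8 → Fin N) → Truth E₀ g → A 0F g)
                (A-edge : ∀ (g : Fin 2 → Fin N) → A 2F g → T (E₀ (g 0F) (g 1F))) (edge-A : ∀ (g : Fin 2 → Fin N) → T (E₀ (g 0F) (g 1F)) → A 2F g) where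

    𝒮 : Structure N 3 arity
    𝒮 = record { E = E₁ ; Δ = Δ ; A = A }

    open Forest E₁ F₁
    open Change E₀ E₁ F₀ F₁

    ¬≤⇒≢ : {a b : Fin N} → ¬ (toℕ a ≤ toℕ b × toℕ b ≤ toℕ a) → a ≢ b
    ¬≤⇒≢ h refl = h (≤-refl , ≤-refl)

    ≢⇒¬≤ : {a b : Fin N} → a ≢ b → ¬ (toℕ a ≤ toℕ b × toℕ b ≤ toℕ a)
    ≢⇒¬≤ h (p , q) = h (toℕ-injective (≤-antisym p q))

    module _ {k : ℕ} (ρ : Fin k → Fin N) where

      succF-⇒ : ∀ j i → ⟦ succF j i ⟧ 𝒮 ρ → toℕ (ρ i) ≡ suc (toℕ (ρ j))
      succF-⇒ j i (j<i , h) = ≤-antisym upper (≰⇒> j<i)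
        where
        j+1<N = ≤-<-trans (≰⇒> j<i) (toℕ<n (ρ i))
        upper : toℕ (ρ i) ≤ suc (toℕ (ρ j))
        upper with h (fromℕ< j+1<N)
        ... | inj₁ q = ⊥-elim (<-irrefl refl (≤-trans (≤-reflexive (sym (toℕ-fromℕ< j+1<N))) q))
        ... | inj₂ q = ≤-trans q (≤-reflexive (toℕ-fromℕ< j+1<N))

      succF-⇐ : ∀ j i → toℕ (ρ i) ≡ suc (toℕ (ρ j)) → ⟦ succF j i ⟧ 𝒮 ρ
      succF-⇐ j i e = <⇒≱ (≤-reflexive (sym e)) , between
        where
        between : ∀ q → toℕ q ≤ toℕ (ρ j) ⊎ toℕ (ρ i) ≤ toℕ q
        between q with toℕ q ≤? toℕ (ρ j)
        ... | yes p = inj₁ p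
        ... | no ¬p = inj₂ (≤-trans (≤-reflexive e) (≰⇒> ¬p))

      zeroF-⇒ : ∀ x → ⟦ zeroF x ⟧ 𝒮 ρ → toℕ (ρ x) ≡ 0
      zeroF-⇒ x h = n≤0⇒n≡0 (≤-trans (h bot) (≤-reflexive bot≡0))

      zeroF-⇐ : ∀ x → toℕ (ρ x) ≡ 0 → ⟦ zeroF x ⟧ 𝒮 ρ
      zeroF-⇐ x e v = subst (_≤ toℕ v) (sym e) z≤n

      sameF-⇒ : ∀ u v → ⟦ sameF u v ⟧ 𝒮 ρ → E₀ (ρ u) (ρ v) ≡ E₁ (ρ u) (ρ v)
      sameF-⇒ u v (inj₁ (p , q)) = T-≡ (λ _ → p) (λ _ → A-edge _ q)
      sameF-⇒ u v (inj₂ (p , q)) = T-≡ (λ e → ⊥-elim (q (edge-A _ e))) (λ e → ⊥-elim (p e))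

      sameF-⇐ : ∀ u v → E₀ (ρ u) (ρ v) ≡ E₁ (ρ u) (ρ v) → ⟦ sameF u v ⟧ 𝒮 ρ
      sameF-⇐ u v e with T? (E₁ (ρ u) (ρ v))
      ... | yes p = inj₁ (p , edge-A _ (subst T (sym e) p))
      ... | no ¬p = inj₂ (¬p , λ q → ¬p (subst T e (A-edge _ q)))

    unchangedF-⇒ : ∀ {k} (ρ : Fin k → Fin N) u → ⟦ unchangedF u ⟧ 𝒮 ρ → Unchanged (ρ u)
    unchangedF-⇒ ρ u h v = sameF-⇒ (ext v ρ) (suc u) 0F (h v)

    unchangedF-⇐ : ∀ {k} (ρ : Fin k → Fin N) u → Unchanged (ρ u) → ⟦ unchangedF u ⟧ 𝒮 ρ
    unchangedF-⇐ ρ u h v = sameF-⇐ (ext v ρ) (suc u) 0F (h v)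

    Quiet : (z z′ lo hi : Fin N) → Set
    Quiet z z′ lo hi = ∀ b → In lo hi b → (E₀ z b ≡ E₁ z b) × (T (E₁ z b) → b ≢ z′ × code E₀ b ≡ code E₁ b)

    quiet-count : ∀ {z z′ lo hi u b₀} → Quiet z z′ lo hi → code E₁ u ≡ code E₀ b₀ →
                  hangsIn E₁ z z′ (code E₁ u) lo hi ≡ hangsIn E₀ z z (code E₀ b₀) lo hi
    quiet-count {z} {z′} {lo} {hi} {u} {b₀} quiet c₀ = sumIn-cong term
      where
      term : ∀ b → In lo hi b → 𝟙 (hangOf? E₁ z z′ (code E₁ u) b) ≡ 𝟙 (hangOf? E₀ z z (code E₀ b₀) b)
      term b i = 𝟙-cong (hangOf? E₁ z z′ (code E₁ u) b) (hangOf? E₀ z z (code E₀ b₀) b)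
        (λ { ((d , _) , cb) → (subst T (sym (proj₁ (quiet b i))) d , no-loop d) , trans (proj₂ (proj₂ (quiet b i) d)) (trans cb c₀) })
        (λ { ((d , _) , cb) → let d′ = subst T (proj₁ (quiet b i)) d in
           (d′ , proj₁ (proj₂ (quiet b i) d′)) , trans (sym (proj₂ (proj₂ (quiet b i) d′))) (trans cb (sym c₀)) })

    module Soundness (R : (Fin 8 → Fin N) → Set) (sound : ∀ g → R g → Truth E₁ g) where
      module New = Atoms E₁ R sound
      module Stored = Atoms E₀ (A 0F) A-sound

      infix 4 _⊨_
      _⊨_ : ∀ {k} (e : Env k) → (Fin k → Fin k → Rule k) → Set
      e ⊨ φ = pos (φ (o e) (l e)) 𝒮 R (ρ e)

      -- A path of length `j` from `x` to `y` is impossible: if `j` exceeds the distance `K` of the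
      -- root, the root has a parent; otherwise the ancestor at distance `j` is both `x` and
      -- different from `x`.
      unreachable-sound : ∀ {k} (e : Env k) x y → e ⊨ (λ o l → unreachable o l x y) → ∀ {j} → ¬ Path E₁ (ρ e x) j (ρ e y)
      unreachable-sound e x y (u , K , no-parent , d , h) {j} p with j ≤? toℕ K
      ... | no j≰K = parent (m<n⇒0<n∸m (≰⇒> j≰K)) (path-≤ (<⇒≤ (≰⇒> j≰K)) (New.dist-sound (e ▸ u ▸ K) 1F (s₂ y) 0F d) p)
        where
        parent : ∀ {i v} → 0 < i → Path E₁ v i u → ⊥
        parent {suc i} _ q with unsnoc q
        ... | w , _ , e = no-parent w e
      ... | yes j≤K with h (fromℕ< (path-length p))
      ...   | inj₁ K≱j = K≱j (≤-trans (≤-reflexive (toℕ-fromℕ< (path-length p))) j≤K)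
      ...   | inj₂ (v , v≢x , q) = ¬≤⇒≢ v≢x (start-unique (New.dist-sound (e ▸ u ▸ K ▸ fromℕ< (path-length p) ▸ v) 0F (s₄ y) 1F q)
                (subst (λ i → Path E₁ (ρ e x) i (ρ e y)) (sym (toℕ-fromℕ< (path-length p))) p))

      light-sound : ∀ {k} (e : Env k) b → e ⊨ (λ o l → light o l b) → Light (ρ e b)
      light-sound e b h {u = u} p with h u
      ... | inj₁ s = unchangedF-⇒ (ext u (ρ e)) 0F s
      ... | inj₂ r = ⊥-elim (unreachable-sound (e ▸ u) (suc b) 0F r p)

      matched-sound : ∀ {k} (e : Env k) z z′ w w′ → e ⊨ (λ o l → matched o l z z′ w w′) →
                      Matching (ρ e z) (ρ e z′) (ρ e w) (ρ e w′)
      matched-sound e z z′ w w′ (h , k) = counts , partners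
        where
        counts : ∀ t → Hang E₁ (ρ e z) (ρ e z′) t → hangs E₁ (ρ e z) (ρ e z′) (code E₁ t) ≡ hangs E₁ (ρ e w) (ρ e w′) (code E₁ t)
        counts t (d , t≢) with h t
        ... | inj₁ ¬h = ⊥-elim (¬h (d , ≢⇒¬≤ t≢))
        ... | inj₂ (c , p , q) = trans (New.count-all-sound (e ▸ t ▸ c) (s₂ z) (s₂ z′) 1F 0F p)
                                   (sym (New.count-all-sound (e ▸ t ▸ c) (s₂ w) (s₂ w′) 1F 0F q))
        partners : ∀ b → Hang E₁ (ρ e w) (ρ e w′) b → Σ (Fin N) λ t → Hang E₁ (ρ e z) (ρ e z′) t × code E₁ t ≡ code E₁ b
        partners b (d , b≢) with k b
        ... | inj₁ ¬h = ⊥-elim (¬h (d , ≢⇒¬≤ b≢))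
        ... | inj₂ (t , (d′ , t≢) , r) = t , (d′ , ¬≤⇒≢ t≢) , New.iso-sound (e ▸ b ▸ t) 0F 1F r

      mismatched-sound : ∀ {k} (e : Env k) z z′ w w′ → e ⊨ (λ o l → mismatched o l z z′ w w′) →
                         ¬ SameHangs (ρ e z) (ρ e z′) (ρ e w) (ρ e w′)
      mismatched-sound e z z′ w w′ (inj₁ (t , h , c , c′ , c≢ , p , q)) same =
        ¬≤⇒≢ c≢ (toℕ-injective (trans (sym (New.count-all-sound (e ▸ t ▸ c ▸ c′) (s₃ w) (s₃ w′) 2F 0F q))
          (trans (sym (same (code E₁ t))) (New.count-all-sound (e ▸ t ▸ c ▸ c′) (s₃ z) (s₃ z′) 2F 1F p))))
      mismatched-sound e z z′ w w′ (inj₂ (b , (d , b≢) , h)) same with proj₂ (⇒matching same) b (d , ¬≤⇒≢ b≢)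
      ... | t , (d′ , t≢) , c with h t
      ...   | inj₁ ¬h = ¬h (d′ , ≢⇒¬≤ t≢)
      ...   | inj₂ r = New.niso-sound (e ▸ b ▸ t) 0F 1F r c

      hangs⁺-sound : ∀ {k} (e : Env k) z z′ w w′ → e ⊨ (λ o l → hangs⁺ o l z z′ w w′) → SameHangs (ρ e z) (ρ e z′) (ρ e w) (ρ e w′)
      hangs⁺-sound e z z′ w w′ (inj₁ m) = matching⇒ (matched-sound e z z′ w w′ m)
      hangs⁺-sound e z z′ w w′ (inj₂ m) v = sym (matching⇒ (matched-sound e w w′ z z′ m) v)

      hangs⁻-sound : ∀ {k} (e : Env k) z z′ w w′ → e ⊨ (λ o l → hangs⁻ o l z z′ w w′) → ¬ SameHangs (ρ e z) (ρ e z′) (ρ e w) (ρ e w′)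
      hangs⁻-sound e z z′ w w′ (inj₁ m) same = mismatched-sound e z z′ w w′ m same
      hangs⁻-sound e z z′ w w′ (inj₂ m) same = mismatched-sound e w w′ z z′ m (λ v → sym (same v))

      level⁺-sound : ∀ {k} (e : Env k) j y y* → e ⊨ (λ o l → level⁺ o l j y y*) → Level (toℕ (ρ e j)) (ρ e y) (ρ e y*)
      level⁺-sound e j y y* (z′ , z , w′ , w , q , q* , (d , d*) , m) = z′ , z , w′ , w ,
        New.dist-sound e₄ 3F (s₄ y) (s₄ j) q , New.dist-sound e₄ 1F (s₄ y*) (s₄ j) q* , d , d* , hangs⁺-sound e₄ 2F 3F 0F 1F m
        where e₄ = e ▸ z′ ▸ z ▸ w′ ▸ w

      -- Ancestors at a given distance are unique, so the nodes in the derivation are the very ones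
      -- that a `Level` would compare.
      level⁻-sound : ∀ {k} (e : Env k) j y y* → e ⊨ (λ o l → level⁻ o l j y y*) → ¬ Level (toℕ (ρ e j)) (ρ e y) (ρ e y*)
      level⁻-sound e j y y* (z′ , z , w′ , w , r , r* , (d , d*) , m) (z″ , v , w″ , u , r′ , r*′ , d′ , d*′ , same)
        with start-unique (New.dist-sound (e ▸ z′ ▸ z ▸ w′ ▸ w) 3F (s₄ y) (s₄ j) r) r′
           | start-unique (New.dist-sound (e ▸ z′ ▸ z ▸ w′ ▸ w) 1F (s₄ y*) (s₄ j) r*) r*′
      ... | refl | refl with parent-unique d d′ | parent-unique d* d*′
      ...   | refl | refl = hangs⁻-sound (e ▸ z′ ▸ z ▸ w′ ▸ w) 2F 3F 0F 1F m same

      along⁺-sound : ∀ {k} (e : Env k) x x* → e ⊨ (λ o l → along⁺ o l x x*) → code E₁ (ρ e x) ≡ code E₁ (ρ e x*)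
      along⁺-sound e x x* (y , y* , K , p , p* , h , lev) =
        ascend (New.dist-sound e₃ (s₃ x) 2F 0F p) (New.dist-sound e₃ (s₃ x*) 1F 0F p*)
          (hangs⇒code (hangs⁺-sound e₃ 2F 2F 1F 1F h)) level
        where
        e₃ = e ▸ y ▸ y* ▸ K
        level : ∀ j → j < toℕ K → Level j y y*
        level j j<K with lev (fromℕ< (<-trans j<K (toℕ<n K)))
        ... | inj₁ K≤j = ⊥-elim (<⇒≱ j<K (≤-trans K≤j (≤-reflexive (toℕ-fromℕ< _))))
        ... | inj₂ r = subst (λ i → Level i y y*) (toℕ-fromℕ< _) (level⁺-sound (e₃ ▸ fromℕ< (<-trans j<K (toℕ<n K))) 0F 3F 2F r)

      along⁻-sound : ∀ {k} (e : Env k) x x* → e ⊨ (λ o l → along⁻ o l x x*) → code E₁ (ρ e x) ≢ code E₁ (ρ e x*)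
      along⁻-sound e x x* (y , K , p , h) c
        with descend c (New.dist-sound (e ▸ y ▸ K) (s₂ x) 1F 0F p)
      ... | y* , p* , cy , lev with h y*
      ...   | inj₁ un = unreachable-sound (e ▸ y ▸ K ▸ y*) (s₃ x*) 0F un p*
      ...   | inj₂ (K* , q* , inj₁ K≢) = ¬≤⇒≢ K≢ (toℕ-injective (length-unique (New.dist-sound (e ▸ y ▸ K ▸ y* ▸ K*) (s₄ x*) 1F 0F q*) p*))
      ...   | inj₂ (K* , q* , inj₂ (inj₁ m)) = hangs⁻-sound (e ▸ y ▸ K ▸ y* ▸ K*) 3F 3F 1F 1F m (code⇒hangs cy)
      ...   | inj₂ (K* , q* , inj₂ (inj₂ (j , j≱K , r))) = level⁻-sound (e ▸ y ▸ K ▸ y* ▸ K* ▸ j) 0F 4F 2F r (lev (toℕ j) (≰⇒> j≱K))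

      isoRule-sound : ∀ {k} (e : Env k) x y → e ⊨ (λ o l → isoRule o l x y) → code E₁ (ρ e x) ≡ code E₁ (ρ e y)
      isoRule-sound e x y (inj₁ (lx , ly , s)) = trans (sym (light-code (light-sound e x lx)))
        (trans (Stored.iso-sound e x y s) (light-code (light-sound e y ly)))
      isoRule-sound e x y (inj₂ (inj₁ a)) = along⁺-sound e x y a
      isoRule-sound e x y (inj₂ (inj₂ a)) = sym (along⁺-sound e y x a)

      nisoRule-sound : ∀ {k} (e : Env k) x y → e ⊨ (λ o l → nisoRule o l x y) → code E₁ (ρ e x) ≢ code E₁ (ρ e y)
      nisoRule-sound e x y (inj₁ (lx , ly , s)) c = s (A-complete _
        (subst (λ p → Judgement E₀ p p (ρ e x) (ρ e y) (ρ e (o e)) (ρ e (o e)) (ρ e (o e)) (ρ e (o e))) (sym (o≡0 e))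
          (trans (light-code (light-sound e x lx)) (trans c (sym (light-code (light-sound e y ly)))))))
      nisoRule-sound e x y (inj₂ (inj₁ a)) = along⁻-sound e x y a
      nisoRule-sound e x y (inj₂ (inj₂ a)) c = along⁻-sound e y x a (sym c)

      oldReach-complete : ∀ {k} (e : Env k) x y → (Σ ℕ λ i → Path E₀ (ρ e x) i (ρ e y)) → ⟦ oldReach (o e) (l e) x y ⟧ 𝒮 (ρ e)
      oldReach-complete e x y (i , p) = d , A-complete _
        (subst₂ (λ p q → Judgement E₀ p q (ρ e x) (ρ e y) d (ρ e (o e)) (ρ e (o e)) (ρ e (o e))) (sym (l≡suc e)) (sym (o≡0 e))
          (subst (λ i → Path E₀ (ρ e x) i (ρ e y)) (sym (toℕ-fromℕ< (Old.path-length p))) p))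
        where d = fromℕ< (Old.path-length p)

      distRule-sound : ∀ {k} (e : Env k) x y d → e ⊨ (λ o l → distRule o l x y d) → Path E₁ (ρ e x) (toℕ (ρ e d)) (ρ e y)
      distRule-sound e x y d (inj₁ (s , h)) = intact⇒path (Stored.dist-sound e x y d s) intact
        where
        intact : Intact (ρ e x) (ρ e y)
        intact u v f r s = decidable-stable (T? (E₁ u v)) λ ¬f → h u v
          (edge-A _ f , oldReach-complete (e ▸ u ▸ v) (s₂ x) 1F r , oldReach-complete (e ▸ u ▸ v) 0F (s₂ y) s , ¬f)
      distRule-sound e x y d (inj₂ (u , v , k₁ , k₂ , j , (f , s , t) , p , q)) =
        subst (λ i → Path E₁ (ρ e x) i (ρ e y))
          (trans (+-suc (toℕ k₁) (toℕ k₂)) (trans (cong suc s) (sym (succF-⇒ (ρ e₅) 0F (s₅ d) t))))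
          (append (New.dist-sound e₅ (s₅ x) 4F 2F p) (f ∷ New.dist-sound e₅ 3F (s₅ y) 1F q))
        where e₅ = e ▸ u ▸ v ▸ k₁ ▸ k₂ ▸ j

      Count : ∀ {k} → Env k → (z z′ t lo hi c : Fin k) → Set
      Count e z z′ t lo hi c = hangsIn E₁ (ρ e z) (ρ e z′) (code E₁ (ρ e t)) (ρ e lo) (ρ e hi) ≡ toℕ (ρ e c)

      quietRule-sound : ∀ {k} (e : Env k) z z′ t lo hi c → e ⊨ (λ o l → quietRule o l z z′ t lo hi c) → Count e z z′ t lo hi c
      quietRule-sound e z z′ t lo hi c (h , cases) = conclude cases
        where
        is? : ∀ b → Dec (Hang E₁ (ρ e z) (ρ e z′) b × code E₁ b ≡ code E₁ (ρ e t))
        is? b = hangOf? E₁ (ρ e z) (ρ e z′) (code E₁ (ρ e t)) b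
        quiet : Quiet (ρ e z) (ρ e z′) (ρ e lo) (ρ e hi)
        quiet b i with h b
        ... | inj₁ ¬i = ⊥-elim (¬i i)
        ... | inj₂ (s , inj₁ ¬e) = sameF-⇒ (ext b (ρ e)) (suc z) 0F s , λ d → ⊥-elim (¬e d)
        ... | inj₂ (s , inj₂ (b≢ , lb)) = sameF-⇒ (ext b (ρ e)) (suc z) 0F s , λ _ → ¬≤⇒≢ b≢ , light-code (light-sound (e ▸ b) 0F lb)
        conclude : _ → Count e z z′ t lo hi c
        conclude (inj₁ (b₀ , (i₀ , e₀ , s) , r)) = trans
          (quiet-count quiet (trans (New.iso-sound (e ▸ b₀) (suc t) 0F r) (sym (proj₂ (proj₂ (quiet b₀ i₀) e₀)))))
          (Stored.count-sound (e ▸ b₀) (suc z) (suc z) 0F (suc lo) (suc hi) (suc c) s)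
        conclude (inj₂ (c0 , h′)) = trans (sumIn-≡0 λ b i → 𝟙-no (is? b) (none b i)) (sym (zeroF-⇒ (ρ e) c c0))
          where
          none : ∀ b → In (ρ e lo) (ρ e hi) b → ¬ (Hang E₁ (ρ e z) (ρ e z′) b × code E₁ b ≡ code E₁ (ρ e t))
          none b i ((d , _) , cb) with h′ b
          ... | inj₁ ¬i = ¬i i
          ... | inj₂ (inj₁ ¬e) = ¬e d
          ... | inj₂ (inj₂ r) = New.niso-sound (e ▸ b) (suc t) 0F r (sym cb)

      splitRule-sound : ∀ {k} (e : Env k) z z′ t lo hi c → e ⊨ (λ o l → splitRule o l z z′ t lo hi c) → Count e z z′ t lo hi c
      splitRule-sound e z z′ t lo hi c (m , m′ , k₁ , k₂ , (lo≤m , s , m′≤hi , eq) , p , q) =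
        trans (sumIn-split (λ b → 𝟙 (hangOf? E₁ (ρ e z) (ρ e z′) (code E₁ (ρ e t)) b)) {ρ e lo} {m} {m′} {ρ e hi}
                 lo≤m (succF-⇒ (ρ e₄) 3F 2F s) m′≤hi)
          (trans (cong₂ _+_ (New.count-sound e₄ (s₄ z) (s₄ z′) (s₄ t) (s₄ lo) 3F 1F p)
                            (New.count-sound e₄ (s₄ z) (s₄ z′) (s₄ t) 2F (s₄ hi) 0F q)) eq)
        where e₄ = e ▸ m ▸ m′ ▸ k₁ ▸ k₂

      leafRule-sound : ∀ {k} (e : Env k) z z′ t lo hi c → e ⊨ (λ o l → leafRule o l z z′ t lo hi c) → Count e z z′ t lo hi c
      leafRule-sound e z z′ t lo hi c ((p , q) , cases) =
        trans (cong (hangsIn E₁ (ρ e z) (ρ e z′) (code E₁ (ρ e t)) (ρ e lo)) (toℕ-injective (≤-antisym q p)))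
          (trans (sumIn-single (λ b → 𝟙 (hangOf? E₁ (ρ e z) (ρ e z′) (code E₁ (ρ e t)) b)) (ρ e lo)) (conclude cases))
        where
        d = hangOf? E₁ (ρ e z) (ρ e z′) (code E₁ (ρ e t)) (ρ e lo)
        conclude : _ → 𝟙 d ≡ toℕ (ρ e c)
        conclude (inj₁ (¬h , c0)) = trans (𝟙-no d λ { ((f , lo≢) , _) → ¬h (f , ≢⇒¬≤ lo≢) }) (sym (zeroF-⇒ (ρ e) c c0))
        conclude (inj₂ ((f , lo≢) , inj₁ (c1 , r))) = trans (𝟙-yes d ((f , ¬≤⇒≢ lo≢) , sym (New.iso-sound e t lo r)))
          (sym (trans (succF-⇒ (ρ e) (o e) c c1) (cong suc (o≡0 e))))
        conclude (inj₂ (_ , inj₂ (c0 , r))) = trans (𝟙-no d λ { (_ , cb) → New.niso-sound e t lo r (sym cb) }) (sym (zeroF-⇒ (ρ e) c c0))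

      countRule-sound : ∀ {k} (e : Env k) z z′ t lo hi c → e ⊨ (λ o l → countRule o l z z′ t lo hi c) → Count e z z′ t lo hi c
      countRule-sound e z z′ t lo hi c (inj₁ p) = quietRule-sound e z z′ t lo hi c p
      countRule-sound e z z′ t lo hi c (inj₂ (inj₁ p)) = splitRule-sound e z z′ t lo hi c p
      countRule-sound e z z′ t lo hi c (inj₂ (inj₂ p)) = leafRule-sound e z z′ t lo hi c p

      rules-sound : ∀ g → pos rules 𝒮 R g → Truth E₁ g
      rules-sound g (b , t , (b0 , tm) , cases) = conclude cases
        where
        b≡0 : toℕ b ≡ 0
        b≡0 = zeroF-⇒ (ext t (ext b g)) 1F b0
        e : Env 10
        e = env (ext t (ext b g)) 1F 0F (toℕ-injective (trans b≡0 (sym bot≡0))) (toℕ-injective (≤-antisym (≤top t) (tm top)))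
        zero-tag : ∀ {p} → toℕ p ≤ toℕ b × toℕ b ≤ toℕ p → toℕ p ≡ 0
        zero-tag (p≤b , _) = n≤0⇒n≡0 (≤-trans p≤b (≤-reflexive b≡0))
        suc-tag : ∀ {p} → ¬ (toℕ p ≤ toℕ b × toℕ b ≤ toℕ p) → Σ ℕ λ k → toℕ p ≡ suc k
        suc-tag {p} h with toℕ p
        ... | zero = ⊥-elim (h (z≤n , ≤-reflexive b≡0))
        ... | suc k = k , refl
        conclude : _ → Truth E₁ g
        conclude (inj₁ ((p , q) , r)) = truth E₁ g (zero-tag p) (zero-tag q) (isoRule-sound e 2F 3F r)
        conclude (inj₂ (inj₁ ((p , q) , r))) = truth E₁ g (zero-tag p) (proj₂ (suc-tag q)) (nisoRule-sound e 2F 3F r)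
        conclude (inj₂ (inj₂ (inj₁ ((p , q) , r)))) = truth E₁ g (proj₂ (suc-tag p)) (zero-tag q) (distRule-sound e 2F 3F 4F r)
        conclude (inj₂ (inj₂ (inj₂ ((p , q) , r)))) = truth E₁ g (proj₂ (suc-tag p)) (proj₂ (suc-tag q)) (countRule-sound e 2F 3F 4F 5F 6F 7F r)

    stage-sound : ∀ t g → stage rules 𝒮 t g → Truth E₁ g
    stage-sound (suc t) g = Soundness.rules-sound (stage rules 𝒮 t) (stage-sound t) g

-- Completeness in O(log log n) rounds

module Completeness {N : ℕ} (bot top : Fin N) (bot≡0 : toℕ bot ≡ 0) {m : ℕ} (top≡suc : toℕ top ≡ suc m)
    (≤top : ∀ (b : Fin N) → toℕ b ≤ toℕ top)
    (E₀ E₁ Δ : BRel N) (F₀ : IsForest E₀) (F₁ : IsForest E₁) (A : AuxState N 3 arity)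
    (A-sound : ∀ (g : Fin 8 → Fin N) → A 0F g → Truth E₀ g) (A-complete : ∀ (g : Fin 8 → Fin N) → Truth E₀ g → A 0F g)
    (A-edge : ∀ (g : Fin 2 → Fin N) → A 2F g → T (E₀ (g 0F) (g 1F))) (edge-A : ∀ (g : Fin 2 → Fin N) → T (E₀ (g 0F) (g 1F)) → A 2F g) where

  open Rules bot top bot≡0 top≡suc ≤top
  open Update E₀ E₁ Δ F₀ F₁ A A-sound A-complete A-edge edge-A
  open Forest E₁ F₁
  open Change E₀ E₁ F₀ F₁

  opaque
    S : ℕ → (Fin 8 → Fin N) → Set
    S = stage rules 𝒮

    derive : ∀ {t g} → pos rules 𝒮 (S t) g → S (suc t) g
    derive p = p

    derived : ∀ {t g} → S t g → stage rules 𝒮 t g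
    derived p = p

    stage-mono : ∀ {t t′} → t ≤ t′ → ∀ g → S t g → S t′ g
    stage-mono {t} {t′} t≤t′ g p = subst (λ t → S t g) (m∸n+n≡m t≤t′) (up (t′ ∸ t))
      where
      up : ∀ d → S (d + t) g
      up zero = p
      up (suc d) = stage-suc rules 𝒮 (d + t) g (up d)

  -- The truth of a tuple depends neither on its padding arguments nor on which nonzero value a tag
  -- has. A judgement counts as known only when all tuples that encode it are derived.
  IsoAt NonIsoAt : ℕ → (x y : Fin N) → Set
  IsoAt t x y = ∀ g → g 0F ≡ x → g 1F ≡ y → toℕ (g 6F) ≡ 0 → toℕ (g 7F) ≡ 0 → S t g
  NonIsoAt t x y = ∀ g → g 0F ≡ x → g 1F ≡ y → toℕ (g 6F) ≡ 0 → toℕ (g 7F) ≢ 0 → S t g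

  DistAt : ℕ → (x : Fin N) → ℕ → (y : Fin N) → Set
  DistAt t x k y = ∀ g → g 0F ≡ x → g 1F ≡ y → toℕ (g 2F) ≡ k → toℕ (g 6F) ≢ 0 → toℕ (g 7F) ≡ 0 → S t g

  CountAt : ℕ → (z z′ u lo hi : Fin N) → ℕ → Set
  CountAt t z z′ u lo hi c = ∀ g → g 0F ≡ z → g 1F ≡ z′ → g 2F ≡ u → g 3F ≡ lo → g 4F ≡ hi → toℕ (g 5F) ≡ c →
                             toℕ (g 6F) ≢ 0 → toℕ (g 7F) ≢ 0 → S t g

  ComparedAt : ℕ → (x y : Fin N) → Set
  ComparedAt t x y = (code E₁ x ≡ code E₁ y → IsoAt t x y) × (code E₁ x ≢ code E₁ y → NonIsoAt t x y)

  CountedAt : ℕ → (z z′ u lo hi : Fin N) → Set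
  CountedAt t z z′ u lo hi = CountAt t z z′ u lo hi (hangsIn E₁ z z′ (code E₁ u) lo hi)

  DistsAt : ℕ → Set
  DistsAt t = ∀ x k y → Path E₁ x k y → DistAt t x k y

  compared-mono : ∀ {t t′ x y} → t ≤ t′ → ComparedAt t x y → ComparedAt t′ x y
  compared-mono t≤ (p , q) = (λ c g a b d e → stage-mono t≤ g (p c g a b d e)) , (λ c g a b d e → stage-mono t≤ g (q c g a b d e))

  counted-mono : ∀ {t t′ z z′ u lo hi} → t ≤ t′ → CountedAt t z z′ u lo hi → CountedAt t′ z z′ u lo hi
  counted-mono t≤ p g a b c d e f h i = stage-mono t≤ g (p g a b c d e f h i)

  dists-mono : ∀ {t t′} → t ≤ t′ → DistsAt t → DistsAt t′
  dists-mono t≤ p x k y q g a b c d e = stage-mono t≤ g (p x k y q g a b c d e)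

  top≢0 : ∀ {k} (e : Env k) → toℕ (ρ e (l e)) ≢ 0
  top≢0 e eq with trans (sym (l≡suc e)) eq
  ... | ()

  baseEnv : (Fin 8 → Fin N) → Env 10
  baseEnv g = env (ext top (ext bot g)) 1F 0F refl refl

  eqF-bot : ∀ {p : Fin N} → toℕ p ≡ 0 → toℕ p ≤ toℕ bot × toℕ bot ≤ toℕ p
  eqF-bot e = ≤-reflexive (trans e (sym bot≡0)) , ≤-reflexive (trans bot≡0 (sym e))

  neF-bot : ∀ {p : Fin N} → toℕ p ≢ 0 → ¬ (toℕ p ≤ toℕ bot × toℕ bot ≤ toℕ p)
  neF-bot h (p≤ , _) = h (n≤0⇒n≡0 (≤-trans p≤ (≤-reflexive bot≡0)))

  bounds : ∀ g → ⟦ conj (zeroF 1F) (maxF 0F) ⟧ 𝒮 (ρ (baseEnv g))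
  bounds g = zeroF-⇐ (ρ (baseEnv g)) 1F bot≡0 , ≤top

  suffix : ∀ {j k x y} → j ≤ k → Path E₁ x k y → Σ (Fin N) λ v → Path E₁ v j y
  suffix {j} {k} j≤k p with j ≟ℕ k
  ... | yes refl = _ , p
  suffix {j} j≤k [] | no j≢k = ⊥-elim (j≢k (n≤0⇒n≡0 j≤k))
  suffix {j} j≤k (e ∷ p) | no j≢k = suffix (s≤s⁻¹ (≤∧≢⇒< j≤k j≢k)) p

  -- `z` is not its own child, so at most N - 1 nodes are counted and the count is an element of the
  -- domain.
  hangs<N : ∀ z z′ v → hangs E₁ z z′ v < N
  hangs<N z z′ v = ≤-trans (≤-reflexive (sym total)) (sum≤N _ term)
    where
    d : ∀ b → Dec (Hang E₁ z z′ b × code E₁ b ≡ v)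
    d b = hangOf? E₁ z z′ v b
    total : sum (λ b → 𝟙 (d b) + 𝟙 (b ≟ z)) ≡ suc (hangs E₁ z z′ v)
    total = trans (∑-distrib-+ (λ b → 𝟙 (d b)) (λ b → 𝟙 (b ≟ z)))
      (trans (cong (hangs E₁ z z′ v +_) (trans (sum-single _ z (λ b → 𝟙-no (b ≟ z))) (𝟙-yes (z ≟ z) refl))) (+-comm _ 1))
    term : ∀ b → 𝟙 (d b) + 𝟙 (b ≟ z) ≤ 1
    term b with b ≟ z
    ... | yes refl = ≤-reflexive (cong (_+ 1) (𝟙-no (d b) λ { ((e , _) , _) → no-loop e refl }))
    ... | no _ = ≤-trans (≤-reflexive (+-identityʳ _)) (𝟙≤1 (d b))

  hangsIn<N : ∀ z z′ v lo hi → hangsIn E₁ z z′ v lo hi < N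
  hangsIn<N z z′ v lo hi = ≤-<-trans (sumIn≤sum (λ b → 𝟙 (hangOf? E₁ z z′ v b)) lo hi) (hangs<N z z′ v)

  hangsIn-all : ∀ z z′ v → hangsIn E₁ z z′ v bot top ≡ hangs E₁ z z′ v
  hangsIn-all z z′ v = sumIn-all (λ b → 𝟙 (hangOf? E₁ z z′ v b)) bot top all-in

  -- Isomorphism classes are represented by the hanging children of z.
  record Comparable (t : ℕ) (z z′ w w′ : Fin N) : Set where
    field
      countˡ : ∀ u → Hang E₁ z z′ u → CountedAt t z z′ u bot top
      countʳ : ∀ u → Hang E₁ z z′ u → CountedAt t w w′ u bot top
      compare : ∀ u b → Hang E₁ z z′ u → Hang E₁ w w′ b → ComparedAt t u b
  open Comparable

  EitherComparable : ℕ → (z z′ w w′ : Fin N) → Set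
  EitherComparable t z z′ w w′ = Comparable t z z′ w w′ ⊎ Comparable t w w′ z z′

  -- All ends `y*` of equally long paths in the other tree are covered, since `along⁻` has to refute
  -- each of them.
  record PathComparable (t : ℕ) (x x* : Fin N) : Set where
    field
      {y} : Fin N
      {k} : ℕ
      path : Path E₁ x k y
      end : ∀ {y*} → Path E₁ x* k y* → EitherComparable t y y y* y*
      levels : ∀ {y* j z′ z w′ w} → Path E₁ x* k y* → j < k → Path E₁ z′ j y → Path E₁ w′ j y* → T (E₁ z z′) → T (E₁ w w′) →
               EitherComparable t z z′ w w′

  Mismatch : ℕ → (y y* : Fin N) → Set
  Mismatch j y y* = Σ (Fin N) λ z′ → Σ (Fin N) λ z → Σ (Fin N) λ w′ → Σ (Fin N) λ w →
    Path E₁ z′ j y × Path E₁ w′ j y* × T (E₁ z z′) × T (E₁ w w′) × ¬ SameHangs z z′ w w′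

  search : ∀ k {P Q : ℕ → Set} → (∀ j → j < k → P j ⊎ Q j) → (∀ j → j < k → P j) ⊎ Σ ℕ λ j → j < k × Q j
  search zero f = inj₁ λ _ ()
  search (suc k) {P} f with f k ≤-refl | search k (λ j j<k → f j (m<n⇒m<1+n j<k))
  ... | inj₂ q | _ = inj₂ (k , ≤-refl , q)
  ... | inj₁ _ | inj₂ (j , j<k , q) = inj₂ (j , m<n⇒m<1+n j<k , q)
  ... | inj₁ p | inj₁ ps = inj₁ all-P
    where
    all-P : ∀ j → j < suc k → P j
    all-P j j< with j ≟ℕ k
    ... | yes refl = p
    ... | no j≢k = ps j (≤∧≢⇒< (s≤s⁻¹ j<) j≢k)

  module Stored = Atoms E₀ (A 0F) A-sound

  module Step (t : ℕ) (dists : DistsAt t) where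

    infix 4 _⊨_
    _⊨_ : ∀ {k} (e : Env k) → (Fin k → Fin k → Rule k) → Set
    e ⊨ φ = pos (φ (o e) (l e)) 𝒮 (S t) (ρ e)

    dist-complete : ∀ {k} (e : Env k) x y d → Path E₁ (ρ e x) (toℕ (ρ e d)) (ρ e y) → S t (λ i → ρ e (distArgs (o e) (l e) x y d i))
    dist-complete e x y d p = dists _ _ _ p _ refl refl refl (top≢0 e) (o≡0 e)

    iso-complete : ∀ {k} (e : Env k) x y → IsoAt t (ρ e x) (ρ e y) → S t (λ i → ρ e (isoArgs (o e) (l e) x y i))
    iso-complete e x y h = h _ refl refl (o≡0 e) (o≡0 e)

    niso-complete : ∀ {k} (e : Env k) x y → NonIsoAt t (ρ e x) (ρ e y) → S t (λ i → ρ e (nisoArgs (o e) (l e) x y i))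
    niso-complete e x y h = h _ refl refl (o≡0 e) (top≢0 e)

    count-all-complete : ∀ {k} (e : Env k) z z′ u c → CountedAt t (ρ e z) (ρ e z′) (ρ e u) bot top →
      toℕ (ρ e c) ≡ hangs E₁ (ρ e z) (ρ e z′) (code E₁ (ρ e u)) → S t (λ i → ρ e (countArgs (o e) (l e) z z′ u (o e) (l e) c i))
    count-all-complete e z z′ u c h eq = h _ refl refl refl (o≡ e) (l≡ e) (trans eq (sym (hangsIn-all _ _ _))) (top≢0 e) (top≢0 e)

    unreachable-complete : ∀ {k} (e : Env k) x y → (∀ {j} → ¬ Path E₁ (ρ e x) j (ρ e y)) → e ⊨ (λ o l → unreachable o l x y)
    unreachable-complete e x y none = below-root (root (ρ e y))
      where
      below-root : (Σ (Fin N) λ u → Σ ℕ λ k → Path E₁ u k (ρ e y) × (∀ p → ¬ T (E₁ p u))) → e ⊨ (λ o l → unreachable o l x y)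
      below-root (u , k , p , no-parent) = u , K , no-parent ,
          dist-complete (e ▸ u ▸ K) 1F (s₂ y) 0F (subst (λ i → Path E₁ u i (ρ e y)) (sym K≡) p) ,
          λ i → Data.Sum.map <⇒≱ (λ i≤K → ancestor i (suffix (≤-trans i≤K (≤-reflexive K≡)) p)) (<-≤-connex (toℕ K) (toℕ i))
        where
        K : Fin N
        K = fromℕ< (path-length p)
        K≡ : toℕ K ≡ k
        K≡ = toℕ-fromℕ< (path-length p)
        ancestor : ∀ i → (Σ (Fin N) λ v → Path E₁ v (toℕ i) (ρ e y)) →
                   (e ▸ u ▸ K ▸ i) ⊨ (λ o l → some (lit (neg (eqF 0F (s₄ x))) and rec (distArgs (suc o) (suc l) 0F (s₄ y) 1F)))
        ancestor i (v , q) = v , ≢⇒¬≤ (λ { refl → none q }) , dist-complete (e ▸ u ▸ K ▸ i ▸ v) 0F (s₄ y) 1F q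

    light-complete : ∀ {k} (e : Env k) b → Light (ρ e b) → e ⊨ (λ o l → light o l b)
    light-complete e b light u = decide (reach? (ρ e b) u)
      where
      decide : Dec (Σ ℕ λ k → Path E₁ (ρ e b) k u) → (e ▸ u) ⊨ (λ o l → lit (unchangedF 0F) or unreachable o l (suc b) 0F)
      decide (yes (k , p)) = inj₁ (unchangedF-⇐ (ext u (ρ e)) 0F (light p))
      decide (no none) = inj₂ (unreachable-complete (e ▸ u) (suc b) 0F (λ p → none (_ , p)))

    module _ {k} (e : Env k) (z z′ w w′ : Fin k) (C : Comparable t (ρ e z) (ρ e z′) (ρ e w) (ρ e w′)) where

      hang-or : ∀ (z z′ : Fin N) u {X : Set} → (Hang E₁ z z′ u → X) → ¬ (T (E₁ z u) × ¬ (toℕ u ≤ toℕ z′ × toℕ z′ ≤ toℕ u)) ⊎ X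
      hang-or z z′ u f with hang? E₁ z z′ u
      ... | yes h = inj₂ (f h)
      ... | no ¬h = inj₁ λ { (d , u≢) → ¬h (d , ¬≤⇒≢ u≢) }

      matched-complete : Matching (ρ e z) (ρ e z′) (ρ e w) (ρ e w′) → e ⊨ (λ o l → matched o l z z′ w w′)
      matched-complete (counts , partners) = (λ u → hang-or (ρ e z) (ρ e z′) u (equal u)) , (λ b → hang-or (ρ e w) (ρ e w′) b (partner b))
        where
        equal : ∀ u → Hang E₁ (ρ e z) (ρ e z′) u → _
        equal u h = fromℕ< c<N ,
          count-all-complete (e ▸ u ▸ fromℕ< c<N) (s₂ z) (s₂ z′) 1F 0F (countˡ C u h) (toℕ-fromℕ< c<N) ,
          count-all-complete (e ▸ u ▸ fromℕ< c<N) (s₂ w) (s₂ w′) 1F 0F (countʳ C u h) (trans (toℕ-fromℕ< c<N) (counts u h))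
          where c<N = hangs<N (ρ e z) (ρ e z′) (code E₁ u)
        partner : ∀ b → Hang E₁ (ρ e w) (ρ e w′) b → _
        partner b h with partners b h
        ... | u , hu , c = u , (proj₁ hu , ≢⇒¬≤ (proj₂ hu)) , iso-complete (e ▸ b ▸ u) 0F 1F (proj₁ (compare C u b hu h) c)

      mismatched-complete : ¬ Matching (ρ e z) (ρ e z′) (ρ e w) (ρ e w′) → e ⊨ (λ o l → mismatched o l z z′ w w′)
      mismatched-complete ¬m
        with any? (λ u → hang? E₁ (ρ e z) (ρ e z′) u ×-dec ¬? (hangs E₁ (ρ e z) (ρ e z′) (code E₁ u) ≟ℕ hangs E₁ (ρ e w) (ρ e w′) (code E₁ u)))
      ... | yes (u , h , c≢) = inj₁ (u , (proj₁ h , ≢⇒¬≤ (proj₂ h)) , fromℕ< c<N , fromℕ< c′<N ,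
              ≢⇒¬≤ (λ eq → c≢ (trans (sym (toℕ-fromℕ< c<N)) (trans (cong toℕ (sym eq)) (toℕ-fromℕ< c′<N)))) ,
              count-all-complete (e ▸ u ▸ fromℕ< c<N ▸ fromℕ< c′<N) (s₃ z) (s₃ z′) 2F 1F (countˡ C u h) (toℕ-fromℕ< c<N) ,
              count-all-complete (e ▸ u ▸ fromℕ< c<N ▸ fromℕ< c′<N) (s₃ w) (s₃ w′) 2F 0F (countʳ C u h) (toℕ-fromℕ< c′<N))
        where
        c<N = hangs<N (ρ e z) (ρ e z′) (code E₁ u)
        c′<N = hangs<N (ρ e w) (ρ e w′) (code E₁ u)
      ... | no equal
        with any? (λ b → hang? E₁ (ρ e w) (ρ e w′) b ×-dec ¬? (any? (λ u → hang? E₁ (ρ e z) (ρ e z′) u ×-dec (code E₁ u ≟ℕ code E₁ b))))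
      ...   | yes (b , h , none) = inj₂ (b , (proj₁ h , ≢⇒¬≤ (proj₂ h)) , λ u → hang-or (ρ e z) (ρ e z′) u λ hu →
                niso-complete (e ▸ b ▸ u) 0F 1F (proj₂ (compare C u b hu h) λ c → none (u , hu , c)))
      ...   | no partnered = ⊥-elim (¬m ((λ u h → decidable-stable (_ ≟ℕ _) λ c≢ → equal (u , h , c≢)) ,
                λ b h → decidable-stable (any? (λ u → hang? E₁ (ρ e z) (ρ e z′) u ×-dec (code E₁ u ≟ℕ code E₁ b))) λ none → partnered (b , h , none)))

    hangs⁺-complete : ∀ {k} (e : Env k) z z′ w w′ → EitherComparable t (ρ e z) (ρ e z′) (ρ e w) (ρ e w′) →
                      SameHangs (ρ e z) (ρ e z′) (ρ e w) (ρ e w′) → e ⊨ (λ o l → hangs⁺ o l z z′ w w′)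
    hangs⁺-complete e z z′ w w′ (inj₁ C) same = inj₁ (matched-complete e z z′ w w′ C (⇒matching same))
    hangs⁺-complete e z z′ w w′ (inj₂ C) same = inj₂ (matched-complete e w w′ z z′ C (⇒matching (λ v → sym (same v))))

    hangs⁻-complete : ∀ {k} (e : Env k) z z′ w w′ → EitherComparable t (ρ e z) (ρ e z′) (ρ e w) (ρ e w′) →
                      ¬ SameHangs (ρ e z) (ρ e z′) (ρ e w) (ρ e w′) → e ⊨ (λ o l → hangs⁻ o l z z′ w w′)
    hangs⁻-complete e z z′ w w′ (inj₁ C) ¬same = inj₁ (mismatched-complete e z z′ w w′ C (¬same ∘ matching⇒))
    hangs⁻-complete e z z′ w w′ (inj₂ C) ¬same = inj₂ (mismatched-complete e w w′ z z′ C (λ m → ¬same (λ v → sym (matching⇒ m v))))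

    level⁺-complete : ∀ {k} (e : Env k) j y y* {z′ z w′ w} → Path E₁ z′ (toℕ (ρ e j)) (ρ e y) → Path E₁ w′ (toℕ (ρ e j)) (ρ e y*) →
                      T (E₁ z z′) → T (E₁ w w′) → EitherComparable t z z′ w w′ → SameHangs z z′ w w′ → e ⊨ (λ o l → level⁺ o l j y y*)
    level⁺-complete e j y y* {z′} {z} {w′} {w} q q* d d* C same = z′ , z , w′ , w ,
      dist-complete (e ▸ z′ ▸ z ▸ w′ ▸ w) 3F (s₄ y) (s₄ j) q , dist-complete (e ▸ z′ ▸ z ▸ w′ ▸ w) 1F (s₄ y*) (s₄ j) q* ,
      (d , d*) , hangs⁺-complete (e ▸ z′ ▸ z ▸ w′ ▸ w) 2F 3F 0F 1F C same

    level⁻-complete : ∀ {k} (e : Env k) j y y* {z′ z w′ w} → Path E₁ z′ (toℕ (ρ e j)) (ρ e y) → Path E₁ w′ (toℕ (ρ e j)) (ρ e y*) →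
                      T (E₁ z z′) → T (E₁ w w′) → EitherComparable t z z′ w w′ → ¬ SameHangs z z′ w w′ → e ⊨ (λ o l → level⁻ o l j y y*)
    level⁻-complete e j y y* {z′} {z} {w′} {w} q q* d d* C ¬same = z′ , z , w′ , w ,
      dist-complete (e ▸ z′ ▸ z ▸ w′ ▸ w) 3F (s₄ y) (s₄ j) q , dist-complete (e ▸ z′ ▸ z ▸ w′ ▸ w) 1F (s₄ y*) (s₄ j) q* ,
      (d , d*) , hangs⁻-complete (e ▸ z′ ▸ z ▸ w′ ▸ w) 2F 3F 0F 1F C ¬same

    step-up : ∀ {j k x y} → j < k → Path E₁ x k y → Σ (Fin N) λ z′ → Σ (Fin N) λ z → Path E₁ z′ j y × T (E₁ z z′)
    step-up j<k p with suffix j<k p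
    ... | z , (_∷_ {z = z′} d q) = z′ , z , q , d

    same? : ∀ z z′ w w′ → Dec (SameHangs z z′ w w′)
    same? z z′ w w′ = map′ matching⇒ ⇒matching (matching? z z′ w w′)

    module _ {k} (e : Env k) (x x* : Fin k) (P : PathComparable t (ρ e x) (ρ e x*)) where
      open PathComparable P renaming (k to len)

      K : Fin N
      K = fromℕ< (path-length path)

      K≡ : toℕ K ≡ len
      K≡ = toℕ-fromℕ< (path-length path)

      at-K : ∀ {x y} → Path E₁ x len y → Path E₁ x (toℕ K) y
      at-K {x} {y} = subst (λ i → Path E₁ x i y) (sym K≡)

      along⁺-level : ∀ {y*} → Path E₁ (ρ e x*) len y* → (∀ j → j < len → Level j y y*) → ∀ j → toℕ j < toℕ K →
                     (e ▸ y ▸ y* ▸ K ▸ j) ⊨ (λ o l → level⁺ o l 0F 3F 2F)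
      along⁺-level {y*} p* lev j j<K = use (lev (toℕ j) j<k)
        where
        j<k : toℕ j < len
        j<k = ≤-trans j<K (≤-reflexive K≡)
        use : Level (toℕ j) y y* → (e ▸ y ▸ y* ▸ K ▸ j) ⊨ (λ o l → level⁺ o l 0F 3F 2F)
        use (z′ , z , w′ , w , q , q* , d , d* , same) =
          level⁺-complete (e ▸ y ▸ y* ▸ K ▸ j) 0F 3F 2F q q* d d* (levels p* j<k q q* d d*) same

      along⁺-complete : code E₁ (ρ e x) ≡ code E₁ (ρ e x*) → e ⊨ (λ o l → along⁺ o l x x*)
      along⁺-complete c = use (descend c path)
        where
        use : (Σ (Fin N) λ y* → Path E₁ (ρ e x*) len y* × code E₁ y ≡ code E₁ y* × (∀ j → j < len → Level j y y*)) →
              e ⊨ (λ o l → along⁺ o l x x*)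
        use (y* , p* , cy , lev) = y , y* , K , dist-complete e₃ (s₃ x) 2F 0F (at-K path) , dist-complete e₃ (s₃ x*) 1F 0F (at-K p*) ,
          hangs⁺-complete e₃ 2F 2F 1F 1F (end p*) (code⇒hangs cy) ,
          λ j → Data.Sum.map id (along⁺-level p* lev j) (≤-<-connex (toℕ K) (toℕ j))
          where e₃ = e ▸ y ▸ y* ▸ K

      module _ (c≢ : code E₁ (ρ e x) ≢ code E₁ (ρ e x*)) {y* : Fin N} {k*} (p* : Path E₁ (ρ e x*) k* y*) where
        K* : Fin N
        K* = fromℕ< (path-length p*)

        K*≡ : toℕ K* ≡ k*
        K*≡ = toℕ-fromℕ< (path-length p*)

        e₄ : Env (4 + k)
        e₄ = e ▸ y ▸ K ▸ y* ▸ K*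

        Differ : Set
        Differ = e₄ ⊨ (λ o l → lit (neg (eqF 0F 2F)) or hangs⁻ o l 3F 3F 1F 1F or
                               some (lit (ltF 0F 3F) and level⁻ (suc o) (suc l) 0F 4F 2F))

        level-differs : k* ≡ len → (Σ ℕ λ j → j < len × Mismatch j y y*) → Differ
        level-differs refl (j , j<k , z′ , z , w′ , w , q , q* , d , d* , ¬s) = inj₂ (inj₂ (fromℕ< j<N ,
            <⇒≱ (≤-trans (s≤s (≤-reflexive j≡)) (≤-trans j<k (≤-reflexive (sym K≡)))) ,
            level⁻-complete (e₄ ▸ fromℕ< j<N) 0F 4F 2F (at-j q) (at-j q*) d d* (levels p* j<k q q* d d*) ¬s))
          where
          j<N : j < N
          j<N = path-length q
          j≡ : toℕ (fromℕ< j<N) ≡ j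
          j≡ = toℕ-fromℕ< j<N
          at-j : ∀ {x y} → Path E₁ x j y → Path E₁ x (toℕ (fromℕ< j<N)) y
          at-j {x} {y} = subst (λ i → Path E₁ x i y) (sym j≡)

        levelOr : k* ≡ len → ∀ j → j < len → Level j y y* ⊎ Mismatch j y y*
        levelOr refl j j<k with step-up j<k path | step-up j<k p*
        ... | z′ , z , q , d | w′ , w , q* , d* with same? z z′ w w′
        ...   | yes s = inj₁ (z′ , z , w′ , w , q , q* , d , d* , s)
        ...   | no ¬s = inj₂ (z′ , z , w′ , w , q , q* , d , d* , ¬s)

        no-levels : k* ≡ len → SameHangs y y y* y* → (∀ j → j < len → Level j y y*) → ⊥
        no-levels refl same all-levels = c≢ (ascend path p* (hangs⇒code same) all-levels)

        -- With equal lengths, equal children of the ends and no differing level, `ascend` would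
        -- make the codes equal. A search over the finitely many levels thus finds a mismatch.
        differ : Differ
        differ = by-length (k* ≟ℕ len)
          where
          by-hangs : k* ≡ len → Dec (SameHangs y y y* y*) → Differ
          by-hangs refl (no ¬same) = inj₂ (inj₁ (hangs⁻-complete e₄ 3F 3F 1F 1F (end p*) ¬same))
          by-hangs eq (yes same) = [ ⊥-elim ∘ no-levels eq same , level-differs eq ] (search len (levelOr eq))
          by-length : Dec (k* ≡ len) → Differ
          by-length (no k*≢k) = inj₁ (≢⇒¬≤ λ eq → k*≢k (trans (sym K*≡) (trans (cong toℕ eq) K≡)))
          by-length (yes eq) = by-hangs eq (same? y y y* y*)

        at-K* : Path E₁ (ρ e x*) (toℕ K*) y*
        at-K* = subst (λ i → Path E₁ (ρ e x*) i y*) (sym K*≡) p*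

        Found : Set
        Found = Σ (Fin N) λ d → S t (λ i → ρ (e ▸ y ▸ K ▸ y* ▸ d) (distArgs (s₄ (o e)) (s₄ (l e)) (s₄ x*) 1F 0F i)) ×
          ((e ▸ y ▸ K ▸ y* ▸ d) ⊨ (λ o l → lit (neg (eqF 0F 2F)) or hangs⁻ o l 3F 3F 1F 1F or
                               some (lit (ltF 0F 3F) and level⁻ (suc o) (suc l) 0F 4F 2F)))

        found : Found
        found = K* , dist-complete e₄ (s₄ x*) 1F 0F at-K* , differ

      along⁻-complete : code E₁ (ρ e x) ≢ code E₁ (ρ e x*) → e ⊨ (λ o l → along⁻ o l x x*)
      along⁻-complete c≢ = y , K , dist-complete (e ▸ y ▸ K) (s₂ x) 1F 0F (at-K path) , λ y* → other y* (reach? (ρ e x*) y*)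
        where
        other : ∀ y* → Dec (Σ ℕ λ k → Path E₁ (ρ e x*) k y*) →
                ((e ▸ y ▸ K ▸ y*) ⊨ (λ o l → unreachable o l (s₃ x*) 0F)) ⊎ _
        other y* (no none) = inj₁ (unreachable-complete (e ▸ y ▸ K ▸ y*) (s₃ x*) 0F (λ p → none (_ , p)))
        other y* (yes (k* , p*)) = inj₂ (found c≢ p*)

    isoRule-complete : ∀ {x y} → PathComparable t x y ⊎ PathComparable t y x ⊎ (Light x × Light y) → ComparedAt (suc t) x y
    isoRule-complete {x} {y} cases = yes-case cases , no-case cases
      where
      light-iso : ∀ g → toℕ (g 6F) ≡ 0 → toℕ (g 7F) ≡ 0 → Judgement E₀ 0 0 (g 0F) (g 1F) bot bot bot bot → A 0F (λ i → ρ (baseEnv g) (isoArgs 1F 0F 2F 3F i))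
      light-iso g p q c = A-complete _ (subst (λ p → Judgement E₀ p p (g 0F) (g 1F) bot bot bot bot) (sym bot≡0) c)
      yes-case : _ → code E₁ x ≡ code E₁ y → IsoAt (suc t) x y
      yes-case cases c g refl refl p q = derive (bot , top , bounds g , inj₁ ((eqF-bot p , eqF-bot q) , rule cases))
        where
        rule : _ → baseEnv g ⊨ (λ o l → isoRule o l 2F 3F)
        rule (inj₁ P) = inj₂ (inj₁ (along⁺-complete (baseEnv g) 2F 3F P c))
        rule (inj₂ (inj₁ P)) = inj₂ (inj₂ (along⁺-complete (baseEnv g) 3F 2F P (sym c)))
        rule (inj₂ (inj₂ (lx , ly))) = inj₁ (light-complete (baseEnv g) 2F lx , light-complete (baseEnv g) 3F ly ,
          light-iso g p q (trans (light-code lx) (trans c (sym (light-code ly)))))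
      no-case : _ → code E₁ x ≢ code E₁ y → NonIsoAt (suc t) x y
      no-case cases c≢ g refl refl p q = derive (bot , top , bounds g , inj₂ (inj₁ ((eqF-bot p , neF-bot q) , rule cases)))
        where
        rule : _ → baseEnv g ⊨ (λ o l → nisoRule o l 2F 3F)
        rule (inj₁ P) = inj₂ (inj₁ (along⁻-complete (baseEnv g) 2F 3F P c≢))
        rule (inj₂ (inj₁ P)) = inj₂ (inj₂ (along⁻-complete (baseEnv g) 3F 2F P (c≢ ∘ sym)))
        rule (inj₂ (inj₂ (lx , ly))) = inj₁ (light-complete (baseEnv g) 2F lx , light-complete (baseEnv g) 3F ly ,
          λ a → c≢ (trans (sym (light-code lx)) (trans (Stored.iso-sound (baseEnv g) 2F 3F a) (light-code ly))))

    -- Weight 0 over the interval means that no edge from `z` into it changed and that its children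
    -- are light, so stored counts apply to it.
    quiet-complete : ∀ {z z′ u lo hi} → sumIn (childWeight z) lo hi ≡ 0 → (∀ b → In lo hi b → T (E₁ z b) → b ≢ z′) →
                     (∀ b → In lo hi b → T (E₁ z b) → ComparedAt t u b) → CountedAt (suc t) z z′ u lo hi
    quiet-complete {z} {z′} {u} {lo} {hi} no-weight ≢z′ compared g refl refl refl refl refl ec p q =
      derive (bot , top , bounds g , inj₂ (inj₂ (inj₂ ((neF-bot p , neF-bot q) , inj₁ ((λ b → quiet-here b (in? lo hi b)) ,
        by-class (any? λ b → in? lo hi b ×-dec T? (E₁ z b) ×-dec (code E₁ u ≟ℕ code E₁ b)))))))
      where
      e : Env 10
      e = baseEnv g
      child≡0 : ∀ b → In lo hi b → childWeight z b ≡ 0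
      child≡0 b i = n≤0⇒n≡0 (≤-trans (term≤sumIn (childWeight z) i) (≤-reflexive no-weight))
      same : ∀ b → In lo hi b → E₀ z b ≡ E₁ z b
      same b i = diff≡0 (n≤0⇒n≡0 (≤-trans (m≤m+n _ _) (≤-reflexive (child≡0 b i))))
      child-light : ∀ b → In lo hi b → T (E₁ z b) → Light b
      child-light b i d = weight≡0⇒light (n≤0⇒n≡0 (≤-trans (child-weight d) (≤-reflexive (child≡0 b i))))
      quiet : Quiet z z′ lo hi
      quiet b i = same b i , λ d → ≢z′ b i d , light-code (child-light b i d)
      quiet-child : ∀ b → In lo hi b → Dec (T (E₁ z b)) →
                    (e ▸ b) ⊨ (λ o l → lit (neg (inp 3F 0F)) or (lit (neg (eqF 0F 4F)) and light o l 0F))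
      quiet-child b i (no ¬d) = inj₁ ¬d
      quiet-child b i (yes d) = inj₂ (≢⇒¬≤ (≢z′ b i d) , light-complete (e ▸ b) 0F (child-light b i d))
      quiet-here : ∀ b → Dec (In lo hi b) → (e ▸ b) ⊨ (λ o l → lit (neg (inF 6F 7F 0F)) or
                     (lit (sameF 3F 0F) and (lit (neg (inp 3F 0F)) or (lit (neg (eqF 0F 4F)) and light o l 0F))))
      quiet-here b (no ¬i) = inj₁ ¬i
      quiet-here b (yes i) = inj₂ (sameF-⇐ (ext b (ρ e)) 3F 0F (same b i) , quiet-child b i (T? (E₁ z b)))
      Class : Fin N → Set
      Class b = In lo hi b × T (E₁ z b) × code E₁ u ≡ code E₁ b
      none-here : ¬ Σ (Fin N) Class → ∀ b → Dec (In lo hi b) → Dec (T (E₁ z b)) →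
                  (e ▸ b) ⊨ (λ o l → lit (neg (inF 6F 7F 0F)) or lit (neg (inp 3F 0F)) or rec (nisoArgs o l 5F 0F))
      none-here none b (no ¬i) _ = inj₁ ¬i
      none-here none b (yes i) (no ¬d) = inj₂ (inj₁ ¬d)
      none-here none b (yes i) (yes d) = inj₂ (inj₂ (niso-complete (e ▸ b) 5F 0F (proj₂ (compared b i d) λ c → none (b , i , d , c))))
      by-class : Dec (Σ (Fin N) Class) → e ⊨ (λ o l →
        some (lit (conj (inF 6F 7F 0F) (conj (inp 3F 0F) (aux 0F (countArgs (suc o) (suc l) 3F 3F 0F 6F 7F 8F)))) and rec (isoArgs (suc o) (suc l) 5F 0F))
        or (lit (zeroF 7F) and every (lit (neg (inF 6F 7F 0F)) or lit (neg (inp 3F 0F)) or rec (nisoArgs (suc o) (suc l) 5F 0F))))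
      by-class (yes (b , i , d , c)) = inj₁ (b , (i , d , A-complete _ stored) , iso-complete (e ▸ b) 5F 0F (proj₁ (compared b i d) c))
        where
        stored : Judgement E₀ (toℕ top) (toℕ top) z z b lo hi (g 5F)
        stored = subst (λ p → Judgement E₀ p p z z b lo hi (g 5F)) (sym top≡suc)
          (trans (sym (quiet-count quiet (trans c (sym (light-code (child-light b i d)))))) (sym ec))
      by-class (no none) = inj₂ (zeroF-⇐ (ρ e) 7F (trans ec (sumIn-≡0 λ b i → 𝟙-no (hangOf? E₁ z z′ (code E₁ u) b)
        λ { ((d , _) , c) → none (b , i , d , sym c) })) , λ b → none-here none b (in? lo hi b) (T? (E₁ z b)))

  dist-constant : ∀ {t x k y} → Path E₁ x k y → weight x ≡ weight y → DistAt (suc t) x k y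
  dist-constant {t} {x} {k} {y} path eq g refl refl refl p q =
    derive (bot , top , bounds g , inj₂ (inj₂ (inj₁ ((neF-bot p , eqF-bot q) , inj₁ (A-complete _ stored , intact)))))
    where
    e : Env 10
    e = baseEnv g
    stored : Judgement E₀ (toℕ top) (toℕ bot) x y (g 2F) bot bot bot
    stored = subst₂ (λ p q → Judgement E₀ p q x y (g 2F) bot bot bot) (sym top≡suc) (sym bot≡0) (constant⇒old path eq)
    intact : ⟦ intactF 1F 0F 2F 3F ⟧ 𝒮 (ρ e)
    intact u v (a , (d , r) , (d′ , s) , ¬f) = ¬f (constant⇒intact path eq u v (A-edge _ a)
      (toℕ d , Stored.dist-sound (e ▸ u ▸ v ▸ d) 5F 2F 0F r) (toℕ d′ , Stored.dist-sound (e ▸ u ▸ v ▸ d′) 1F 6F 0F s))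

  dist-join : ∀ {t x u v y k₁ k₂} → Path E₁ x k₁ u → T (E₁ u v) → Path E₁ v k₂ y →
              DistAt t x k₁ u → DistAt t v k₂ y → DistAt (suc t) x (suc (k₁ + k₂)) y
  dist-join {t} {x} {u} {v} {y} {k₁} {k₂} p d q hp hq g refl refl ek tp tq =
    derive (bot , top , bounds g , inj₂ (inj₂ (inj₁ ((neF-bot tp , eqF-bot tq) , inj₂ (u , v , K₁ , K₂ , K ,
      (d , trans (cong₂ _+_ K₁≡ K₂≡) (sym K≡) , succF-⇐ (ρ e) 0F 9F (trans ek (cong suc (sym K≡)))) ,
      hp _ refl refl K₁≡ (top≢0 e) (o≡0 e) , hq _ refl refl K₂≡ (top≢0 e) (o≡0 e))))))
    where
    k<N : k₁ + k₂ < N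
    k<N = ≤-trans (n≤1+n _) (subst (_< N) (+-suc k₁ k₂) (path-length (append p (d ∷ q))))
    K₁ = fromℕ< (path-length p)
    K₁≡ = toℕ-fromℕ< (path-length p)
    K₂ = fromℕ< (path-length q)
    K₂≡ = toℕ-fromℕ< (path-length q)
    K = fromℕ< k<N
    K≡ = toℕ-fromℕ< k<N
    e : Env 15
    e = baseEnv g ▸ u ▸ v ▸ K₁ ▸ K₂ ▸ K

  split-complete : ∀ {t z z′ u lo m m′ hi} → toℕ lo ≤ toℕ m → toℕ m′ ≡ suc (toℕ m) → toℕ m′ ≤ toℕ hi →
                   CountedAt t z z′ u lo m → CountedAt t z z′ u m′ hi → CountedAt (suc t) z z′ u lo hi
  split-complete {t} {z} {z′} {u} {lo} {m} {m′} {hi} l e h left right g refl refl refl refl refl ec p q =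
    derive (bot , top , bounds g , inj₂ (inj₂ (inj₂ ((neF-bot p , neF-bot q) , inj₂ (inj₁ (m , m′ , K₁ , K₂ ,
      (l , succF-⇐ (ρ e′) 3F 2F e , h , trans (cong₂ _+_ K₁≡ K₂≡) (sym (trans ec total))) ,
      left _ refl refl refl refl refl K₁≡ (top≢0 e′) (top≢0 e′) , right _ refl refl refl refl refl K₂≡ (top≢0 e′) (top≢0 e′)))))))
    where
    k₁<N = hangsIn<N z z′ (code E₁ u) lo m
    k₂<N = hangsIn<N z z′ (code E₁ u) m′ hi
    K₁ = fromℕ< k₁<N
    K₁≡ = toℕ-fromℕ< k₁<N
    K₂ = fromℕ< k₂<N
    K₂≡ = toℕ-fromℕ< k₂<N
    e′ : Env 14
    e′ = baseEnv g ▸ m ▸ m′ ▸ K₁ ▸ K₂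
    total : hangsIn E₁ z z′ (code E₁ u) lo hi ≡ hangsIn E₁ z z′ (code E₁ u) lo m + hangsIn E₁ z z′ (code E₁ u) m′ hi
    total = sumIn-split (λ b → 𝟙 (hangOf? E₁ z z′ (code E₁ u) b)) l e h

  leaf-complete : ∀ {t z z′ u a} → (Hang E₁ z z′ a → ComparedAt t u a) → CountedAt (suc t) z z′ u a a
  leaf-complete {t} {z} {z′} {u} {a} compared g refl refl refl refl a≡ ec p q =
    derive (bot , top , bounds g , inj₂ (inj₂ (inj₂ ((neF-bot p , neF-bot q) , inj₂ (inj₂ (
      (≤-reflexive (cong toℕ (sym a≡)) , ≤-reflexive (cong toℕ a≡)) , by-hang (hang? E₁ z z′ a) (code E₁ u ≟ℕ code E₁ a)))))))
    where
    e : Env 10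
    e = baseEnv g
    value≡ : toℕ (g 5F) ≡ 𝟙 (hangOf? E₁ z z′ (code E₁ u) a)
    value≡ = trans ec (sumIn-single (λ b → 𝟙 (hangOf? E₁ z z′ (code E₁ u) b)) a)
    by-hang : Dec (Hang E₁ z z′ a) → Dec (code E₁ u ≡ code E₁ a) → pos (lit (conj (neg (hangF 2F 3F 5F)) (zeroF 7F)) or
      (lit (hangF 2F 3F 5F) and ((lit (succF 1F 7F) and rec (isoArgs 1F 0F 4F 5F)) or (lit (zeroF 7F) and rec (nisoArgs 1F 0F 4F 5F))))) 𝒮 (S t) (ρ e)
    by-hang (no ¬h) _ = inj₁ ((λ { (d , a≢) → ¬h (d , ¬≤⇒≢ a≢) }) , zeroF-⇐ (ρ e) 7F
      (trans value≡ (𝟙-no (hangOf? E₁ z z′ (code E₁ u) a) (¬h ∘ proj₁))))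
    by-hang (yes h) (yes c) = inj₂ ((proj₁ h , ≢⇒¬≤ (proj₂ h)) , inj₁ (succF-⇐ (ρ e) 1F 7F
      (trans value≡ (trans (𝟙-yes (hangOf? E₁ z z′ (code E₁ u) a) (h , sym c)) (cong suc (sym bot≡0)))) ,
      proj₁ (compared h) c _ refl refl (o≡0 e) (o≡0 e)))
    by-hang (yes h) (no c≢) = inj₂ ((proj₁ h , ≢⇒¬≤ (proj₂ h)) , inj₂ (zeroF-⇐ (ρ e) 7F
      (trans value≡ (𝟙-no (hangOf? E₁ z z′ (code E₁ u) a) (c≢ ∘ sym ∘ proj₂))) ,
      proj₂ (compared h) c≢ _ refl refl (o≡0 e) (top≢0 e)))

  -- One round for the single position `a` and at most one for joining each side.
  around-complete : ∀ {t z z′ u lo hi a} → In lo hi a →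
    (∀ m → toℕ a ≡ suc (toℕ m) → toℕ lo ≤ toℕ m → CountedAt t z z′ u lo m) →
    (∀ m → toℕ m ≡ suc (toℕ a) → toℕ m ≤ toℕ hi → CountedAt t z z′ u m hi) →
    (Hang E₁ z z′ a → ComparedAt t u a) → CountedAt (3 + t) z z′ u lo hi
  around-complete {t} {z} {z′} {u} {lo} {hi} {a} (lo≤a , a≤hi) left right compared = from-left (toℕ a ≤? toℕ lo)
    where
    from-a : Dec (toℕ hi ≤ toℕ a) → CountedAt (2 + t) z z′ u a hi
    from-a (yes hi≤a) = subst (CountedAt (2 + t) z z′ u a) (toℕ-injective (≤-antisym a≤hi hi≤a))
      (counted-mono (n≤1+n (suc t)) (leaf-complete compared))
    from-a (no hi≰a) = cut (successor {a = a} {hi} (≰⇒> hi≰a))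
      where
      cut : (Σ (Fin N) λ m → toℕ m ≡ suc (toℕ a)) → CountedAt (2 + t) z z′ u a hi
      cut (m , e) = split-complete ≤-refl e m≤hi (leaf-complete compared) (counted-mono (n≤1+n t) (right m e m≤hi))
        where m≤hi = ≤-trans (≤-reflexive e) (≰⇒> hi≰a)
    whole-right : CountedAt (2 + t) z z′ u a hi
    whole-right = from-a (toℕ hi ≤? toℕ a)
    from-left : Dec (toℕ a ≤ toℕ lo) → CountedAt (3 + t) z z′ u lo hi
    from-left (yes a≤lo) = subst (λ b → CountedAt (3 + t) z z′ u b hi) (toℕ-injective (≤-antisym a≤lo lo≤a))
      (counted-mono (n≤1+n (2 + t)) whole-right)
    from-left (no a≰lo) = cut (predecessor {lo = lo} {a} (≰⇒> a≰lo))
      where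
      cut : (Σ (Fin N) λ m → toℕ a ≡ suc (toℕ m)) → CountedAt (3 + t) z z′ u lo hi
      cut (m , e) = split-complete lo≤m e a≤hi (counted-mono (≤-trans (n≤1+n t) (n≤1+n (suc t))) (left m e lo≤m)) whole-right
        where lo≤m = s≤s⁻¹ (≤-trans (≰⇒> a≰lo) (≤-reflexive e))

  -- Rounds needed under bounds on the weights

  double : ∀ i → 2 ^ suc i ≡ 2 ^ i + 2 ^ i
  double i = cong (2 ^ i +_) (+-identityʳ (2 ^ i))

  -- Each cut halves the bound on the excess of the upper weight over the lower one. With bound 1
  -- the weight is constant, and the path is an intact old path.
  dist-known : ∀ i {x k y} → Path E₁ x k y → weight x < weight y + 2 ^ i → DistAt (suc i) x k y
  dist-known zero {x} {k} {y} p bound = dist-constant p (≤-antisym (s≤s⁻¹ (≤-trans bound (≤-reflexive (+-comm (weight y) 1)))) (weight-path p))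
  dist-known (suc i) {x} {k} {y} p bound = by-weight (weight y + 2 ^ i ≤? weight x)
    where
    join : SplitPath x k y (2 ^ i) → DistAt (2 + i) x k y
    join sp = subst (λ k → DistAt (2 + i) x k y) total
        (dist-join first edge second (dist-known i first first-light) (dist-known i second second-light))
      where open SplitPath sp
    by-weight : Dec (weight y + 2 ^ i ≤ weight x) → DistAt (2 + i) x k y
    by-weight (no light) g a b c d e = stage-mono (n≤1+n (suc i)) g (dist-known i p (≰⇒> light) g a b c d e)
    by-weight (yes heavy) = join (split-path (2 ^ i) (m^n>0 2 i) p (subst (λ h → weight x < weight y + h) (double i) bound) heavy)

  module Bounded (r : ℕ) (bounded : ∀ x → weight x < 2 ^ r) where

    all-dists : DistsAt (suc r)
    all-dists x k y p = dist-known r p (≤-trans (bounded x) (m≤n+m (2 ^ r) (weight y)))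

    -- Distances take `suc r` rounds and light trees one more. One unit of the measure then costs 7
    -- rounds: 3 to go from comparisons to counts over intervals without `z′`, 3 to assemble counts
    -- over all children, 1 to apply the comparison rule.
    isoStage countStage : ℕ → ℕ
    isoStage zero = 2 + r
    isoStage (suc ϱ) = 7 + isoStage ϱ
    countStage ϱ = 3 + isoStage ϱ

    dists≤isoStage : ∀ ϱ → suc r ≤ isoStage ϱ
    dists≤isoStage zero = n≤1+n (suc r)
    dists≤isoStage (suc ϱ) = ≤-trans (dists≤isoStage ϱ) (m≤n+m _ 7)

    -- In `CountKnown` the interval takes the place of one of the trees. Its last hypothesis keeps
    -- the path child `z′`, which may be heavy, out of the interval, as `quietRule` demands.
    IsoKnown CountKnown : ℕ → Set
    IsoKnown ϱ = ∀ i j {x y} → i + j ≤ ϱ → weight x < 2 ^ i → weight y < 2 ^ j → ComparedAt (isoStage ϱ) x y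
    CountKnown ϱ = ∀ i j {z z′ u lo hi} → i + j ≤ ϱ → sumIn (childWeight z) lo hi < 2 ^ i → weight u < 2 ^ j →
                   (∀ b → In lo hi b → T (E₁ z b) → b ≢ z′) → CountedAt (countStage ϱ) z z′ u lo hi

    count-quiet : ∀ ϱ → IsoKnown ϱ → ∀ j {z z′ u lo hi} → j ≤ ϱ → sumIn (childWeight z) lo hi ≡ 0 → weight u < 2 ^ j →
                  (∀ b → In lo hi b → T (E₁ z b) → b ≢ z′) → CountedAt (countStage ϱ) z z′ u lo hi
    count-quiet ϱ iso j {z} {z′} {u} {lo} {hi} j≤ no-weight u-light ≢z′ = counted-mono (m≤n+m _ 2)
      (Step.quiet-complete (isoStage ϱ) (dists-mono (dists≤isoStage ϱ) all-dists) no-weight ≢z′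
        λ b i d → iso j 0 (≤-trans (≤-reflexive (+-identityʳ j)) j≤) u-light (s≤s (≤-trans (child-weight d)
          (≤-trans (term≤sumIn (childWeight z) i) (≤-reflexive no-weight)))))

    count-around : ∀ {ϱ t} → CountKnown ϱ →
      ∀ i j {z z′ u lo hi a} → i + j ≤ ϱ → weight u < 2 ^ j → In lo hi a →
      (∀ m → toℕ a ≡ suc (toℕ m) → toℕ lo ≤ toℕ m → sumIn (childWeight z) lo m < 2 ^ i) →
      (∀ m → toℕ m ≡ suc (toℕ a) → toℕ m ≤ toℕ hi → sumIn (childWeight z) m hi < 2 ^ i) →
      (∀ b → In lo hi b → b ≢ a → T (E₁ z b) → b ≢ z′) →
      countStage ϱ ≤ t → (Hang E₁ z z′ a → ComparedAt t u a) → CountedAt (3 + t) z z′ u lo hi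
    count-around count i j {z} {z′} {u} {lo} {hi} {a} ij≤ u-light a∈ left right ≢z′ c≤t compared =
      around-complete a∈
        (λ m e l → counted-mono c≤t (count i j ij≤ (left m e l) u-light λ b b∈ → ≢z′ b (proj₁ b∈ , ≤-trans (proj₂ b∈) (≤-trans (n≤1+n _) (≤-trans (≤-reflexive (sym e)) (proj₂ a∈))))
          (λ { refl → <-irrefl refl (≤-trans (≤-reflexive (sym e)) (proj₂ b∈)) })))
        (λ m e l → counted-mono c≤t (count i j ij≤ (right m e l) u-light λ b b∈ → ≢z′ b (≤-trans (proj₁ a∈) (≤-trans (n≤1+n _) (≤-trans (≤-reflexive (sym e)) (proj₁ b∈))) , proj₂ b∈)
          (λ { refl → <-irrefl refl (≤-trans (≤-reflexive (sym e)) (proj₁ b∈)) })))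
        compared

    -- Both sides of the centre have the smaller exponent `i`, but the child at the centre may keep
    -- the full weight. Its comparison with `u` therefore uses `IsoKnown` at `suc ϱ`.
    count-step : ∀ ϱ → IsoKnown (suc ϱ) → CountKnown ϱ → CountKnown (suc ϱ)
    count-step ϱ iso count zero j {z} ij≤ light u-light ≢z′ = count-quiet (suc ϱ) iso j ij≤ (n≤0⇒n≡0 (s≤s⁻¹ light)) u-light ≢z′
    count-step ϱ iso count (suc i) j {z} {z′} {u} {lo} {hi} ij≤ light u-light ≢z′ = by-order (toℕ lo ≤? toℕ hi)
      where
      by-order : Dec (toℕ lo ≤ toℕ hi) → CountedAt (countStage (suc ϱ)) z z′ u lo hi
      by-order (no lo≰hi) = count-quiet (suc ϱ) iso j (≤-trans (m≤n+m j (suc i)) ij≤)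
        (sumIn-≡0 λ b b∈ → ⊥-elim (lo≰hi (≤-trans (proj₁ b∈) (proj₂ b∈)))) u-light ≢z′
      by-order (yes lo≤hi) = cut (centre (childWeight z) (2 ^ i) lo≤hi (≤-trans light (≤-reflexive (double i))))
        where
        cut : (Σ (Fin N) λ a → In lo hi a × (∀ m → toℕ a ≡ suc (toℕ m) → toℕ lo ≤ toℕ m → sumIn (childWeight z) lo m < 2 ^ i)
                × (∀ m → toℕ m ≡ suc (toℕ a) → toℕ m ≤ toℕ hi → sumIn (childWeight z) m hi < 2 ^ i)) → CountedAt (countStage (suc ϱ)) z z′ u lo hi
        cut (a , a∈ , left , right) = count-around count i j (s≤s⁻¹ ij≤) u-light a∈ left right (λ b b∈ _ → ≢z′ b b∈)
          (m≤n+m _ 4) λ h → iso j (suc i) (≤-trans (≤-reflexive (+-comm j (suc i))) ij≤) u-light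
            (≤-<-trans (≤-trans (child-weight (proj₁ h)) (term≤sumIn (childWeight z) a∈)) light)

    -- A position `a` that leaves little weight on either side while all hanging children are light.
    -- In use, `a` is either `z′`, where nothing is counted, or the centre of the children when `z′`
    -- is `z`.
    record Split (i : ℕ) (z z′ : Fin N) : Set where
      field
        a : Fin N
        left : ∀ m → toℕ a ≡ suc (toℕ m) → toℕ bot ≤ toℕ m → sumIn (childWeight z) bot m < 2 ^ i
        right : ∀ m → toℕ m ≡ suc (toℕ a) → toℕ m ≤ toℕ top → sumIn (childWeight z) m top < 2 ^ i
        except : ∀ b → In bot top b → b ≢ a → T (E₁ z b) → b ≢ z′
        hanging : ∀ b → Hang E₁ z z′ b → weight b < 2 ^ i

    count-total : ∀ {ϱ} → IsoKnown ϱ → CountKnown ϱ → ∀ i j {z z′ u} → i + j ≤ ϱ → Split i z z′ → weight u < 2 ^ j →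
                  CountedAt (3 + countStage ϱ) z z′ u bot top
    count-total {ϱ} iso count i j ij≤ sp u-light = count-around count i j ij≤ u-light (all-in a) left right except ≤-refl
        λ h → compared-mono (m≤n+m _ 3) (iso j i (≤-trans (≤-reflexive (+-comm j i)) ij≤) u-light (hanging a h))
      where open Split sp

    comparable : ∀ {ϱ} → IsoKnown ϱ → CountKnown ϱ → ∀ i j {z z′ w w′} → i + i ≤ ϱ → i + j ≤ ϱ → Split i z z′ → Split j w w′ →
                 Comparable (3 + countStage ϱ) z z′ w w′
    comparable iso count i j ii≤ ij≤ sp sp′ = record
      { countˡ = λ u h → count-total iso count i i ii≤ sp (Split.hanging sp u h)
      ; countʳ = λ u h → count-total iso count j i (≤-trans (≤-reflexive (+-comm j i)) ij≤) sp′ (Split.hanging sp u h)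
      ; compare = λ u b hu hb → compared-mono (m≤n+m _ 6) (iso i j ij≤ (Split.hanging sp u hu) (Split.hanging sp′ b hb)) }

    split-by-total : ∀ i z z′ → (∀ b → b ≢ z′ → T (E₁ z b) → weight b < 2 ^ i) →
                     (∀ lo hi → ¬ In lo hi z′ → sumIn (childWeight z) lo hi < 2 ^ i) → Split i z z′
    split-by-total i z z′ light sums = record
      { a = z′
      ; left = λ m e _ → sums bot m λ { (_ , z′≤m) → <-irrefl refl (≤-trans (≤-reflexive (sym e)) z′≤m) }
      ; right = λ m e _ → sums m top λ { (m≤z′ , _) → <-irrefl refl (≤-trans (≤-reflexive (sym e)) m≤z′) }
      ; except = λ b _ b≢z′ _ → b≢z′
      ; hanging = λ b h → light b (proj₂ h) (proj₁ h) }

    split-light : ∀ i z z′ → weight z < 2 ^ i → Split i z z′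
    split-light i z z′ light = split-by-total i z z′ (λ b _ d → ≤-<-trans (weight-child d) light)
      (λ lo hi _ → ≤-<-trans (≤-trans (sumIn≤sum (childWeight z) lo hi) (childWeights≤weight z)) light)

    split-heavy-child : ∀ i z z′ → sum (childWeight z) < childWeight z z′ + 2 ^ i → Split i z z′
    split-heavy-child i z z′ bound = split-by-total i z z′
      (λ b b≢z′ d → ≤-<-trans (child-weight d) (+-cancelˡ-< (childWeight z z′) _ _
        (≤-<-trans (two-terms≤sum (childWeight z) z′ b (b≢z′ ∘ sym)) bound)))
      (λ lo hi z′∉ → +-cancelˡ-< (childWeight z z′) _ _
        (≤-<-trans (≤-trans (≤-reflexive (+-comm (childWeight z z′) _)) (sumIn+term≤sum (childWeight z) z′∉)) bound))

    split-centre : ∀ i z → weight z < 2 ^ suc i → (∀ b → T (E₁ z b) → weight b < 2 ^ i) → Split i z z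
    split-centre i z bound light = at (centre (childWeight z) (2 ^ i) (≤-trans (≤-reflexive bot≡0) z≤n)
        (≤-trans (≤-<-trans (≤-trans (sumIn≤sum (childWeight z) bot top) (childWeights≤weight z)) bound) (≤-reflexive (double i))))
      where
      at : (Σ (Fin N) λ a → In bot top a × (∀ m → toℕ a ≡ suc (toℕ m) → toℕ bot ≤ toℕ m → sumIn (childWeight z) bot m < 2 ^ i)
                × (∀ m → toℕ m ≡ suc (toℕ a) → toℕ m ≤ toℕ top → sumIn (childWeight z) m top < 2 ^ i)) → Split i z z
      at (a , _ , left , right) = record { a = a ; left = left ; right = right ; except = λ b _ _ d → no-loop d ; hanging = λ b h → light b (proj₁ h) }

    -- x is the side with the larger bound. Classes are represented by hanging children of
    -- the path in x if both bounds agree, and of the path in y otherwise: this is what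
    -- keeps the sum of the bounds of any two compared trees below i + j.
    path-comparable : ∀ {ϱ} → IsoKnown ϱ → CountKnown ϱ → ∀ i j {x y} → i + j ≤ ϱ → j ≤ suc i → weight x < 2 ^ suc i → weight y < 2 ^ j →
                      PathComparable (3 + countStage ϱ) x y
    path-comparable {ϱ} iso count i j {x} {x*} ij≤ j≤ x-light x*-light = build (heavy-path (2 ^ i) x)
      where
      either : ∀ {z z′ w w′} → Split i z z′ → Split j w w′ → EitherComparable (3 + countStage ϱ) z z′ w w′
      either sp sp′ = by (j ≤? i)
        where
        by : Dec (j ≤ i) → _
        by (yes j≤i) = inj₂ (comparable iso count j i (≤-trans (+-monoˡ-≤ j j≤i) ij≤) (≤-trans (≤-reflexive (+-comm j i)) ij≤) sp′ sp)
        by (no j≰i) = inj₁ (comparable iso count i j (≤-trans (+-monoʳ-≤ i (<⇒≤ (≰⇒> j≰i))) ij≤) ij≤ sp sp′)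
      build : (Σ (Fin N) λ y → Σ ℕ λ k → Path E₁ x k y × (∀ b → T (E₁ y b) → weight b < 2 ^ i) × (0 < k → 2 ^ i ≤ weight y)) →
              PathComparable (3 + countStage ϱ) x x*
      build (y , k , p , y-light , y-heavy) = record
        { path = p
        ; end = λ {y*} p* → either (split-centre i y (≤-<-trans (weight-path p) x-light) y-light)
                                    (split-light j y* y* (≤-<-trans (weight-path p*) x*-light))
        ; levels = λ {y*} {l} {z′} {z} {w′} {w} p* l<k q q* d d* →
            either (split-heavy-child i z z′ (proj₁ (path-siblings p (≤-trans x-light (≤-reflexive (double i))) y-heavy l<k q d)))
                   (split-light j w w′ (≤-<-trans (weight-path (path-≤ l<k (d* ∷ q*) p*)) x*-light)) }

    -- The tree with the larger exponent supplies the path, and its exponent falls by one. If both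
    -- exponents are 0, both trees are light and the stored relation decides.
    iso-step : ∀ ϱ → IsoKnown ϱ → CountKnown ϱ → IsoKnown (suc ϱ)
    iso-step ϱ iso count i j {x} {y} ij≤ x-light y-light = Step.isoRule-complete (3 + countStage ϱ)
        (dists-mono (≤-trans (dists≤isoStage ϱ) (m≤n+m _ 6)) all-dists) (cases i j ij≤ x-light y-light (≤-total j i))
      where
      cases : ∀ i j → i + j ≤ suc ϱ → weight x < 2 ^ i → weight y < 2 ^ j → j ≤ i ⊎ i ≤ j →
              PathComparable (3 + countStage ϱ) x y ⊎ PathComparable (3 + countStage ϱ) y x ⊎ (Light x × Light y)
      cases zero zero _ x-light y-light _ = inj₂ (inj₂ (weight≡0⇒light (n≤0⇒n≡0 (s≤s⁻¹ x-light)) , weight≡0⇒light (n≤0⇒n≡0 (s≤s⁻¹ y-light))))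
      cases (suc i) j ij≤ x-light y-light (inj₁ j≤i) = inj₁ (path-comparable iso count i j (s≤s⁻¹ ij≤) j≤i x-light y-light)
      cases i (suc j) ij≤ x-light y-light (inj₂ i≤j) = inj₂ (inj₁ (path-comparable iso count j i
        (s≤s⁻¹ (≤-trans (≤-reflexive (+-comm (suc j) i)) ij≤)) i≤j y-light x-light))

    iso-known : ∀ ϱ → IsoKnown ϱ
    count-known : ∀ ϱ → CountKnown ϱ
    iso-known zero zero zero z≤n x-light y-light = Step.isoRule-complete (suc r) all-dists
      (inj₂ (inj₂ (weight≡0⇒light (n≤0⇒n≡0 (s≤s⁻¹ x-light)) , weight≡0⇒light (n≤0⇒n≡0 (s≤s⁻¹ y-light)))))
    iso-known (suc ϱ) = iso-step ϱ (iso-known ϱ) (count-known ϱ)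
    count-known zero zero j ij≤ light u-light ≢z′ = count-quiet 0 (iso-known 0) j ij≤ (n≤0⇒n≡0 (s≤s⁻¹ light)) u-light ≢z′
    count-known (suc ϱ) = count-step ϱ (iso-known (suc ϱ)) (count-known ϱ)

    finalStage : ℕ
    finalStage = 3 + countStage (r + r)

    count-final : ∀ z z′ u lo hi → CountedAt finalStage z z′ u lo hi
    count-final z z′ u lo hi = by (in? lo hi z′)
      where
      small : ∀ lo hi → sumIn (childWeight z) lo hi < 2 ^ r
      small lo hi = ≤-<-trans (≤-trans (sumIn≤sum (childWeight z) lo hi) (childWeights≤weight z)) (bounded z)
      by : Dec (In lo hi z′) → CountedAt finalStage z z′ u lo hi
      by (no z′∉) = counted-mono (m≤n+m _ 3) (count-known (r + r) r r ≤-refl (small lo hi) (bounded u) λ { b b∈ _ refl → z′∉ b∈ })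
      by (yes z′∈) = count-around (count-known (r + r)) r r ≤-refl (bounded u) z′∈ (λ m _ _ → small lo m) (λ m _ _ → small m hi)
        (λ b _ b≢ _ → b≢) ≤-refl λ h → ⊥-elim (proj₂ h refl)

    truth⇒final : ∀ g → Truth E₁ g → S finalStage g
    truth⇒final g = by-tags (toℕ (g 6F)) (toℕ (g 7F)) refl refl
      where
      compared : ∀ x y → ComparedAt finalStage x y
      compared x y = compared-mono (m≤n+m _ 6) (iso-known (r + r) r r ≤-refl (bounded x) (bounded y))
      known : suc r ≤ finalStage
      known = ≤-trans (dists≤isoStage (r + r)) (m≤n+m _ 6)
      suc≢0 : ∀ {a b} → a ≡ suc b → a ≢ 0
      suc≢0 refl ()
      by-tags : ∀ p q → toℕ (g 6F) ≡ p → toℕ (g 7F) ≡ q → Judgement E₁ p q (g 0F) (g 1F) (g 2F) (g 3F) (g 4F) (g 5F) → S finalStage g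
      by-tags zero zero p q c = proj₁ (compared _ _) c g refl refl p q
      by-tags zero (suc _) p q c = proj₂ (compared _ _) c g refl refl p (suc≢0 q)
      by-tags (suc _) zero p q path = dists-mono known all-dists _ _ _ path g refl refl refl (suc≢0 p) q
      by-tags (suc _) (suc _) p q c = count-final (g 0F) (g 1F) (g 2F) (g 3F) (g 4F) g refl refl refl refl refl (sym c) (suc≢0 p) (suc≢0 q)

    truth⇒stage : ∀ {t} → finalStage ≤ t → ∀ g → Truth E₁ g → stage rules 𝒮 t g
    truth⇒stage t≥ g j = derived (stage-mono t≥ g (truth⇒final g j))

    isoStage≡ : ∀ ϱ → isoStage ϱ ≡ 7 * ϱ + (2 + r)
    isoStage≡ zero = refl
    isoStage≡ (suc ϱ) = trans (cong (7 +_) (isoStage≡ ϱ)) (trans (sym (+-assoc 7 (7 * ϱ) (2 + r))) (cong (_+ (2 + r)) (sym (*-suc 7 ϱ))))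

-- The program

list-sum : ∀ {N} (f : Fin N → ℕ) → List.sum (map f (allFin N)) ≡ sum f
list-sum f = trans (cong List.sum (map-tabulate id f)) (go f)
  where
  go : ∀ {N} (f : Fin N → ℕ) → List.sum (tabulate f) ≡ sum f
  go {zero} f = refl
  go {suc N} f = cong (f zero +_) (go (f ∘ suc))

card-sum : ∀ {N} (R : BRel N) → card R ≡ sum (λ u → sum (λ v → if R u v then 1 else 0))
card-sum R = trans (list-sum (λ u → List.sum (map (λ v → if R u v then 1 else 0) (allFin _))))
  (sum-cong-≗ λ u → list-sum (λ v → if R u v then 1 else 0))

diff≤ : ∀ {N} (E : BRel N) τ (Δ : BRel N) u v → 𝟙 (¬? (E u v ≟B applyChange E (τ , Δ) u v)) ≤ (if Δ u v then 1 else 0)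
diff≤ E ins Δ u v with E u v | Δ u v
... | true | _ = z≤n
... | false | true = ≤-refl
... | false | false = z≤n
diff≤ E del Δ u v with E u v | Δ u v
... | true | true = ≤-refl
... | true | false = z≤n
... | false | _ = z≤n

n<2^[1+log₂n] : ∀ n → n < 2 ^ suc ⌊log₂ n ⌋
n<2^[1+log₂n] n = ≰⇒> λ h → <-irrefl refl (≤-trans (≤-reflexive (sym (⌊log₂[2^n]⌋≡n (suc ⌊log₂ n ⌋)))) (⌊log₂⌋-mono-≤ h))

module _ (c : ℕ) where

  -- The judgements true in the empty forest: all codes are 0, so no pair is non-isomorphic, all
  -- paths have length 0, and all counts are 0.
  initW : Fm 8
  initW = disj (conj (zeroF 6F) (zeroF 7F))
    (disj (conj (neg (zeroF 6F)) (conj (zeroF 7F) (conj (eqF 0F 1F) (zeroF 2F))))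
          (conj (neg (zeroF 6F)) (conj (neg (zeroF 7F)) (zeroF 5F))))

  -- With b = `bits`, the derivations take 3 + 3 + 7(b + b) + (2 + b) = 8 + 15b rounds. For b = 1 +
  -- (1 + l)c, where l = `loglog`, this is 23 + 15c(l + 1), at most (23 + 15c)(l + 1).
  rate : ℕ
  rate = 23 + 15 * c

  initially : (i : Fin 3) → Fm (arity i)
  initially 0F = initW
  initially 1F = eqF 0F 0F
  initially 2F = neg (eqF 0F 0F)

  updates : ChangeType → (i : Fin 3) → IterFO 3 arity (arity i)
  updates _ 0F = Compile.iterFO rules rate
  -- Padding with 0 sets both tags to 0, so this section of the relation is isomorphism.
  updates _ 1F = CompilePair.iterFO₂ rules rate
  updates _ 2F = record { k = 0 ; block = [] ; base = inp 0F 1F ; d = 0 }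

  program : DynFOLLProgram
  program = record { m = 3 ; ar = arity ; init = initially ; update = updates ; q = 1F ; q-bin = refl }

  -- The invariant of the program and its preservation

  record Inv {n : ℕ} (E : BRel (suc n)) (A : AuxState (suc n) 3 arity) : Set where
    field
      W-sound : ∀ g → A 0F g → Truth E g
      W-complete : ∀ g → Truth E g → A 0F g
      Q-sound : ∀ g → A 1F g → code E (g 0F) ≡ code E (g 1F)
      Q-complete : ∀ g → code E (g 0F) ≡ code E (g 1F) → A 1F g
      edge-sound : ∀ g → A 2F g → T (E (g 0F) (g 1F))
      edge-complete : ∀ g → T (E (g 0F) (g 1F)) → A 2F g

  truth-ext : ∀ {N} (E : BRel N) g h → (∀ i → g i ≡ h i) → Truth E g → Truth E h
  truth-ext E g h e p rewrite sym (e 0F) | sym (e 1F) | sym (e 2F) | sym (e 3F) | sym (e 4F) | sym (e 5F) | sym (e 6F) | sym (e 7F) = p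

  inv-ext : ∀ {n} {E E′ Δ : BRel (suc n)} {A} → Inv E A → Extensional (record { E = E′ ; Δ = Δ ; A = A })
  inv-ext {E = E} I 0F g h e p = Inv.W-complete I h (truth-ext E g h e (Inv.W-sound I g p))
  inv-ext {E = E} I 1F g h e p = Inv.Q-complete I h (subst₂ (λ x y → code E x ≡ code E y) (e 0F) (e 1F) (Inv.Q-sound I g p))
  inv-ext {E = E} I 2F g h e p = Inv.edge-complete I h (subst₂ (λ x y → T (E x y)) (e 0F) (e 1F) (Inv.edge-sound I g p))

  module _ {n : ℕ} where
    L : ℕ
    L = ⌊log₂ suc n ⌋

    rounds : ℕ
    rounds = rate * (loglog (suc n) + 1)

    -- `L` is below 2 to the power `suc (loglog (suc n))`; the c-th power multiplies this exponent
    -- by `c`, and one more bit makes the bound strict even for `c = 0`.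
    bits : ℕ
    bits = suc (suc (loglog (suc n)) * c)

    log^c<2^bits : L ^ c < 2 ^ bits
    log^c<2^bits = ≤-<-trans (≤-trans (^-monoˡ-≤ c (<⇒≤ (n<2^[1+log₂n] L))) (≤-reflexive (^-*-assoc 2 (suc (loglog (suc n))) c)))
      (^-monoʳ-< 2 (s≤s (s≤s z≤n)) {exponent} (n<1+n exponent))
      where exponent = suc (loglog (suc n)) * c

    rounds-suc : Σ ℕ λ t → suc t ≡ rounds
    rounds-suc = loglog (suc n) + (22 + 15 * c) * suc (loglog (suc n)) , cong (rate *_) (+-comm 1 (loglog (suc n)))

    rounds-suffice : 3 + (3 + (7 * (bits + bits) + (2 + bits))) ≤ rounds
    rounds-suffice = ≤-trans (m≤m+n _ (23 * loglog (suc n))) (≤-reflexive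
      (solve 2 (λ l c → let b = con 1 :+ (con 1 :+ l) :* c in
        con 3 :+ (con 3 :+ (con 7 :* (b :+ b) :+ (con 2 :+ b))) :+ con 23 :* l := (con 23 :+ con 15 :* c) :* (l :+ con 1)) refl (loglog (suc n)) c))
      where open +-*-Solver

  least⇒0 : ∀ {n} (x : Fin (suc n)) → (∀ (v : Fin (suc n)) → toℕ x ≤ toℕ v) → toℕ x ≡ 0
  least⇒0 x h = n≤0⇒n≡0 (h zero)

  0⇒least : ∀ {n} (x : Fin (suc n)) → toℕ x ≡ 0 → ∀ (v : Fin (suc n)) → toℕ x ≤ toℕ v
  0⇒least x e v = ≤-trans (≤-reflexive e) z≤n

  module Initially {n : ℕ} where

    empty : BRel (suc n)
    empty = emptyRel

    forest : IsForest empty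
    forest = (λ _ _ _ ()) , λ _ _ ()

    code-empty : ∀ x → code empty x ≡ 0
    code-empty x = sum-≡0 {suc n} (λ _ → refl)

    hangsIn-empty : ∀ z z′ v lo hi → hangsIn empty z z′ v lo hi ≡ 0
    hangsIn-empty z z′ v lo hi = sumIn-≡0 {f = λ b → 𝟙 (hangOf? empty z z′ v b)} {lo} {hi} λ b _ → 𝟙-no (hangOf? empty z z′ v b) λ { ((() , _) , _) }

    path-empty : ∀ {x k y} → Path empty x k y → x ≡ y × k ≡ 0
    path-empty [] = refl , refl

    state : AuxState (suc n) 3 arity
    state = initState program

    inv : Inv empty state
    inv = record
      { W-sound = W-sound
      ; W-complete = λ g → W-complete g (toℕ (g 6F)) (toℕ (g 7F)) refl refl
      ; Q-sound = λ g _ → trans (code-empty (g 0F)) (sym (code-empty (g 1F)))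
      ; Q-complete = λ _ _ → ≤-refl , ≤-refl
      ; edge-sound = λ g h → ⊥-elim (h (≤-refl , ≤-refl))
      ; edge-complete = λ _ () }
      where
      positive : ∀ (x : Fin (suc n)) → ¬ (∀ (v : Fin (suc n)) → toℕ x ≤ toℕ v) → Σ ℕ λ k → toℕ x ≡ suc k
      positive zero h = ⊥-elim (h λ _ → z≤n)
      positive (suc x) h = toℕ x , refl
      suc≢0 : ∀ (x : Fin (suc n)) {k} → toℕ x ≡ suc k → ¬ (∀ (v : Fin (suc n)) → toℕ x ≤ toℕ v)
      suc≢0 x e h with trans (sym e) (least⇒0 x h)
      ... | ()
      W-sound : ∀ g → state 0F g → Truth empty g
      W-sound g (inj₁ (p , q)) = truth empty g (least⇒0 (g 6F) p) (least⇒0 (g 7F) q) (trans (code-empty (g 0F)) (sym (code-empty (g 1F))))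
      W-sound g (inj₂ (inj₁ (p , q , (a , b) , d))) = truth empty g (proj₂ (positive (g 6F) p)) (least⇒0 (g 7F) q)
        (subst₂ (λ k y → Path empty (g 0F) k y) (sym (least⇒0 (g 2F) d)) (toℕ-injective (≤-antisym a b)) [])
      W-sound g (inj₂ (inj₂ (p , q , d))) = truth empty g (proj₂ (positive (g 6F) p)) (proj₂ (positive (g 7F) q))
        (trans (hangsIn-empty (g 0F) (g 1F) (code empty (g 2F)) (g 3F) (g 4F)) (sym (least⇒0 (g 5F) d)))
      W-complete : ∀ g p q → toℕ (g 6F) ≡ p → toℕ (g 7F) ≡ q → Judgement empty p q (g 0F) (g 1F) (g 2F) (g 3F) (g 4F) (g 5F) → state 0F g
      W-complete g zero zero p q j = inj₁ (0⇒least (g 6F) p , 0⇒least (g 7F) q)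
      W-complete g zero (suc _) p q j = ⊥-elim (j (trans (code-empty (g 0F)) (sym (code-empty (g 1F)))))
      W-complete g (suc _) zero p q j = inj₂ (inj₁ (suc≢0 (g 6F) p , 0⇒least (g 7F) q ,
        (≤-reflexive (cong toℕ (proj₁ (path-empty j))) , ≤-reflexive (cong toℕ (sym (proj₁ (path-empty j))))) , 0⇒least (g 2F) (proj₂ (path-empty j))))
      W-complete g (suc _) (suc _) p q j = inj₂ (inj₂ (suc≢0 (g 6F) p , suc≢0 (g 7F) q , 0⇒least (g 5F) (trans (sym j) (hangsIn-empty (g 0F) (g 1F) (code empty (g 2F)) (g 3F) (g 4F)))))

  -- Both tags are 0 and both nodes coincide, so every tuple is a true isomorphism judgement. This
  -- matches the value that the guard of the compiled block gives on such a domain.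
  truth-one : ∀ {n} → (∀ (x y : Fin (suc n)) → x ≡ y) → (E : BRel (suc n)) (g : Fin 8 → Fin (suc n)) → Truth E g
  truth-one one E g = truth E g (cong toℕ (one (g 6F) zero)) (cong toℕ (one (g 7F) zero)) (cong (code E) (one (g 0F) (g 1F)))

  module StepInv {n : ℕ} (E : BRel (suc n)) (A : AuxState (suc n) 3 arity) (τ : ChangeType) (Δ : BRel (suc n))
                 (I : Inv E A) (F : IsForest E) (allowed : Allowed c E (τ , Δ)) where
    E₁ : BRel (suc n)
    E₁ = applyChange E (τ , Δ)

    𝒮 : Structure (suc n) 3 arity
    𝒮 = record { E = E₁ ; Δ = Δ ; A = A }

    module W = Compile.Evaluation rules 𝒮 (inv-ext {E = E} {E₁} {Δ} {A} I) rate
    module Q = CompilePair.PairEvaluation rules 𝒮 (inv-ext {E = E} {E₁} {Δ} {A} I) rate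

    trivial-inv : (∀ (x y : Fin (suc n)) → x ≡ y) → Inv E₁ (step program E A (τ , Δ))
    trivial-inv one = record
      { W-sound = λ g _ → truth-one one E₁ g
      ; W-complete = λ g _ → W.eval-trivial one (proj₁ (rounds-suc {n})) (proj₂ (rounds-suc {n})) g
      ; Q-sound = λ g _ → cong (code E₁) (one (g 0F) (g 1F))
      ; Q-complete = λ g _ → Q.eval-trivial one (proj₁ (rounds-suc {n})) (proj₂ (rounds-suc {n})) g
      ; edge-sound = λ _ p → p
      ; edge-complete = λ _ p → p }

    module _ {m : ℕ} (n≡ : n ≡ suc m) where
      top≡suc : toℕ (fromℕ n) ≡ suc m
      top≡suc = trans (toℕ-fromℕ n) n≡

      ≤top : ∀ (b : Fin (suc n)) → toℕ b ≤ toℕ (fromℕ n)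
      ≤top b = ≤-trans (toℕ≤pred[n] b) (≤-reflexive (sym (toℕ-fromℕ n)))

      bot≢top : zero ≢ fromℕ n
      bot≢top e with trans (cong toℕ e) top≡suc
      ... | ()

      open Inv I
      open Rules.Update zero (fromℕ n) refl top≡suc ≤top E E₁ Δ F (proj₂ allowed) A W-sound W-complete edge-sound edge-complete using (stage-sound)
      open Change E E₁ F (proj₂ allowed) using (weight; weight≤degrees)

      -- A pair on which the two forests differ belongs to `Δ`, so the weight is at most the number
      -- of pairs in the change.
      bounded : ∀ x → weight x < 2 ^ bits {n}
      bounded x = ≤-<-trans (≤-trans (weight≤degrees x) (≤-trans (sum-mono λ u → sum-mono λ v → diff≤ E τ Δ u v)
        (≤-trans (≤-reflexive (sym (card-sum Δ))) (proj₁ allowed)))) (log^c<2^bits {n})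

      module B = Completeness.Bounded zero (fromℕ n) refl top≡suc ≤top E E₁ Δ F (proj₂ allowed) A W-sound W-complete edge-sound edge-complete
                   (bits {n}) bounded

      stage-complete : ∀ g → Truth E₁ g → stage rules 𝒮 (rounds {n}) g
      stage-complete g = B.truth⇒stage (≤-trans (≤-reflexive (cong (λ s → 3 + (3 + s)) (B.isoStage≡ (bits {n} + bits {n})))) (rounds-suffice {n})) g

      proper-inv : Inv E₁ (step program E A (τ , Δ))
      proper-inv = record
        { W-sound = λ g p → stage-sound (rounds {n}) g (W.eval-⇒ zero (fromℕ n) bot≢top g p)
        ; W-complete = λ g j → W.eval-⇐ zero (fromℕ n) bot≢top g (stage-complete g j)
        ; Q-sound = λ g p → stage-sound (rounds {n}) (CompilePair.padded rules g) (Q.eval-⇒ zero (fromℕ n) bot≢top g p)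
        ; Q-complete = λ g j → Q.eval-⇐ zero (fromℕ n) bot≢top g (stage-complete (CompilePair.padded rules g) j)
        ; edge-sound = λ _ p → p
        ; edge-complete = λ _ p → p }

    step-inv : Inv E₁ (step program E A (τ , Δ))
    step-inv = by-size n refl
      where
      one : n ≡ 0 → ∀ (x y : Fin (suc n)) → x ≡ y
      one e x y = toℕ-injective (trans (zero-only x) (sym (zero-only y)))
        where
        zero-only : ∀ (x : Fin (suc n)) → toℕ x ≡ 0
        zero-only x = n≤0⇒n≡0 (≤-trans (toℕ≤pred[n] x) (≤-reflexive e))
      by-size : ∀ k → n ≡ k → Inv E₁ (step program E A (τ , Δ))
      by-size zero e = trivial-inv (one e)
      by-size (suc m) e = proper-inv e

  run-inv : ∀ {n} (chs : List (Change (suc n))) E A → Inv E A → IsForest E → ValidSeq c E chs →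
            Inv (proj₁ (run program E A chs)) (proj₂ (run program E A chs)) × IsForest (proj₁ (run program E A chs))
  run-inv [] E A I F v = I , F
  run-inv (ch ∷ chs) E A I F (allowed , v) = run-inv chs _ _ (StepInv.step-inv E A (proj₁ ch) (proj₂ ch) I F allowed) (proj₂ allowed) v

  program-maintains : MaintainsTreeIso program c
  program-maintains n chs valid x y with run-inv chs _ _ Initially.inv Initially.forest valid
  ... | I , F = mk⇔ (λ p → Equivalence.from (Isomorphism.iso⇔code _ F x y) (Inv.Q-sound I _ p))
                    (λ iso → Inv.Q-complete I _ (Equivalence.to (Isomorphism.iso⇔code _ F x y) iso))

theorem12 : (c : ℕ) → Σ DynFOLLProgram (λ P → MaintainsTreeIso P c)
theorem12 c = program c , program-maintains c
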